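{- Let $EP$ be a maximal planar graph belonging to $e\mathcal{MPGN}4$. Suppose $EP$ contains a "dumbbell" configuration: adjacent vertices $a,b$ with $\deg(a)=\deg(b)=5$, whose two common neighbors (the third vertices of the two triangular faces containing $ab$) are $c$ and $d$; the neighbors of $a$ in cyclic order are $b,d,v_1,v_2,c$ and the neighbors of $b$ in cyclic order are $a,c,v_4,v_5,d$ (so $v_1$-$v_2$-$c$-$v_4$-$v_5$-$d$-$v_1$ is the 6-cycle of vertices surrounding $\{a,b\}$); moreover $$\deg(v_1)=\deg(v_2)=\deg(v_4)=\deg(v_5)=5,$$ so that $a v_1 v_2$ and $b v_4 v_5$ are triangles, and the vertices surrounding $\{a,b,v_1,v_2,v_4,v_5\}$ form the 8-cycle $d$-$u_1$-$u_2$-$u_3$-$c$-$u_4$-$u_5$-$u_6$-$d$, where $u_2$ is the common neighbor of $v_1,v_2$ other than $a$ and $u_5$ is the common neighbor of $v_4,v_5$ other than $b$. Then $\deg(c)\ge 8$ and $\deg(d)\ge 8$.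
   Context: All graphs are simple and connected. A maximal planar graph (MPG) is a planar graph to which no edge can be added while preserving planarity; equivalently (with at least 3 vertices) a plane graph all of whose faces are triangles. Let $\mathcal{N}4$ be the set of simple connected planar graphs that are not 4-colorable (proper vertex coloring with 4 colors). Let $e\mathcal{MPGN}4$ be the set of those $EP\in\mathcal{N}4$ that are MPGs and have the minimum number of vertices among graphs in $\mathcal{N}4$. (The statement is a claim about this hypothetical class; it is used in an approach to the Four Color Theorem by contradiction.) -}

module Defs where

open import Data.Nat using (ℕ; zero; suc; _+_; _*_; _≤_; _≤ᵇ_)
open import Data.Bool using (Bool; true; false; _∧_; if_then_else_)
open import Data.Fin using (Fin; toℕ; _≟_)
open import Data.List using (List; map; allFin; upTo)
open import Data.Bool.ListAction using (and)
open import Data.Nat.ListAction using (sum)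
open import Data.Product using (Σ; ∃; _×_; _,_; proj₁; proj₂)
open import Data.Sum using (_⊎_)
open import Relation.Binary.PropositionalEquality using (_≡_; _≢_)
open import Relation.Nullary using (¬_; does)

record Graph (n : ℕ) : Set where
  field
    adj    : Fin n → Fin n → Bool
    sym    : ∀ u v → adj u v ≡ adj v u
    irrefl : ∀ v → adj v v ≡ false
open Graph public

Adj : ∀ {n} → Graph n → Fin n → Fin n → Set
Adj G u v = adj G u v ≡ true

deg : ∀ {n} → Graph n → Fin n → ℕ
deg {n} G v = sum (map (λ w → if adj G v w then 1 else 0) (allFin n))

degSum : ∀ {n} → Graph n → ℕ
degSum {n} G = sum (map (deg G) (allFin n))

data Walk {n} (G : Graph n) : Fin n → Fin n → Set where
  here : ∀ {u} → Walk G u u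
  step : ∀ {u w v} → Adj G u w → Walk G w v → Walk G u v

Connected : ∀ {n} → Graph n → Set
Connected {n} G = ∀ (u v : Fin n) → Walk G u v

Colorable : ∀ {n} → Graph n → ℕ → Set
Colorable {n} G k =
  Σ (Fin n → Fin k) λ f → ∀ u v → Adj G u v → f u ≢ f v

iter : ∀ {A : Set} → (A → A) → ℕ → A → A
iter f zero x = x
iter f (suc k) x = f (iter f k x)

-- Rotation system (combinatorial embedding): rot v is a cyclic permutation
-- of the neighbourhood of v; rot v w is the neighbour following w around v.
record Rotation {n} (G : Graph n) : Set where
  field
    rot     : Fin n → Fin n → Fin n
    rot-adj : ∀ v w → Adj G v w → Adj G v (rot v w)
    rot-inj : ∀ v w w' → Adj G v w → Adj G v w' → rot v w ≡ rot v w' → w ≡ w'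
    rot-cyc : ∀ v w w' → Adj G v w → Adj G v w' → ∃ λ k → iter (rot v) k w ≡ w'
open Rotation public

faceStep : ∀ {n} {G : Graph n} → Rotation G → Fin n × Fin n → Fin n × Fin n
faceStep ρ (u , w) = (w , rot ρ w u)

dartCode : ∀ {n} → Fin n × Fin n → ℕ
dartCode {n} (u , w) = toℕ u * n + toℕ w

-- a dart is the representative of its face (orbit) if it has the least code
-- in its orbit (orbits have length ≤ n * n)
isRep : ∀ {n} {G : Graph n} → Rotation G → Fin n × Fin n → Bool
isRep {n} ρ d =
  and (map (λ k → dartCode d ≤ᵇ dartCode (iter (faceStep ρ) k d)) (upTo (n * n)))

-- number of faces of the embedding = number of orbits of faceStep on darts
faces : ∀ {n} {G : Graph n} → Rotation G → ℕ
faces {n} {G} ρ =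
  sum (map (λ u → sum (map (λ w → if adj G u w ∧ isRep ρ (u , w) then 1 else 0)
                           (allFin n)))
           (allFin n))

-- a rotation system is a planar embedding iff Euler's formula V - E + F = 2
-- holds (genus 0), written as 2V + 2F = 2E + 4
PlanarRot : ∀ {n} {G : Graph n} → Rotation G → Set
PlanarRot {n} {G} ρ = 2 * n + 2 * faces ρ ≡ degSum G + 4

-- planar (connected) graph: trivial graph, or has a genus-0 rotation system
Planar : ∀ {n} → Graph n → Set
Planar {n} G = n ≤ 1 ⊎ Σ (Rotation G) PlanarRot

addEdge : ∀ {n} → Graph n → (u v : Fin n) → u ≢ v → Graph n
addEdge {n} G u v u≢v = record
  { adj = λ x y → adj G x y ∨' isPair x y
  ; sym = symP
  ; irrefl = irr
  }
  where
  open import Data.Bool using (_∨_)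
  open import Relation.Nullary using (yes; no)
  open import Relation.Binary.PropositionalEquality using (refl; cong₂; trans; sym)
  _∨'_ = _∨_
  isPair : Fin n → Fin n → Bool
  isPair x y = (does (x ≟ u) ∧ does (y ≟ v)) ∨ (does (x ≟ v) ∧ does (y ≟ u))
  ∧-comm : ∀ a b → (a ∧ b) ≡ (b ∧ a)
  ∧-comm false false = refl
  ∧-comm false true = refl
  ∧-comm true false = refl
  ∧-comm true true = refl
  ∨-comm : ∀ a b → (a ∨ b) ≡ (b ∨ a)
  ∨-comm false false = refl
  ∨-comm false true = refl
  ∨-comm true false = refl
  ∨-comm true true = refl
  isPair-sym : ∀ x y → isPair x y ≡ isPair y x
  isPair-sym x y =
    trans (cong₂ _∨_ (∧-comm (does (x ≟ u)) (does (y ≟ v)))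
                     (∧-comm (does (x ≟ v)) (does (y ≟ u))))
          (∨-comm (does (y ≟ v) ∧ does (x ≟ u)) (does (y ≟ u) ∧ does (x ≟ v)))
  symP : ∀ x y → (adj G x y ∨ isPair x y) ≡ (adj G y x ∨ isPair y x)
  symP x y = cong₂ _∨_ (Graph.sym G x y) (isPair-sym x y)
  irr : ∀ x → (adj G x x ∨ isPair x x) ≡ false
  irr x with adj G x x | Graph.irrefl G x
  ... | false | _ with x ≟ u | x ≟ v
  ...   | yes refl | yes refl = Data.Empty.⊥-elim (u≢v refl)
    where import Data.Empty
  ...   | yes _ | no _ = refl
  ...   | no _ | yes _ = refl
  ...   | no _ | no _ = refl

MPG : ∀ {n} → Graph n → Set
MPG {n} G = Planar G ×
  (∀ (u v : Fin n) (u≢v : u ≢ v) → adj G u v ≡ false → ¬ Planar (addEdge G u v u≢v))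

N4 : ∀ {n} → Graph n → Set
N4 G = Connected G × Planar G × ¬ Colorable G 4

eMPGN4 : ∀ {n} → Graph n → Set
eMPGN4 {n} G = N4 G × MPG G × (∀ (m : ℕ) (H : Graph m) → N4 H → n ≤ m)

-- If c had degree at most 7, its neighbours would be u₄, v₄, b, a, v₂, u₃ and at most one more
-- vertex, so that the seven vertices a, b, v₁, v₂, v₄, v₅, c fill a disc bounded by a ring of
-- seven or eight vertices.  By minimality G − a, hence the part of G outside the disc, has a
-- 4-colouring.  Exchanging two colours along Kempe chains turns it into one which extends to the
-- disc: each ring colouring gets a level, and for a suitable pairing of the colours every planar
-- arrangement of the chains has a chain whose exchange lowers the level, while the colourings of
-- level 0 extend.  The half turn of the dumbbell exchanges c and d.
--
-- All topology comes from counting in 𝔽₂-vector spaces.  For a connected rotation system the vertex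
-- potentials and the dual paths between faces are independent edge functions, whence
-- V + F ≤ E + 2; in case of equality there is no room for a further closed edge function, so H¹
-- vanishes and two closed walks cross an even number of times.  This rules out crossing chains and
-- makes the faces of a maximal planar graph triangles.  Since V + F ≤ E + 2 always holds, planarity
-- after adding a chord to a face or deleting a vertex only requires exhibiting enough faces.

module Submission where

open import Data.Bool using (Bool; true; false; _∧_; _xor_; not; if_then_else_; _∨_; T)
import Data.Bool as Bool
open import Data.Bool.ListAction using (and; all; any)
open import Data.Bool.Properties
  using (xor-same; xor-comm; xor-assoc; xor-identityʳ; ∧-distribˡ-xor; ∧-zeroʳ; ∧-identityʳ;
         ∧-distribʳ-xor; T-≡; not-involutive)
open import Data.Bool.Solver using (module xor-∧-Solver)
open import Data.Empty using (⊥; ⊥-elim)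
open import Data.Fin
  using (Fin; zero; suc; toℕ; _≟_; _↑ˡ_; _↑ʳ_; splitAt; funToFin; finToFun; combine; punchIn;
         punchOut; #_)
open import Data.Fin.Properties
  using (injective⇒≤; funToFin-finToFin; finToFun-funToFin; pigeonhole; combine-injective;
         toℕ-combine; toℕ-injective; toℕ<n; splitAt⁻¹-↑ˡ; splitAt⁻¹-↑ʳ; punchIn-injective;
         punchInᵢ≢i; punchIn-punchOut)
open import Data.List
  using (List; []; _∷_; _++_; map; filter; length; allFin; cartesianProduct; upTo; lookup)
open import Data.List.Membership.Propositional using (_∈_; _∉_)
open import Data.List.Membership.Propositional.Properties
  using (∈-filter⁺; ∈-filter⁻; ∈-map⁺; ∈-map⁻; ∈-lookup; ∈-allFin; ∈-cartesianProduct⁺; ∈-upTo⁺;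
         ∈-++⁺ˡ; ∈-++⁺ʳ; ∈-++⁻)
open import Data.List.Membership.Propositional.Properties.WithK using (unique∧set⇒bag)
open import Data.List.Properties using (length-map; length-++; filter-++)
open import Data.List.Relation.Binary.BagAndSetEquality using (∼bag⇒↭)
open import Data.List.Relation.Binary.Permutation.Propositional using (_↭_; ↭⇒↭ₛ)
open import Data.List.Relation.Binary.Permutation.Propositional.Properties using (++-comm)
import Data.List.Relation.Binary.Permutation.Setoid.Properties as Permutationₛ
open import Data.List.Relation.Unary.All as All using (All; []; _∷_)
open import Data.List.Relation.Unary.All.Properties using (All¬⇒¬Any; ¬Any⇒All¬; applyUpTo⁻)
open import Data.List.Relation.Unary.AllPairs using (AllPairs; []; _∷_)
open import Data.List.Relation.Unary.Any as Any using (here; there)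
open import Data.List.Relation.Unary.Any.Properties using (lookup-index)
open import Data.List.Relation.Unary.Unique.Propositional using (Unique)
open import Data.List.Relation.Unary.Unique.Propositional.Properties
  using (map⁺; filter⁺; Unique[x∷xs]⇒x∉xs; allFin⁺; cartesianProduct⁺; ++⁺)
open import Data.Maybe using (Maybe; just; nothing; _<∣>_; maybe′)
open import Data.Nat
  using (ℕ; zero; suc; _+_; _*_; _^_; _≤_; _<_; z≤n; s≤s; _∸_; _≤ᵇ_; _<ᵇ_; _≡ᵇ_; _/_; _%_)
import Data.Nat as ℕ
open import Data.Nat.Induction using (<-wellFounded)
open import Data.Nat.ListAction using (sum)
open import Data.Nat.Properties hiding (_≟_)
open import Data.Nat.Solver using (module +-*-Solver)
open import Data.Product using (Σ; ∃; _×_; _,_; proj₁; proj₂; swap)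
open import Data.Product.Properties using (≡-dec; ,-injectiveˡ; ,-injectiveʳ)
open import Data.Sum using (_⊎_; inj₁; inj₂)
open import Defs renaming (sym to adj-sym; irrefl to adj-irrefl)
open import Function using (_∘_; id; mk⇔; const)
open import Function.Bundles using (Equivalence)
open import Induction.WellFounded using (Acc; acc)
open import Relation.Binary.Construct.Closure.ReflexiveTransitive
  using (Star; ε; _◅_; _◅◅_; gmap; reverse)
open import Relation.Binary.PropositionalEquality
  using (_≡_; _≢_; refl; sym; trans; cong; cong₂; subst; subst₂; ≢-sym; setoid)
open import Relation.Nullary using (¬_; Dec; yes; no; does)
open import Relation.Nullary.Decidable
  using (dec-true; dec-false; ¬?; ¬¬-excluded-middle; False; toWitnessFalse)

-- Sums over 𝔽₂

-- Both configurations are D-reducible: every proper ring colouring, not only a chosen few, can be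
-- driven to one that extends. Hence no contraction occurs, and minimality enters through one
-- deleted vertex. Which degree case holds is decided by comparing two vertices, so degrees 6 and 7
-- only have to yield a contradiction; the colouring of G - a and the chain components are therefore
-- used under double negation. Possible coincidences of vertices shape the geometry. The hypotheses
-- make eight outer vertices distinct but do not say that an inner vertex of one half differs from
-- the vertices of the other half; degree 5 determines the neighbourhoods completely and rules this
-- out. The seventh neighbour of c is not shown to differ from all other ring vertices. The ring is
-- therefore a sequence of positions, and a position is recognised by a spoke into the disc rather
-- than by its vertex. Dimensions are compared on darts: the 2E darts hold two copies of a space of
-- edge functions, so 2((V - 1) + (F - 1)) ≤ `degSum` needs no list of edges and, by counting
-- vectors, no bases.

⨁ : ∀ {A : Set} → (A → Bool) → List A → Bool
⨁ h []       = false
⨁ h (x ∷ xs) = h x xor ⨁ h xs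

interchange : ∀ a b c d → (a xor b) xor (c xor d) ≡ (a xor c) xor (b xor d)
interchange = solve 4 (λ a b c d → (a :+ b) :+ (c :+ d) := (a :+ c) :+ (b :+ d)) refl
  where open xor-∧-Solver

xor-telescope : ∀ a b c → (a xor b) xor (b xor c) ≡ a xor c
xor-telescope = solve 3 (λ a b c → (a :+ b) :+ (b :+ c) := a :+ c) refl
  where open xor-∧-Solver

xor-cancelˡ : ∀ a b → a xor (a xor b) ≡ b
xor-cancelˡ = solve 2 (λ a b → a :+ (a :+ b) := b) refl
  where open xor-∧-Solver

module _ {A : Set} where

  ⨁-cong : ∀ {g h : A → Bool} xs → (∀ {x} → x ∈ xs → g x ≡ h x) → ⨁ g xs ≡ ⨁ h xs
  ⨁-cong []       e = refl
  ⨁-cong (x ∷ xs) e = cong₂ _xor_ (e (here refl)) (⨁-cong xs (e ∘ there))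

  ⨁-xor : ∀ (g h : A → Bool) xs → ⨁ (λ x → g x xor h x) xs ≡ ⨁ g xs xor ⨁ h xs
  ⨁-xor g h []       = refl
  ⨁-xor g h (x ∷ xs) =
    trans (cong ((g x xor h x) xor_) (⨁-xor g h xs)) (interchange (g x) (h x) _ _)

  ⨁-false : ∀ {h : A → Bool} xs → (∀ {x} → x ∈ xs → h x ≡ false) → ⨁ h xs ≡ false
  ⨁-false []       e = refl
  ⨁-false (x ∷ xs) e = cong₂ _xor_ (e (here refl)) (⨁-false xs (e ∘ there))

  ⨁-∧ : ∀ b (h : A → Bool) xs → ⨁ (λ x → b ∧ h x) xs ≡ b ∧ ⨁ h xs
  ⨁-∧ true  h xs = refl
  ⨁-∧ false h xs = ⨁-false xs (λ _ → refl)

  ⨁-↭ : ∀ {xs ys} (h : A → Bool) → xs ↭ ys → ⨁ h xs ≡ ⨁ h ys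
  ⨁-↭ h _↭_.refl         = refl
  ⨁-↭ h (_↭_.prep x p)   = cong (h x xor_) (⨁-↭ h p)
  ⨁-↭ h (_↭_.swap {xs = xs} {ys} x y p) =
    trans (cong (λ r → h x xor (h y xor r)) (⨁-↭ h p)) (lemma (h x) (h y) (⨁ h ys))
    where
    open xor-∧-Solver
    lemma : ∀ a b c → a xor (b xor c) ≡ b xor (a xor c)
    lemma = solve 3 (λ a b c → a :+ (b :+ c) := b :+ (a :+ c)) refl
  ⨁-↭ h (_↭_.trans p q) = trans (⨁-↭ h p) (⨁-↭ h q)

  ⨁-single : ∀ {h : A → Bool} {x xs} → Unique xs → x ∈ xs →
    (∀ {y} → y ∈ xs → y ≢ x → h y ≡ false) → ⨁ h xs ≡ h x
  ⨁-single {h} {x} {y ∷ ys} u@(_ ∷ _) (here refl) z =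
    trans (cong (h y xor_) (⨁-false ys λ y∈ → z (there y∈) λ { refl → Unique[x∷xs]⇒x∉xs u y∈ }))
          (xor-identityʳ (h y))
  ⨁-single {h} {x} {y ∷ ys} u@(_ ∷ us) (there x∈) z =
    cong₂ _xor_ (z (here refl) λ { refl → Unique[x∷xs]⇒x∉xs u x∈ }) (⨁-single us x∈ (z ∘ there))

  lookup-injective : ∀ {xs : List A} → Unique xs → ∀ i j →
    lookup xs i ≡ lookup xs j → i ≡ j
  lookup-injective {_ ∷ xs} u zero zero e = refl
  lookup-injective {_ ∷ xs} u zero (suc j) refl = ⊥-elim (Unique[x∷xs]⇒x∉xs u (∈-lookup j))
  lookup-injective {_ ∷ xs} u (suc i) zero refl = ⊥-elim (Unique[x∷xs]⇒x∉xs u (∈-lookup i))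
  lookup-injective {_ ∷ xs} (_ ∷ u) (suc i) (suc j) e = cong suc (lookup-injective u i j e)

  unique-⊆⇒length≤ : ∀ {xs ys : List A} → Unique xs → (∀ {x} → x ∈ xs → x ∈ ys) →
    length xs ≤ length ys
  unique-⊆⇒length≤ {xs} {ys} u s = injective⇒≤ {f = λ i → Any.index (s (∈-lookup i))} λ {i} {j} e →
    lookup-injective u i j
      (trans (lookup-index (s (∈-lookup i)))
             (trans (cong (lookup ys) e) (sym (lookup-index (s (∈-lookup j))))))

  unique-set⇒↭ : ∀ {xs ys : List A} → Unique xs → Unique ys →
    (∀ {x} → x ∈ xs → x ∈ ys) → (∀ {x} → x ∈ ys → x ∈ xs) → xs ↭ ys
  unique-set⇒↭ u v s t = ∼bag⇒↭ (unique∧set⇒bag u v (mk⇔ s t))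

  select : (A → Bool) → List A → List A
  select p = filter (λ x → p x Bool.≟ true)

  count≡length-select : ∀ (p : A → Bool) xs →
    sum (map (λ x → if p x then 1 else 0) xs) ≡ length (select p xs)
  count≡length-select p [] = refl
  count≡length-select p (x ∷ xs) with p x Bool.≟ true
  ... | yes e rewrite e = cong suc (count≡length-select p xs)
  ... | no e with p x
  ...   | true  = ⊥-elim (e refl)
  ...   | false = count≡length-select p xs

  ∈-select⁺ : ∀ (p : A → Bool) {x xs} → x ∈ xs → p x ≡ true → x ∈ select p xs
  ∈-select⁺ p = ∈-filter⁺ (λ x → p x Bool.≟ true)

  ∈-select⁻ : ∀ (p : A → Bool) {x} xs → x ∈ select p xs → p x ≡ true
  ∈-select⁻ p xs x∈ = proj₂ (∈-filter⁻ (λ x → p x Bool.≟ true) {xs = xs} x∈)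

  select-unique : ∀ (p : A → Bool) {xs} → Unique xs → Unique (select p xs)
  select-unique p = filter⁺ (λ x → p x Bool.≟ true)

⨁-swap : ∀ {A B : Set} (k : A → B → Bool) xs ys →
  ⨁ (λ x → ⨁ (k x) ys) xs ≡ ⨁ (λ y → ⨁ (λ x → k x y) xs) ys
⨁-swap k []       ys = sym (⨁-false ys (λ _ → refl))
⨁-swap k (x ∷ xs) ys =
  trans (cong (⨁ (k x) ys xor_) (⨁-swap k xs ys))
        (sym (⨁-xor (k x) (λ y → ⨁ (λ x′ → k x′ y) xs) ys))

⨁-map : ∀ {A B : Set} (h : B → Bool) (f : A → B) xs → ⨁ h (map f xs) ≡ ⨁ (h ∘ f) xs
⨁-map h f []       = refl
⨁-map h f (x ∷ xs) = cong (h (f x) xor_) (⨁-map h f xs)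

module _ {A B : Set} (p : A × B → Bool) where

  select-map : ∀ x (ys : List B) → length (select p (map (x ,_) ys)) ≡ length (select (λ y → p (x , y)) ys)
  select-map x [] = refl
  select-map x (y ∷ ys) with p (x , y) Bool.≟ true
  ... | yes _ = cong suc (select-map x ys)
  ... | no  _ = select-map x ys

  doubleCount≡length-select : ∀ (xs : List A) (ys : List B) →
    sum (map (λ x → sum (map (λ y → if p (x , y) then 1 else 0) ys)) xs)
      ≡ length (select p (cartesianProduct xs ys))
  doubleCount≡length-select [] ys = refl
  doubleCount≡length-select (x ∷ xs) ys =
    trans (cong₂ _+_ (trans (count≡length-select (λ y → p (x , y)) ys) (sym (select-map x ys)))
                     (doubleCount≡length-select xs ys))
    (sym (trans (cong length (filter-++ (λ z → p z Bool.≟ true) (map (x ,_) ys) (cartesianProduct xs ys)))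
                (length-++ (select p (map (x ,_) ys)))))

toBit : Bool → Fin 2
toBit false = zero
toBit true  = suc zero

fromBit : Fin 2 → Bool
fromBit zero    = false
fromBit (suc _) = true

toBit-injective : ∀ {a b} → toBit a ≡ toBit b → a ≡ b
toBit-injective {false} {false} _ = refl
toBit-injective {true}  {true}  _ = refl

fromBit-injective : ∀ {a b} → fromBit a ≡ fromBit b → a ≡ b
fromBit-injective {zero}     {zero}     _ = refl
fromBit-injective {suc zero} {suc zero} _ = refl

-- Dimension through cardinality: an injection of 𝔽₂-vectors gives 2 ^ k ≤ 2 ^ length xs, which
-- replaces all linear algebra. Injectivity is pointwise for want of function extensionality.
injective⇒≤length : ∀ {A : Set} {k} (f : (Fin k → Bool) → A → Bool) (xs : List A) →
  (∀ x y → (∀ {a} → a ∈ xs → f x a ≡ f y a) → ∀ i → x i ≡ y i) → k ≤ length xs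
injective⇒≤length {k = k} f xs inj = ≮⇒≥ λ l<k →
  ≤⇒≯ (injective⇒≤ {f = F} F-injective) (^-monoʳ-< 2 (s≤s (s≤s z≤n)) l<k)
  where
  F : Fin (2 ^ k) → Fin (2 ^ length xs)
  F c = funToFin (λ i → toBit (f (fromBit ∘ finToFun c) (lookup xs i)))

  F-injective : ∀ {c d} → F c ≡ F d → c ≡ d
  F-injective {c} {d} e =
    trans (sym (funToFin-finToFin {k} c))
          (trans (cong-funToFin λ i → fromBit-injective (inj _ _ pointwise i)) (funToFin-finToFin {k} d))
    where
    cong-funToFin : ∀ {m n} {g h : Fin m → Fin n} → (∀ i → g i ≡ h i) → funToFin g ≡ funToFin h
    cong-funToFin {zero}  q = refl
    cong-funToFin {suc m} q = cong₂ Data.Fin.combine (q zero) (cong-funToFin (q ∘ suc))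

    pointwise : ∀ {a} → a ∈ xs → f (fromBit ∘ finToFun c) a ≡ f (fromBit ∘ finToFun d) a
    pointwise a∈ = subst (λ a → f (fromBit ∘ finToFun c) a ≡ f (fromBit ∘ finToFun d) a)
      (sym (lookup-index a∈))
      (toBit-injective (trans (sym (finToFun-funToFin _ (Any.index a∈)))
        (trans (cong (λ z → finToFun z (Any.index a∈)) e) (finToFun-funToFin _ (Any.index a∈)))))

-- Faces of a rotation system

Dart : ℕ → Set
Dart n = Fin n × Fin n

_≟ᵈ_ : ∀ {n} (d e : Dart n) → Dec (d ≡ e)
_≟ᵈ_ = ≡-dec _≟_ _≟_

does-⇔ : ∀ {P Q : Set} (p? : Dec P) (q? : Dec Q) → (P → Q) → (Q → P) → does p? ≡ does q?
does-⇔ (yes p) q? f g = sym (dec-true q? (f p))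
does-⇔ (no ¬p) q? f g = sym (dec-false q? (¬p ∘ g))

∧-true⁻ : ∀ {a b} → a ∧ b ≡ true → a ≡ true × b ≡ true
∧-true⁻ {true} {true} _ = refl , refl

xor-false⇒≡ : ∀ {a b} → a xor b ≡ false → a ≡ b
xor-false⇒≡ {false} {false} _ = refl
xor-false⇒≡ {true}  {true}  _ = refl

iter-+ : ∀ {A : Set} (f : A → A) m k x → iter f (m + k) x ≡ iter f m (iter f k x)
iter-+ f zero    k x = refl
iter-+ f (suc m) k x = cong f (iter-+ f m k x)

iter-comm : ∀ {A : Set} (f : A → A) k x → iter f k (f x) ≡ f (iter f k x)
iter-comm f zero    x = refl
iter-comm f (suc k) x = cong f (iter-comm f k x)

∀-split : ∀ {a b} (P : Fin (a + b) → Set) →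
  (∀ i → P (i ↑ˡ b)) → (∀ j → P (a ↑ʳ j)) → ∀ i → P i
∀-split {a} P l r i with splitAt a i in eq
... | inj₁ j = subst P (splitAt⁻¹-↑ˡ eq) (l j)
... | inj₂ j = subst P (splitAt⁻¹-↑ʳ {a} eq) (r j)

and-map⇒ : ∀ {A : Set} (g : A → Bool) xs → and (map g xs) ≡ true → ∀ {x} → x ∈ xs → g x ≡ true
and-map⇒ g (x ∷ xs) e (here refl) = proj₁ (∧-true⁻ e)
and-map⇒ g (x ∷ xs) e (there x∈) = and-map⇒ g xs (proj₂ (∧-true⁻ {g x} e)) x∈

and-map⇐ : ∀ {A : Set} (g : A → Bool) xs → and (map g xs) ≢ true → ∃ λ x → g x ≡ false
and-map⇐ g []       e = ⊥-elim (e refl)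
and-map⇐ g (x ∷ xs) e with g x in eq
... | false = x , eq
... | true  = and-map⇐ g xs e

≤ᵇ-false⇒> : ∀ {a b} → (a ≤ᵇ b) ≡ false → b < a
≤ᵇ-false⇒> {a} {b} e = ≰⇒> λ a≤b → case (trans (sym e) (Equivalence.to T-≡ (≤⇒≤ᵇ a≤b)))
  where
  case : false ≡ true → ⊥
  case ()

≤ᵇ-true⇒≤ : ∀ {a b} → (a ≤ᵇ b) ≡ true → a ≤ b
≤ᵇ-true⇒≤ {a} {b} e = ≤ᵇ⇒≤ a b (Equivalence.from T-≡ e)

dartCode-injective : ∀ {n} {d e : Dart n} → dartCode d ≡ dartCode e → d ≡ e
dartCode-injective {n} {u , w} {u′ , w′} e = cong₂ _,_ (proj₁ uw) (proj₂ uw)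
  where
  code : ∀ (u w : Fin n) → toℕ (combine u w) ≡ toℕ u * n + toℕ w
  code u w = trans (toℕ-combine u w) (cong (_+ toℕ w) (*-comm n (toℕ u)))
  uw = combine-injective u w u′ w′ (toℕ-injective (trans (code u w) (trans e (sym (code u′ w′)))))

path-sum : ∀ {n} {R : Fin n → Fin n → Set} → (Dart n → Bool) → ∀ {u v} → Star R u v → Bool
path-sum p ε = false
path-sum p (_◅_ {u} {v} _ W) = p (u , v) xor path-sum p W

module Faces {n} (G : Graph n) (ρ : Rotation G) where

  IsDart : Dart n → Set
  IsDart (u , w) = Adj G u w

  Adj-sym : ∀ {u w} → Adj G u w → Adj G w u
  Adj-sym {u} {w} a = trans (adj-sym G w u) a

  Adj⇒≢ : ∀ {u w} → Adj G u w → u ≢ w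
  Adj⇒≢ {u} a refl with trans (sym a) (adj-irrefl G u)
  ... | ()

  φ : Dart n → Dart n
  φ = faceStep ρ

  φ-dart : ∀ {d} → IsDart d → IsDart (φ d)
  φ-dart {u , w} a = rot-adj ρ w u (Adj-sym a)

  φ-injective : ∀ {d e} → IsDart d → IsDart e → φ d ≡ φ e → d ≡ e
  φ-injective {u , w} {u′ , w′} a a′ eq with ,-injectiveˡ eq
  ... | refl = cong (_, w) (rot-inj ρ w u u′ (Adj-sym a) (Adj-sym a′) (,-injectiveʳ eq))

  iter-dart : ∀ k {d} → IsDart d → IsDart (iter φ k d)
  iter-dart zero    a = a
  iter-dart (suc k) a = φ-dart (iter-dart k a)

  iter-injective : ∀ k {d e} → IsDart d → IsDart e → iter φ k d ≡ iter φ k e → d ≡ e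
  iter-injective zero    a b eq = eq
  iter-injective (suc k) a b eq = iter-injective k a b (φ-injective (iter-dart k a) (iter-dart k b) eq)

  period : ∀ {d} → IsDart d → ∃ λ p → p < n * n × iter φ (suc p) d ≡ d
  -- Two of the first n * n + 1 iterates coincide, and injectivity of `φ` cancels their common
  -- prefix.
  period {d} a with pigeonhole (n<1+n (n * n)) (λ k → combine (proj₁ (iter φ (toℕ k) d)) (proj₂ (iter φ (toℕ k) d)))
  ... | i , j , i<j , eq = p , p<n² , sym (iter-injective (toℕ i) a (iter-dart (suc p) a)
        (trans same (trans (cong (λ m → iter φ m d) (sym i+p+1≡j)) (iter-+ φ (toℕ i) (suc p) d))))
    where
    p = toℕ j ∸ suc (toℕ i)
    i+p+1≡j : toℕ i + suc p ≡ toℕ j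
    i+p+1≡j = trans (+-suc (toℕ i) p) (m+[n∸m]≡n i<j)
    p<n² : p < n * n
    p<n² = ≤-trans (≤-trans (m≤n+m (suc p) (toℕ i)) (≤-reflexive i+p+1≡j)) (≤-pred (toℕ<n j))
    same : iter φ (toℕ i) d ≡ iter φ (toℕ j) d
    same with combine-injective (proj₁ (iter φ (toℕ i) d)) (proj₂ (iter φ (toℕ i) d)) (proj₁ (iter φ (toℕ j) d)) (proj₂ (iter φ (toℕ j) d)) eq
    ... | e₁ , e₂ = cong₂ _,_ e₁ e₂

  infix 4 _~_
  _~_ : Dart n → Dart n → Set
  d ~ e = ∃ λ k → iter φ k d ≡ e

  ~-refl : ∀ {d} → d ~ d
  ~-refl = 0 , refl

  ~-trans : ∀ {d e f} → d ~ e → e ~ f → d ~ f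
  ~-trans {d} (k , refl) (m , refl) = m + k , iter-+ φ m k d

  ~-φ : ∀ {d} → d ~ φ d
  ~-φ = 1 , refl

  φ-~ : ∀ {d} → IsDart d → φ d ~ d
  φ-~ {d} a with period a
  ... | p , _ , eq = p , trans (iter-comm φ p d) eq

  ~-sym : ∀ {d e} → IsDart d → d ~ e → e ~ d
  ~-sym a (zero  , refl) = ~-refl
  ~-sym a (suc k , refl) = ~-trans (φ-~ (iter-dart k a)) (~-sym a (k , refl))

  ~-dart : ∀ {d e} → IsDart d → d ~ e → IsDart e
  ~-dart a (k , refl) = iter-dart k a

  -- `isRep` inspects only the first n * n iterates; reducing exponents modulo the period shows that
  -- these exhaust the orbit.
  ~-short : ∀ {d e} → IsDart d → d ~ e → ∃ λ k → k < n * n × iter φ k d ≡ e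
  ~-short {d} a (zero , eq) with period a
  ... | p , p<n² , _ = 0 , ≤-trans (s≤s z≤n) p<n² , eq
  ~-short {d} a (suc k , refl) with ~-short a (k , refl) | period a
  ... | m , m<n² , eq | p , p<n² , eqₚ with m ℕ.≟ p
  ...   | yes refl = 0 , ≤-trans (s≤s z≤n) p<n² , trans (sym eqₚ) (cong φ eq)
  ...   | no m≢p with suc m ≤? p
  ...     | yes m<p = suc m , ≤-trans (s≤s m<p) p<n² , cong φ eq
  ...     | no m≮p = m ∸ p , ≤-trans (s≤s (m∸n≤m m p)) m<n² ,
            trans (cong φ′ (sym eqₚ)) (trans (sym (iter-+ φ (m ∸ p) (suc p) d))
              (trans (cong (λ z → iter φ z d) (trans (+-suc (m ∸ p) p) (cong suc (m∸n+n≡m p≤m)))) (cong φ eq)))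
    where
    φ′ = iter φ (m ∸ p)
    p≤m : p ≤ m
    p≤m = ≮⇒≥ m≮p

  isRep⇒≤ : ∀ {d e} → IsDart d → isRep ρ d ≡ true → d ~ e → dartCode d ≤ dartCode e
  isRep⇒≤ a r s with ~-short a s
  ... | k , k<n² , refl = ≤ᵇ-true⇒≤ (and-map⇒ _ (upTo (n * n)) r (∈-upTo⁺ k<n²))

  rep-unique : ∀ {d e} → IsDart d → isRep ρ d ≡ true → isRep ρ e ≡ true → d ~ e → d ≡ e
  rep-unique a r r′ s = dartCode-injective
    (≤-antisym (isRep⇒≤ a r s) (isRep⇒≤ (~-dart a s) r′ (~-sym a s)))

  abstract
    -- A dart that fails `isRep` has an iterate of smaller code, so descent along the codes ends at
    -- a representative.
    hasRep : ∀ d → Acc _<_ (dartCode d) → ∃ λ r → d ~ r × isRep ρ r ≡ true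
    hasRep d (acc rs) with isRep ρ d Bool.≟ true
    ... | yes r = d , ~-refl , r
    ... | no ¬r with and-map⇐ _ (upTo (n * n)) ¬r
    ...   | k , lt with hasRep (iter φ k d) (rs (≤ᵇ-false⇒> lt))
    ...     | r , s , isr = r , ~-trans (k , refl) s , isr

  rep : Dart n → Dart n
  rep d = proj₁ (hasRep d (<-wellFounded _))

  ~-rep : ∀ {d} → d ~ rep d
  ~-rep {d} = proj₁ (proj₂ (hasRep d (<-wellFounded _)))

  isRep-rep : ∀ d → isRep ρ (rep d) ≡ true
  isRep-rep d = proj₂ (proj₂ (hasRep d (<-wellFounded _)))

  ~⇒rep≡ : ∀ {d e} → IsDart d → d ~ e → rep d ≡ rep e
  ~⇒rep≡ {d} {e} a s = rep-unique (~-dart a ~-rep) (isRep-rep d) (isRep-rep e)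
    (~-trans (~-sym a ~-rep) (~-trans s ~-rep))

  rep≡⇒~ : ∀ {d e} → IsDart e → rep d ≡ rep e → d ~ e
  rep≡⇒~ {d} a eq = ~-trans (subst (d ~_) eq ~-rep) (~-sym a ~-rep)

  pairs : List (Dart n)
  pairs = cartesianProduct (allFin n) (allFin n)

  ∈-pairs : ∀ d → d ∈ pairs
  ∈-pairs (u , w) = ∈-cartesianProduct⁺ (∈-allFin u) (∈-allFin w)

  pairs-unique : Unique pairs
  pairs-unique = cartesianProduct⁺ (allFin⁺ n) (allFin⁺ n)

  darts : List (Dart n)
  darts = select (λ d → adj G (proj₁ d) (proj₂ d)) pairs

  reps : List (Dart n)
  reps = select (λ d → adj G (proj₁ d) (proj₂ d) ∧ isRep ρ d) pairs

  length-darts : degSum G ≡ length darts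
  length-darts = doubleCount≡length-select (λ d → adj G (proj₁ d) (proj₂ d)) (allFin n) (allFin n)

  length-reps : faces ρ ≡ length reps
  length-reps = doubleCount≡length-select (λ d → adj G (proj₁ d) (proj₂ d) ∧ isRep ρ d) (allFin n) (allFin n)

  ∈-darts⁺ : ∀ {d} → IsDart d → d ∈ darts
  ∈-darts⁺ {d} a = ∈-filter⁺ _ (∈-pairs d) a

  ∈-darts⁻ : ∀ {d} → d ∈ darts → IsDart d
  ∈-darts⁻ d∈ = proj₂ (∈-filter⁻ _ {xs = pairs} d∈)

  ∈-reps⁺ : ∀ {d} → IsDart d → isRep ρ d ≡ true → d ∈ reps
  ∈-reps⁺ {d} a r = ∈-filter⁺ _ (∈-pairs d) (cong₂ _∧_ a r)

  ∈-reps⁻ : ∀ {d} → d ∈ reps → IsDart d × isRep ρ d ≡ true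
  ∈-reps⁻ {d} d∈ = ∧-true⁻ (proj₂ (∈-filter⁻ _ {xs = pairs} d∈))

  darts-unique : Unique darts
  darts-unique = filter⁺ _ pairs-unique

  reps-unique : Unique reps
  reps-unique = filter⁺ _ pairs-unique

  ∈-reps⇒rep≡ : ∀ {d} → d ∈ reps → rep d ≡ d
  ∈-reps⇒rep≡ d∈ with ∈-reps⁻ d∈
  ... | a , r = sym (rep-unique a r (isRep-rep _) ~-rep)

  rep∈reps : ∀ {d} → IsDart d → rep d ∈ reps
  rep∈reps a = ∈-reps⁺ (~-dart a ~-rep) (isRep-rep _)

  -- The tool for bounding face numbers from below: inequivalent darts have different
  -- representatives.
  length≤faces : ∀ {ds} → All IsDart ds → AllPairs (λ d e → ¬ d ~ e) ds → length ds ≤ faces ρ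
  length≤faces {ds} as sep = subst (length ds ≤_) (sym length-reps)
    (subst (_≤ length reps) (length-map rep ds)
      (unique-⊆⇒length≤ (rep-distinct as sep) sub))
    where
    rep-distinct : ∀ {ds} → All IsDart ds → AllPairs (λ d e → ¬ d ~ e) ds → Unique (map rep ds)
    rep-distinct [] [] = []
    rep-distinct (a ∷ as) (s ∷ ss) = distinct as s ∷ rep-distinct as ss
      where
      distinct : ∀ {d es} → All IsDart es → All (λ e → ¬ d ~ e) es → All (rep d ≢_) (map rep es)
      distinct [] [] = []
      distinct (b ∷ bs) (t ∷ ts) = (λ eq → t (rep≡⇒~ b eq)) ∷ distinct bs ts
    sub : ∀ {x} → x ∈ map rep ds → x ∈ reps
    sub x∈ with ∈-map⁻ rep x∈
    ... | d , d∈ , refl = rep∈reps (All.lookup as d∈)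

  -- The sum of p around the face represented by r. For symmetric p this is the coboundary of a
  -- 1-cochain, or the boundary of the dual edge set; `FaceClosed` means cocycle.
  δ : (Dart n → Bool) → Dart n → Bool
  δ p r = ⨁ (λ d → does (rep d ≟ᵈ r) ∧ p d) darts

  FaceClosed : (Dart n → Bool) → Set
  FaceClosed p = ∀ r → δ p r ≡ false

  δ-cong : ∀ {p q} r → (∀ {d} → IsDart d → p d ≡ q d) → δ p r ≡ δ q r
  δ-cong r e = ⨁-cong darts λ {d} d∈ → cong (does (rep d ≟ᵈ r) ∧_) (e (∈-darts⁻ d∈))

  δ-xor : ∀ p q r → δ (λ d → p d xor q d) r ≡ δ p r xor δ q r
  δ-xor p q r = trans
    (⨁-cong darts λ {d} _ → ∧-distribˡ-xor (does (rep d ≟ᵈ r)) (p d) (q d))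
    (⨁-xor (λ d → does (rep d ≟ᵈ r) ∧ p d) (λ d → does (rep d ≟ᵈ r) ∧ q d) darts)

  φ-darts : map φ darts ↭ darts
  φ-darts = unique-set⇒↭ (map-unique darts-unique (All.tabulate ∈-darts⁻))
    darts-unique
    (λ x∈ → let (d , d∈ , eq) = ∈-map⁻ φ x∈ in subst (_∈ darts) (sym eq) (∈-darts⁺ (φ-dart (∈-darts⁻ d∈))))
    (λ {x} x∈ → let (p , _ , eq) = period (∈-darts⁻ x∈) in
      subst (_∈ map φ darts) eq (∈-map⁺ φ (∈-darts⁺ (iter-dart p (∈-darts⁻ x∈)))))
    where
    map-unique : ∀ {ds} → Unique ds → All IsDart ds → Unique (map φ ds)
    map-unique [] [] = []
    map-unique (u ∷ us) (a ∷ as) = distinct u as ∷ map-unique us as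
      where
      distinct : ∀ {es} → All (_ ≢_) es → All IsDart es → All (φ _ ≢_) (map φ es)
      distinct [] [] = []
      distinct (t ∷ ts) (b ∷ bs) = (λ eq → t (φ-injective a b eq)) ∷ distinct ts bs

  δ-φ : ∀ p r → δ (p ∘ φ) r ≡ δ p r
  δ-φ p r = trans
    (⨁-cong darts λ {d} d∈ → cong (λ z → does (z ≟ᵈ r) ∧ p (φ d)) (~⇒rep≡ (∈-darts⁻ d∈) ~-φ))
    (trans (sym (⨁-map (λ d → does (rep d ≟ᵈ r) ∧ p d) φ darts)) (⨁-↭ _ φ-darts))

  -- The head of d is the tail of `φ d`, so both halves of the sum agree by `δ-φ`.
  potential-closed : ∀ H → FaceClosed (λ d → H (proj₁ d) xor H (proj₂ d))
  potential-closed H r = trans (δ-xor (H ∘ proj₁) (H ∘ proj₁ ∘ φ) r)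
    (trans (cong (δ (H ∘ proj₁) r xor_) (δ-φ (H ∘ proj₁) r)) (xor-same (δ (H ∘ proj₁) r)))

  -- Around a face the corner conditions telescope.
  corner-closed : ∀ (s c : Dart n → Bool) →
    (∀ v u → Adj G v u → s (v , u) xor s (v , rot ρ v u) ≡ c (u , v) xor c (v , rot ρ v u)) →
    FaceClosed (λ d → s d xor s (swap d))
  corner-closed s c corner r =
    trans (δ-xor s (s ∘ swap) r)
    (trans (cong (_xor δ (s ∘ swap) r) (sym (δ-φ s r)))
    (trans (sym (δ-xor (s ∘ φ) (s ∘ swap) r))
    (trans (δ-cong r λ {d} a → trans (xor-comm (s (φ d)) (s (swap d))) (corner (proj₂ d) (proj₁ d) (Adj-sym a)))
    (trans (δ-xor c (c ∘ φ) r)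
    (trans (cong (δ c r xor_) (δ-φ c r)) (xor-same (δ c r)))))))

  Symmetric : (Dart n → Bool) → Set
  Symmetric p = ∀ d → p (swap d) ≡ p d

  -- A dual path, as an edge set mod 2: its boundary consists of the faces of d and e.
  Lift : Dart n → Dart n → Set
  Lift d e = Σ (Dart n → Bool) λ p → Symmetric p ×
    (∀ r → δ p r ≡ does (rep d ≟ᵈ r) xor does (rep e ≟ᵈ r))

  lift-same : ∀ {d e} → rep d ≡ rep e → Lift d e
  lift-same {d} {e} eq = (λ _ → false) , (λ _ → refl) , λ r →
    trans (⨁-false darts λ {c} _ → ∧-zeroʳ (does (rep c ≟ᵈ r)))
      (sym (trans (cong (λ z → does (z ≟ᵈ r) xor does (rep e ≟ᵈ r)) eq) (xor-same (does (rep e ≟ᵈ r)))))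

  lift-trans : ∀ {d e f} → Lift d e → Lift e f → Lift d f
  lift-trans {d} {e} {f} (p , ps , pe) (q , qs , qe) =
    (λ c → p c xor q c) , (λ c → cong₂ _xor_ (ps c) (qs c)) , λ r →
      trans (δ-xor p q r) (trans (cong₂ _xor_ (pe r) (qe r))
        (xor-telescope (does (rep d ≟ᵈ r)) (does (rep e ≟ᵈ r)) (does (rep f ≟ᵈ r))))

  δ-single : ∀ {d} r → IsDart d → δ (λ c → does (c ≟ᵈ d)) r ≡ does (rep d ≟ᵈ r)
  δ-single {d} r a = trans
    (⨁-single darts-unique (∈-darts⁺ a) λ {c} _ c≢d →
      trans (cong (does (rep c ≟ᵈ r) ∧_) (dec-false (c ≟ᵈ d) c≢d)) (∧-zeroʳ (does (rep c ≟ᵈ r))))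
    (trans (cong (does (rep d ≟ᵈ r) ∧_) (dec-true (d ≟ᵈ d) refl)) (∧-identityʳ (does (rep d ≟ᵈ r))))

  lift-swap : ∀ {d} → IsDart d → Lift d (swap d)
  lift-swap {d} a = (λ c → does (c ≟ᵈ d) xor does (c ≟ᵈ swap d)) ,
    (λ c → trans (cong₂ _xor_ (does-⇔ (swap c ≟ᵈ d) (c ≟ᵈ swap d) (cong swap) (cong swap))
                              (does-⇔ (swap c ≟ᵈ swap d) (c ≟ᵈ d) (cong swap) (cong swap)))
                 (xor-comm (does (c ≟ᵈ swap d)) (does (c ≟ᵈ d)))) ,
    λ r → trans (δ-xor _ _ r) (cong₂ _xor_ (δ-single r a) (δ-single r (Adj-sym a)))

  -- Neighbouring darts at v are one edge apart: `swap` crosses the edge to (u , v), and `φ` takes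
  -- that dart to (v , rot ρ v u) within the same face.
  lift-rot : ∀ {v u} → Adj G v u → ∀ k → Lift (v , u) (v , iter (rot ρ v) k u)
  lift-rot a zero = lift-same refl
  lift-rot {v} {u} a (suc k) = lift-trans (lift-rot a k)
    (lift-trans (lift-swap (iter-adj k)) (lift-same (~⇒rep≡ (Adj-sym (iter-adj k)) ~-φ)))
    where
    iter-adj : ∀ k → Adj G v (iter (rot ρ v) k u)
    iter-adj zero = a
    iter-adj (suc k) = rot-adj ρ v _ (iter-adj k)

  lift-around : ∀ {v u w} → Adj G v u → Adj G v w → Lift (v , u) (v , w)
  lift-around {v} {u} {w} a b with rot-cyc ρ v u w a b
  ... | k , refl = lift-rot a k

  -- Connectedness of the graph becomes connectedness of its dual: the dual path turns around each
  -- vertex of the walk in succession.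
  lift-walk : ∀ {v v′ u u′} → Walk G v v′ → Adj G v u → Adj G v′ u′ → Lift (v , u) (v′ , u′)
  lift-walk here       a a′ = lift-around a a′
  lift-walk (step b W) a a′ =
    lift-trans (lift-around a b) (lift-trans (lift-swap b) (lift-walk W (Adj-sym b) a′))

-- Vanishing of H¹

Walk⇒Star : ∀ {n} {G : Graph n} {u v} → Walk G u v → Star (Adj G) u v
Walk⇒Star here       = ε
Walk⇒Star (step a W) = a ◅ Walk⇒Star W

path-sum-cong : ∀ {n} {R : Fin n → Fin n → Set} {p q : Dart n → Bool} →
  (∀ {u v} → R u v → p (u , v) ≡ q (u , v)) → ∀ {u v} (W : Star R u v) → path-sum p W ≡ path-sum q W
path-sum-cong e ε       = refl
path-sum-cong e (a ◅ W) = cong₂ _xor_ (e a) (path-sum-cong e W)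

path-sum-potential : ∀ {n} {R : Fin n → Fin n → Set} (H : Fin n → Bool) {u v} (W : Star R u v) →
  path-sum (λ d → H (proj₁ d) xor H (proj₂ d)) W ≡ H u xor H v
path-sum-potential H {u} ε = sym (xor-same (H u))
path-sum-potential H {u} {v} (_◅_ {j = w} a W) =
  trans (cong ((H u xor H w) xor_) (path-sum-potential H W)) (xor-telescope (H u) (H w) (H v))

-- Packs two symmetric functions into one dart function: l is read on the darts going up, r on their
-- reverses. This turns a bound by E into half a bound by the number of darts.
interleave : ∀ {n} → (Dart n → Bool) → (Dart n → Bool) → Dart n → Bool
interleave l r (u , w) = if toℕ u <ᵇ toℕ w then l (u , w) else r (u , w)

interleave-injective : ∀ {n} (G : Graph n) {l l′ r r′ : Dart n → Bool} →
  (∀ d → l (swap d) ≡ l d) → (∀ d → l′ (swap d) ≡ l′ d) →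
  (∀ d → r (swap d) ≡ r d) → (∀ d → r′ (swap d) ≡ r′ d) →
  (∀ {d} → Adj G (proj₁ d) (proj₂ d) → interleave l r d ≡ interleave l′ r′ d) →
  (∀ {d} → Adj G (proj₁ d) (proj₂ d) → l d ≡ l′ d) × (∀ {d} → Adj G (proj₁ d) (proj₂ d) → r d ≡ r′ d)
interleave-injective G {l} {l′} {r} {r′} ls ls′ rs rs′ eq = left , right
  where
  below : ∀ {u w} → toℕ u < toℕ w → Adj G u w → l (u , w) ≡ l′ (u , w)
  below {u} {w} u<w a with toℕ u <ᵇ toℕ w | dec-true (toℕ u ℕ.<? toℕ w) u<w | eq {u , w} a
  ... | true | _ | q = q

  above : ∀ {u w} → ¬ toℕ u < toℕ w → Adj G u w → r (u , w) ≡ r′ (u , w)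
  above {u} {w} u≮w a with toℕ u <ᵇ toℕ w | dec-false (toℕ u ℕ.<? toℕ w) u≮w | eq {u , w} a
  ... | false | _ | q = q

  opposite : ∀ {u w} → Adj G u w → Adj G w u
  opposite {u} {w} a = trans (adj-sym G w u) a

  left : ∀ {d} → Adj G (proj₁ d) (proj₂ d) → l d ≡ l′ d
  left {u , w} a with toℕ u ℕ.<? toℕ w
  ... | yes u<w = below u<w a
  ... | no u≮w = trans (ls (w , u)) (trans (below w<u (opposite a)) (sym (ls′ (w , u))))
    where
    u≢w : u ≢ w
    u≢w refl with trans (sym a) (adj-irrefl G u)
    ... | ()
    w<u : toℕ w < toℕ u
    w<u = ≤∧≢⇒< (≮⇒≥ u≮w) (u≢w ∘ sym ∘ toℕ-injective)

  right : ∀ {d} → Adj G (proj₁ d) (proj₂ d) → r d ≡ r′ d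
  right {u , w} a with toℕ u ℕ.<? toℕ w
  ... | no u≮w = above u≮w a
  ... | yes u<w = trans (rs (w , u)) (trans (above (<-asym u<w) (opposite a)) (sym (rs′ (w , u))))

module Cohomology {n′} (G : Graph (suc n′)) (ρ : Rotation G) (connected : Connected G)
  {d₀ : Dart (suc n′)} (a₀ : Adj G (proj₁ d₀) (proj₂ d₀)) where

  open Faces G ρ

  r₀ : Dart (suc n′)
  r₀ = rep d₀

  others : List (Dart (suc n′))
  others = filter (λ d → ¬? (d ≟ᵈ r₀)) reps

  m : ℕ
  m = length others

  faces≤1+m : faces ρ ≤ suc m
  faces≤1+m = subst (_≤ suc m) (sym length-reps) (unique-⊆⇒length≤ reps-unique sub)
    where
    sub : ∀ {x} → x ∈ reps → x ∈ r₀ ∷ others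
    sub {x} x∈ with x ≟ᵈ r₀
    ... | yes eq = here eq
    ... | no neq = there (∈-filter⁺ _ x∈ neq)

  other : Fin m → Dart (suc n′)
  other = lookup others

  other∈reps : ∀ i → other i ∈ reps
  other∈reps i = proj₁ (∈-filter⁻ (λ d → ¬? (d ≟ᵈ r₀)) {xs = reps} (∈-lookup i))

  other≢r₀ : ∀ i → other i ≢ r₀
  other≢r₀ i = proj₂ (∈-filter⁻ (λ d → ¬? (d ≟ᵈ r₀)) {xs = reps} (∈-lookup i))

  lift : ∀ i → Lift (other i) d₀
  lift i = lift-walk (connected _ _) (proj₁ (∈-reps⁻ (other∈reps i))) a₀

  λᵢ : Fin m → Dart (suc n′) → Bool
  λᵢ i = proj₁ (lift i)

  -- Away from the base face the dual paths have Kronecker boundaries, so `δ` reads off the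
  -- coefficients of a combination of them.
  δλᵢ : ∀ i j → δ (λᵢ i) (other j) ≡ does (i ≟ j)
  δλᵢ i j = trans (proj₂ (proj₂ (lift i)) (other j))
    (trans (cong₂ _xor_
      (trans (cong (λ z → does (z ≟ᵈ other j)) (∈-reps⇒rep≡ (other∈reps i)))
        (does-⇔ (other i ≟ᵈ other j) (i ≟ j)
          (lookup-injective (filter⁺ _ reps-unique) i j) (cong other)))
      (dec-false (r₀ ≟ᵈ other j) (other≢r₀ j ∘ sym)))
      (xor-identityʳ _))

  -- `p-independent` says that the classes of the cocycles p in H¹ are independent, tested by sums
  -- over closed walks. With e = 0 the resulting dimension bound is Euler's inequality; with e = 1
  -- it excludes an odd closed walk in the planar case.
  module Independence {e : ℕ} (p : Fin e → Dart (suc n′) → Bool)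
    (p-symmetric : ∀ i → Symmetric (p i)) (p-closed : ∀ i → FaceClosed (p i))
    (p-independent : ∀ (c : Fin e → Bool) → (∀ {u : Fin (suc n′)} (W : Star (Adj G) u u) →
      path-sum (λ d → ⨁ (λ i → c i ∧ p i d) (allFin e)) W ≡ false) → ∀ i → c i ≡ false) where

    K : ℕ
    K = n′ + (e + m)

    H : (Fin K → Bool) → Fin (suc n′) → Bool
    -- Potentials count only up to a constant, which is fixed by their value at `zero`.
    H x zero    = false
    H x (suc i) = x (i ↑ˡ (e + m))

    c : (Fin K → Bool) → Fin e → Bool
    c x i = x (n′ ↑ʳ (i ↑ˡ m))

    g : (Fin K → Bool) → Fin m → Bool
    g x i = x (n′ ↑ʳ (e ↑ʳ i))

    ∂H : (Fin K → Bool) → Dart (suc n′) → Bool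
    ∂H x d = H x (proj₁ d) xor H x (proj₂ d)

    Σp : (Fin K → Bool) → Dart (suc n′) → Bool
    Σp x d = ⨁ (λ i → c x i ∧ p i d) (allFin e)

    Σλ : (Fin K → Bool) → Dart (suc n′) → Bool
    Σλ x d = ⨁ (λ i → g x i ∧ λᵢ i d) (allFin m)

    Λ : (Fin K → Bool) → Dart (suc n′) → Bool
    Λ x d = (∂H x d xor Σp x d) xor Σλ x d

    Λ-symmetric : ∀ x → Symmetric (Λ x)
    Λ-symmetric x d = cong₂ _xor_ (cong₂ _xor_ (xor-comm (H x (proj₂ d)) (H x (proj₁ d)))
      (⨁-cong (allFin e) λ {i} _ → cong (c x i ∧_) (p-symmetric i d)))
      (⨁-cong (allFin m) λ {i} _ → cong (g x i ∧_) (proj₁ (proj₂ (lift i)) d))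

    Λ-xor : ∀ x y d → Λ (λ i → x i xor y i) d ≡ Λ x d xor Λ y d
    Λ-xor x y d = trans (cong₂ _xor_ (cong₂ _xor_
        (trans (cong₂ _xor_ (H-xor (proj₁ d)) (H-xor (proj₂ d))) (interchange (H x (proj₁ d)) _ _ _))
        (combination (c x) (c y) (λ i → p i d) (allFin e)))
        (combination (g x) (g y) (λ i → λᵢ i d) (allFin m)))
      (trans (cong (_xor (Σλ x d xor Σλ y d)) (interchange (∂H x d) (∂H y d) _ _))
             (interchange (∂H x d xor Σp x d) _ _ _))
      where
      H-xor : ∀ v → H (λ i → x i xor y i) v ≡ H x v xor H y v
      H-xor zero = refl
      H-xor (suc i) = refl
      combination : ∀ {A : Set} (a b q : A → Bool) xs →
        ⨁ (λ i → (a i xor b i) ∧ q i) xs ≡ ⨁ (λ i → a i ∧ q i) xs xor ⨁ (λ i → b i ∧ q i) xs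
      combination a b q xs = trans (⨁-cong xs λ {i} _ → ∧-distribʳ-xor (q i) (a i) (b i))
        (⨁-xor (λ i → a i ∧ q i) (λ i → b i ∧ q i) xs)

    δ-combination : ∀ {k} (a : Fin k → Bool) (q : Fin k → Dart (suc n′) → Bool) r →
      δ (λ d → ⨁ (λ i → a i ∧ q i d) (allFin k)) r ≡ ⨁ (λ i → a i ∧ δ (q i) r) (allFin k)
    δ-combination {k} a q r = trans
      (⨁-cong darts λ {d} _ → trans (sym (⨁-∧ (does (rep d ≟ᵈ r)) _ (allFin k)))
        (⨁-cong (allFin k) λ {i} _ → ∧-left-comm (does (rep d ≟ᵈ r)) (a i) (q i d)))
      (trans (⨁-swap (λ d i → a i ∧ (does (rep d ≟ᵈ r) ∧ q i d)) darts (allFin k))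
        (⨁-cong (allFin k) λ {i} _ → ⨁-∧ (a i) _ darts))
      where
      open xor-∧-Solver
      ∧-left-comm : ∀ a b c → a ∧ (b ∧ c) ≡ b ∧ (a ∧ c)
      ∧-left-comm = solve 3 (λ a b c → a :* (b :* c) := b :* (a :* c)) refl

    -- The three families are separated in turn. `δ` kills potentials and cocycles, so g vanishes;
    -- then the combination of the p is a potential difference with zero sum on closed walks, so c
    -- vanishes; then H is constant along walks, and it is zero at `zero`.
    Λ-kernel : ∀ x → (∀ {d} → IsDart d → Λ x d ≡ false) → ∀ i → x i ≡ false
    Λ-kernel x z = ∀-split (λ i → x i ≡ false) (λ i → H≡0 (suc i)) (∀-split _ c≡0 g≡0)
      where
      δΣλ : ∀ j → δ (Σλ x) (other j) ≡ g x j
      δΣλ j = trans (δ-combination (g x) λᵢ (other j))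
        (trans (⨁-cong (allFin m) λ {i} _ → cong (g x i ∧_) (δλᵢ i j))
        (trans (⨁-single (allFin⁺ m) (∈-allFin j)
          (λ {i} _ i≢j → trans (cong (g x i ∧_) (dec-false (i ≟ j) i≢j)) (∧-zeroʳ (g x i))))
        (trans (cong (g x j ∧_) (dec-true (j ≟ j) refl)) (∧-identityʳ (g x j)))))

      δΣp : ∀ r → δ (Σp x) r ≡ false
      δΣp r = trans (δ-combination (c x) p r)
        (⨁-false (allFin e) λ {i} _ → trans (cong (c x i ∧_) (p-closed i r)) (∧-zeroʳ (c x i)))

      g≡0 : ∀ j → g x j ≡ false
      g≡0 j = trans (sym (δΣλ j)) (trans (sym (cong (_xor δ (Σλ x) (other j))
          (trans (δ-xor (∂H x) (Σp x) (other j))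
                 (cong₂ _xor_ (potential-closed (H x) (other j)) (δΣp (other j))))))
        (trans (sym (δ-xor (λ d → ∂H x d xor Σp x d) (Σλ x) (other j)))
        (trans (δ-cong {q = λ _ → false} (other j) z) (⨁-false darts λ {d} _ → ∧-zeroʳ (does (rep d ≟ᵈ other j))))))

      Σp≡∂H : ∀ {d} → IsDart d → Σp x d ≡ ∂H x d
      Σp≡∂H {d} a = sym (xor-false⇒≡ (trans (sym (xor-identityʳ _))
        (trans (cong ((∂H x d xor Σp x d) xor_)
          (sym (⨁-false (allFin m) λ {i} _ → cong (_∧ λᵢ i d) (g≡0 i)))) (z a))))

      c≡0 : ∀ i → c x i ≡ false
      c≡0 = p-independent (c x) λ {u} W → trans (path-sum-cong Σp≡∂H W)
        (trans (path-sum-potential (H x) W) (xor-same (H x u)))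

      H-const : ∀ {u v} → Walk G u v → H x u ≡ H x v
      H-const here = refl
      H-const (step {u} {w} a W) = trans (xor-false⇒≡ (trans (sym (Σp≡∂H a))
        (⨁-false (allFin e) λ {i} _ → cong (_∧ p i (u , w)) (c≡0 i)))) (H-const W)

      H≡0 : ∀ v → H x v ≡ false
      H≡0 v = H-const (connected v zero)

    -- Every edge carries two darts, so a dart function has room for two independent copies of Λ.
    twice : (Fin (K + K) → Bool) → Dart (suc n′) → Bool
    twice x = interleave (Λ (x ∘ (_↑ˡ K))) (Λ (x ∘ (K ↑ʳ_)))

    dimension : K + K ≤ degSum G
    dimension = subst (K + K ≤_) (sym length-darts) (injective⇒≤length twice darts injective)
      where
      Λ-injective : ∀ x y → (∀ {d} → IsDart d → Λ x d ≡ Λ y d) → ∀ i → x i ≡ y i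
      Λ-injective x y eq i = xor-false⇒≡ (Λ-kernel (λ i → x i xor y i)
        (λ {d} a → trans (Λ-xor x y d) (trans (cong (_xor Λ y d) (eq a)) (xor-same (Λ y d)))) i)

      injective : ∀ x y → (∀ {d} → d ∈ darts → twice x d ≡ twice y d) → ∀ i → x i ≡ y i
      injective x y eq = ∀-split _
        (Λ-injective (x ∘ (_↑ˡ K)) (y ∘ (_↑ˡ K)) λ {d} → proj₁ halves {d})
        (Λ-injective (x ∘ (K ↑ʳ_)) (y ∘ (K ↑ʳ_)) λ {d} → proj₂ halves {d})
        where
        halves = interleave-injective G (Λ-symmetric (x ∘ (_↑ˡ K))) (Λ-symmetric (y ∘ (_↑ˡ K)))
          (Λ-symmetric (x ∘ (K ↑ʳ_))) (Λ-symmetric (y ∘ (K ↑ʳ_))) λ {d} a → eq (∈-darts⁺ {d} a)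

  euler-≤ : 2 * suc n′ + 2 * faces ρ ≤ degSum G + 4
  euler-≤ = begin
    2 * suc n′ + 2 * faces ρ   ≤⟨ +-monoʳ-≤ (2 * suc n′) (*-monoʳ-≤ 2 faces≤1+m) ⟩
    2 * suc n′ + 2 * suc m     ≡⟨ arith n′ m ⟩
    ((n′ + (0 + m)) + (n′ + (0 + m))) + 4 ≤⟨ +-monoˡ-≤ 4 (Independence.dimension {0} (λ ()) (λ ()) (λ ()) (λ _ _ ())) ⟩
    degSum G + 4 ∎
    where
    open ≤-Reasoning
    arith : ∀ n m → 2 * suc n + 2 * suc m ≡ ((n + (0 + m)) + (n + (0 + m))) + 4
    arith = solve 2 (λ n m → con 2 :* (con 1 :+ n) :+ con 2 :* (con 1 :+ m)
                          := ((n :+ (con 0 :+ m)) :+ (n :+ (con 0 :+ m))) :+ con 4) refl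
      where open +-*-Solver

  -- If p were odd on some closed walk it would be independent of the potentials and the dual
  -- paths, one dimension too many.
  planar⇒closed-even : PlanarRot ρ → ∀ p → Symmetric p → FaceClosed p →
    ∀ {u} (W : Star (Adj G) u u) → path-sum p W ≡ false
  planar⇒closed-even planar p p-symmetric p-closed W with path-sum p W in odd
  ... | false = refl
  ... | true = ⊥-elim (<-irrefl refl (begin-strict
    degSum G + 4              ≡⟨ sym planar ⟩
    2 * suc n′ + 2 * faces ρ  ≤⟨ +-monoʳ-≤ (2 * suc n′) (*-monoʳ-≤ 2 faces≤1+m) ⟩
    2 * suc n′ + 2 * suc m    <⟨ m<m+n _ {2} (s≤s z≤n) ⟩
    (2 * suc n′ + 2 * suc m) + 2 ≡⟨ arith n′ m ⟩
    ((n′ + (1 + m)) + (n′ + (1 + m))) + 4 ≤⟨ +-monoˡ-≤ 4 (Independence.dimension {1} (λ _ → p) (λ _ → p-symmetric) (λ _ → p-closed) independent) ⟩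
    degSum G + 4 ∎))
    where
    open ≤-Reasoning
    arith : ∀ n m → (2 * suc n + 2 * suc m) + 2 ≡ ((n + (1 + m)) + (n + (1 + m))) + 4
    arith = solve 2 (λ n m → (con 2 :* (con 1 :+ n) :+ con 2 :* (con 1 :+ m)) :+ con 2
                          := ((n :+ (con 1 :+ m)) :+ (n :+ (con 1 :+ m))) :+ con 4) refl
      where open +-*-Solver
    independent : ∀ (c : Fin 1 → Bool) → (∀ {u} (W : Star (Adj G) u u) →
      path-sum (λ d → ⨁ (λ i → c i ∧ p d) (allFin 1)) W ≡ false) → ∀ i → c i ≡ false
    independent c z zero with c zero | z W
    ... | false | _ = refl
    ... | true  | even with trans (sym even) (trans (path-sum-cong (λ {u} {v} _ → xor-identityʳ (p (u , v))) W) odd)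
    ...   | ()
 

-- Crossings of closed walks

module Rotations {n} (G : Graph n) (ρ : Rotation G) where

  open Faces G ρ

  iter-adj : ∀ {v u} k → Adj G v u → Adj G v (iter (rot ρ v) k u)
  iter-adj zero    a = a
  iter-adj (suc k) a = rot-adj ρ _ _ (iter-adj k a)

  -- The indicator of the neighbours of v strictly between x and y in the rotation order.
  module Interval {v x y} (ax : Adj G v x) (ay : Adj G v y) where

    σ : Fin n → Fin n
    σ = rot ρ v

    -- The discrete derivative of the indicator along σ: it switches on when leaving x and off on
    -- arriving at y. `between` is its sum starting from x.
    jump : Fin n → Bool
    jump u = does (u ≟ x) xor does (σ u ≟ y)

    visits : Fin n → ℕ → Fin n → Bool
    visits z zero    u = false
    visits z (suc k) u = visits z k u xor does (iter σ k u ≟ z)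

    jumps : ℕ → Fin n → Bool
    jumps zero    u = false
    jumps (suc k) u = jumps k u xor jump (iter σ k u)

    visits-shift : ∀ z k u → visits z k u xor does (iter σ k u ≟ z) ≡ does (u ≟ z) xor visits z k (σ u)
    visits-shift z zero u = sym (xor-identityʳ _)
    visits-shift z (suc k) u = trans
      (cong₂ _xor_ (visits-shift z k u) (cong (λ t → does (t ≟ z)) (sym (iter-comm σ k u))))
      (xor-assoc (does (u ≟ z)) (visits z k (σ u)) _)

    visits-σ : ∀ {z} → Adj G v z → ∀ k {u} → Adj G v u → visits z k u ≡ visits (σ z) k (σ u)
    visits-σ az zero au = refl
    visits-σ {z} az (suc k) {u} au = cong₂ _xor_ (visits-σ az k au)
      (does-⇔ (iter σ k u ≟ z) (iter σ k (σ u) ≟ σ z)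
        (λ e → trans (iter-comm σ k u) (cong σ e))
        (λ e → rot-inj ρ v _ _ (iter-adj k au) az (trans (sym (iter-comm σ k u)) e)))

    loop-shift : ∀ z {k u} → iter σ k u ≡ u → visits z k (σ u) ≡ visits z k u
    loop-shift z {k} {u} e = sym (cancel (trans
      (cong (λ t → visits z k u xor does (t ≟ z)) (sym e)) (visits-shift z k u)))
      where
      cancel : ∀ {a b c} → a xor b ≡ b xor c → a ≡ c
      cancel {false} {false} {false} _ = refl
      cancel {false} {true}  {false} _ = refl
      cancel {true}  {false} {true}  _ = refl
      cancel {true}  {true}  {true}  _ = refl

    -- This makes the parity of jumps depend only on the end of a trip around v, not on its winding.
    loop-visits : ∀ {z} → Adj G v z → ∀ m {k u} → Adj G v u → iter σ k u ≡ u →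
      visits (iter σ m z) k u ≡ visits z k u
    loop-visits az zero    au e = refl
    loop-visits {z} az (suc m) {k} {u} au e = trans (sym (loop-shift (iter σ (suc m) z) {k} e))
      (trans (sym (visits-σ (iter-adj m az) k au)) (loop-visits az m {k} au e))

    jumps≡visits : ∀ k u → jumps k u ≡ visits x k u xor visits y k (σ u)
    jumps≡visits zero u = refl
    jumps≡visits (suc k) u = trans (cong₂ _xor_ (jumps≡visits k u)
        (cong (λ t → does (iter σ k u ≟ x) xor does (t ≟ y)) (sym (iter-comm σ k u))))
      (interchange (visits x k u) (visits y k (σ u)) _ _)

    -- Since y is an iterate of x, a loop around v visits both equally often mod 2, so the switches
    -- cancel.
    jumps-loop : ∀ k {u} → Adj G v u → iter σ k u ≡ u → jumps k u ≡ false
    jumps-loop k {u} au e with rot-cyc ρ v x y ax ay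
    ... | m , refl = trans (jumps≡visits k u)
      (trans (cong (visits x k u xor_) (trans (loop-shift y {k} e) (loop-visits ax m {k} au e)))
             (xor-same (visits x k u)))

    jumps-+ : ∀ m k u → jumps (m + k) u ≡ jumps k u xor jumps m (iter σ k u)
    jumps-+ zero    k u = sym (xor-identityʳ _)
    jumps-+ (suc m) k u = trans (cong₂ _xor_ (jumps-+ m k u) (cong jump (iter-+ σ m k u)))
      (xor-assoc (jumps k u) _ _)

    jumps-≤ : ∀ {k m u} → Adj G v u → k ≤ m → iter σ k u ≡ iter σ m u → jumps m u ≡ jumps k u
    jumps-≤ {k} {m} {u} au k≤m e = trans (cong (λ z → jumps z u) (sym m≡))
      (trans (jumps-+ (m ∸ k) k u) (trans (cong (jumps k u xor_)
        (jumps-loop (m ∸ k) (iter-adj k au) (trans (sym (iter-+ σ (m ∸ k) k u))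
          (trans (cong (λ z → iter σ z u) m≡) (sym e))))) (xor-identityʳ _)))
      where
      m≡ : m ∸ k + k ≡ m
      m≡ = m∸n+n≡m k≤m

    jumps-cong : ∀ k m {u} → Adj G v u → iter σ k u ≡ iter σ m u → jumps k u ≡ jumps m u
    jumps-cong k m au e with ≤-total k m
    ... | inj₁ k≤m = sym (jumps-≤ au k≤m e)
    ... | inj₂ m≤k = jumps-≤ au m≤k (sym e)

    between : Fin n → Bool
    between w with adj G v w Bool.≟ true
    ... | yes a = jumps (proj₁ (rot-cyc ρ v x w ax a)) x
    ... | no  _ = false

    between-iter : ∀ k → between (iter σ k x) ≡ jumps k x
    between-iter k with adj G v (iter σ k x) Bool.≟ true
    ... | yes a = let (m , e) = rot-cyc ρ v x (iter σ k x) ax a in jumps-cong m k ax e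
    ... | no ¬a = ⊥-elim (¬a (iter-adj k ax))

    -- The start value and the derivative determine an indicator on a cyclic neighbourhood; this
    -- identifies `between` with explicit runs of neighbours.
    between-unique : ∀ (J : Fin n → Bool) → J x ≡ false →
      (∀ {u} → Adj G v u → J u xor J (σ u) ≡ jump u) → ∀ {w} → Adj G v w → between w ≡ J w
    between-unique J J₀ J-jump {w} aw with rot-cyc ρ v x w ax aw
    ... | k , refl = trans (between-iter k) (agree k)
      where
      agree : ∀ k → jumps k x ≡ J (iter σ k x)
      agree zero = sym J₀
      agree (suc k) = trans (cong₂ _xor_ (agree k) (sym (J-jump (iter-adj k ax))))
        (xor-cancelˡ (J (iter σ k x)) _)

    between-start : between x ≡ false
    between-start = between-iter 0

    between-jump : ∀ {u} → Adj G v u → between u xor between (σ u) ≡ jump u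
    between-jump {u} au with rot-cyc ρ v x u ax au
    ... | k , refl = trans (cong₂ _xor_ (between-iter k) (between-iter (suc k))) (xor-cancelˡ (jumps k x) _)

  open Interval public using (between; between-unique; between-start; between-jump)

  steps : ∀ {b z} → Star (Adj G) b z → Dart n → Bool
  steps ε d = false
  steps (_◅_ {b} {b′} a W) d = does ((b , b′) ≟ᵈ d) xor steps W d

  -- Pushing a walk a → b ⇝ z → c to one side: the darts (v , w) which leave it on that side.
  side : ∀ {a b z c} → Adj G a b → Star (Adj G) b z → Adj G z c → Dart n → Bool
  side {b = b} ab ε zc (v , w) = does (b ≟ v) ∧ between (Adj-sym ab) zc w
  side {b = b} ab (bb′ ◅ W) zc (v , w) =
    (does (b ≟ v) ∧ between (Adj-sym ab) bb′ w) xor side bb′ W zc (v , w)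

  middle-corner : ∀ {a b c} (ab : Adj G a b) (bc : Adj G b c) → ∀ v u → Adj G v u →
    (does (b ≟ v) ∧ between (Adj-sym ab) bc u) xor (does (b ≟ v) ∧ between (Adj-sym ab) bc (rot ρ v u))
      ≡ does ((a , b) ≟ᵈ (u , v)) xor does ((b , c) ≟ᵈ (v , rot ρ v u))
  middle-corner {a} {b} {c} ab bc v u au = cases (b ≟ v)
    where
    cases : (b≟v : Dec (b ≡ v)) →
      (does b≟v ∧ between (Adj-sym ab) bc u) xor (does b≟v ∧ between (Adj-sym ab) bc (rot ρ v u))
        ≡ does ((a , b) ≟ᵈ (u , v)) xor does ((b , c) ≟ᵈ (v , rot ρ v u))
    cases (yes refl) = trans (between-jump (Adj-sym ab) bc au)
      (cong₂ _xor_ (does-⇔ (u ≟ a) ((a , b) ≟ᵈ (u , b)) (λ { refl → refl }) (sym ∘ ,-injectiveˡ))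
                   (does-⇔ (rot ρ b u ≟ c) ((b , c) ≟ᵈ (b , rot ρ b u)) (λ { refl → refl }) (sym ∘ ,-injectiveʳ)))
    cases (no b≢v) = sym (cong₂ _xor_ (dec-false ((a , b) ≟ᵈ (u , v)) (b≢v ∘ ,-injectiveʳ))
                                      (dec-false ((b , c) ≟ᵈ (v , rot ρ v u)) (b≢v ∘ ,-injectiveˡ)))

  -- Each step of W counts twice, as an arrival at its head and as a departure from its tail,
  -- whereas ab only arrives and zc only departs. When zc is ab again the two halves match, as
  -- `corner-closed` demands.
  side-corner : ∀ {a b z c} (ab : Adj G a b) (W : Star (Adj G) b z) (zc : Adj G z c) →
    ∀ v u → Adj G v u → side ab W zc (v , u) xor side ab W zc (v , rot ρ v u)
      ≡ (does ((a , b) ≟ᵈ (u , v)) xor steps W (u , v))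
        xor (steps W (v , rot ρ v u) xor does ((z , c) ≟ᵈ (v , rot ρ v u)))
  side-corner {a} {b} {c = c} ab ε zc v u au =
    trans (middle-corner ab zc v u au) (cong (_xor _) (sym (xor-identityʳ (does ((a , b) ≟ᵈ (u , v))))))
  side-corner {a} {b} {z} {c} ab (_◅_ {j = b′} bb′ W) zc v u au = trans
    (interchange (does (b ≟ v) ∧ between (Adj-sym ab) bb′ u) _ _ _)
    (trans (cong₂ _xor_ (middle-corner ab bb′ v u au) (side-corner bb′ W zc v u au))
      (lemma (does ((a , b) ≟ᵈ (u , v))) (does ((b , b′) ≟ᵈ (v , rot ρ v u))) (does ((b , b′) ≟ᵈ (u , v)))
        (steps W (u , v)) (steps W (v , rot ρ v u)) (does ((z , c) ≟ᵈ (v , rot ρ v u)))))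
    where
    lemma : ∀ p q r s t o → (p xor q) xor ((r xor s) xor (t xor o)) ≡ (p xor (r xor s)) xor ((q xor t) xor o)
    lemma = solve 6 (λ p q r s t o → (p :+ q) :+ ((r :+ s) :+ (t :+ o)) := (p :+ (r :+ s)) :+ ((q :+ t) :+ o)) refl
      where open xor-∧-Solver

  -- The Poincaré dual of the closed walk, as a symmetric function: add, over both darts of an edge,
  -- the departures from the pushed-off walk. Its sum along another closed walk is their
  -- intersection number mod 2.
  crossing : ∀ {a b} → Adj G a b → Star (Adj G) b a → Dart n → Bool
  crossing ab W d = side ab W ab d xor side ab W ab (swap d)

  crossing-closed : ∀ {a b} (ab : Adj G a b) (W : Star (Adj G) b a) → FaceClosed (crossing ab W)
  crossing-closed {a} {b} ab W = corner-closed (side ab W ab)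
    (λ d → does ((a , b) ≟ᵈ d) xor steps W d)
    λ v u au → trans (side-corner ab W ab v u au)
      (cong ((does ((a , b) ≟ᵈ (u , v)) xor steps W (u , v)) xor_)
        (xor-comm (steps W (v , rot ρ v u)) _))

module Jordan {n′} (G : Graph (suc n′)) (connected : Connected G)
  (ρ : Rotation G) (planar : PlanarRot ρ) where

  open Faces G ρ
  open Rotations G ρ

  closed-walks-cross-evenly : ∀ {a b} (ab : Adj G a b) (W : Star (Adj G) b a) →
    ∀ {u} (D : Star (Adj G) u u) → path-sum (crossing ab W) D ≡ false
  closed-walks-cross-evenly ab W = Cohomology.planar⇒closed-even G ρ connected ab planar
    (crossing ab W) (λ d → xor-comm (side ab W ab (swap d)) (side ab W ab d)) (crossing-closed ab W)

  -- If the face to the left of u → v → w were larger than the triangle u v w, then the chord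
  -- from v to the next vertex of that face would cross this triangle.
  triangle : (∀ {v u} → Adj G v u → rot ρ v u ≢ u → Adj G u (rot ρ v u)) →
    ∀ {v u w} → Adj G v u → rot ρ v u ≡ w → w ≢ u → rot ρ w v ≡ u
  triangle chord {v} {u} {w} vu refl w≢u with rot ρ w v ≟ u
  ... | yes eq = eq
  ... | no x≢u = ⊥-elim (contradiction (closed-walks-cross-evenly wu C D))
    where
    vw : Adj G v w
    vw = rot-adj ρ v u vu
    uv = Adj-sym vu
    wv = Adj-sym vw
    wu : Adj G w u
    wu = Adj-sym (chord vu w≢u)
    x = rot ρ w v
    wx : Adj G w x
    wx = rot-adj ρ w v wv
    xw = Adj-sym wx
    x≢v : x ≢ v
    -- A fixed point of a cyclic rotation would be the only neighbour of w, but u is another one.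
    x≢v fixed with rot-cyc ρ w v u wv wu
    ... | k , reach = Adj⇒≢ vu (trans (sym (constant k)) reach)
      where
      constant : ∀ k → iter (rot ρ w) k v ≡ v
      constant zero = refl
      constant (suc k) = trans (cong (rot ρ w) (constant k)) fixed
    vx : Adj G v x
    vx = chord wv x≢v
    C : Star (Adj G) u w
    C = uv ◅ vw ◅ ε
    D : Star (Adj G) v v
    D = vx ◅ xw ◅ wv ◅ ε

    at-v : ∀ {t} → Adj G v t → between (Adj-sym uv) vw t ≡ false
    at-v = between-unique (Adj-sym uv) vw (λ _ → false) refl λ {t} vt →
      sym (trans (cong (_xor does (rot ρ v t ≟ w)) (does-⇔ (t ≟ u) (rot ρ v t ≟ w)
        (cong (rot ρ v)) (rot-inj ρ v t u vt vu))) (xor-same (does (rot ρ v t ≟ w))))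

    at-w : between (Adj-sym vw) wu x ≡ true
    at-w = trans (sym (cong (_xor between (Adj-sym vw) wu x) (between-start (Adj-sym vw) wu)))
      (trans (between-jump (Adj-sym vw) wu wv)
        (cong₂ _xor_ (dec-true (v ≟ v) refl) (dec-false (x ≟ u) x≢u)))

    collect : ∀ {p q r} p′ q′ r′ → p ≡ false → q ≡ false → r ≡ false →
      (p ∧ p′) xor ((q ∧ q′) xor (r ∧ r′)) ≡ false
    collect _ _ _ refl refl refl = refl

    away : ∀ {s} t → u ≢ s → v ≢ s → w ≢ s → side wu C wu (s , t) ≡ false
    away {s} t u≢ v≢ w≢ = collect _ _ _ (dec-false (u ≟ s) u≢) (dec-false (v ≟ s) v≢) (dec-false (w ≟ s) w≢)

    side-v : ∀ t → side wu C wu (v , t) ≡ between (Adj-sym uv) vw t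
    side-v t = collect′ (dec-false (u ≟ v) (Adj⇒≢ uv)) (dec-true (v ≟ v) refl) (dec-false (w ≟ v) (Adj⇒≢ wv))
      where
      collect′ : ∀ {p q r p′ q′ r′} → p ≡ false → q ≡ true → r ≡ false →
        (p ∧ p′) xor ((q ∧ q′) xor (r ∧ r′)) ≡ q′
      collect′ refl refl refl = xor-identityʳ _

    side-w : ∀ t → side wu C wu (w , t) ≡ between (Adj-sym vw) wu t
    side-w t = collect′ (dec-false (u ≟ w) (Adj⇒≢ (Adj-sym wu))) (dec-false (v ≟ w) (Adj⇒≢ vw)) (dec-true (w ≟ w) refl)
      where
      collect′ : ∀ {p q r p′ q′ r′} → p ≡ false → q ≡ false → r ≡ true →
        (p ∧ p′) xor ((q ∧ q′) xor (r ∧ r′)) ≡ r′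
      collect′ refl refl refl = refl

    x-away : ∀ t → side wu C wu (x , t) ≡ false
    x-away t = away t (x≢u ∘ sym) (x≢v ∘ sym) (Adj⇒≢ wx)

    -- The only odd contribution is the dart from w to x, which lies strictly between v and u around
    -- w.
    odd : path-sum (crossing wu C) D ≡ true
    odd = cong₂ _xor_ (cong₂ _xor_ (trans (side-v x) (at-v vx)) (x-away v))
      (cong₂ _xor_ (cong₂ _xor_ (x-away w) (trans (side-w x) at-w))
        (cong₂ _xor_ (cong₂ _xor_ (trans (side-w v) (between-start (Adj-sym vw) wu))
                                  (trans (side-v w) (at-v vw)))
          (refl {x = false})))

    contradiction : path-sum (crossing wu C) D ≡ false → ⊥
    contradiction even with trans (sym even) odd
    ... | ()

-- Adding a chord to a face

record CyclicOn {A : Set} (P : A → Set) (σ : A → A) : Set where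
  field
    closed    : ∀ {x} → P x → P (σ x)
    injective : ∀ {x y} → P x → P y → σ x ≡ σ y → x ≡ y
    reach     : ∀ {x y} → P x → P y → ∃ λ k → iter σ k x ≡ y

  iter-closed : ∀ k {x} → P x → P (iter σ k x)
  iter-closed zero    p = p
  iter-closed (suc k) p = closed (iter-closed k p)

  preimage : ∀ {x} → P x → ∃ λ z → P z × σ z ≡ x
  preimage {x} p with reach (closed p) p
  ... | k , e = iter σ k x , iter-closed k p , trans (sym (iter-comm σ k x)) e

open CyclicOn

rot-cyclic : ∀ {n} {G : Graph n} (ρ : Rotation G) v → CyclicOn (Adj G v) (rot ρ v)
rot-cyclic ρ v = record
  { closed = rot-adj ρ v _ ; injective = rot-inj ρ v _ _ ; reach = rot-cyc ρ v _ _ }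

cyclic⇒rotation : ∀ {n} (G : Graph n) (σ : Fin n → Fin n → Fin n) →
  (∀ v → CyclicOn (Adj G v) (σ v)) → Rotation G
cyclic⇒rotation G σ c = record
  { rot = σ
  ; rot-adj = λ v w → closed (c v)
  ; rot-inj = λ v w w′ → injective (c v)
  ; rot-cyc = λ v w w′ → reach (c v)
  }

cyclic-resp : ∀ {A : Set} {P Q : A → Set} {σ} → (∀ {x} → P x → Q x) → (∀ {x} → Q x → P x) →
  CyclicOn P σ → CyclicOn Q σ
cyclic-resp f g c = record
  { closed = f ∘ closed c ∘ g
  ; injective = λ p q → injective c (g p) (g q)
  ; reach = λ p q → reach c (g p) (g q) }

reach-trans : ∀ {A : Set} (σ : A → A) {x y z : A} →
  (∃ λ k → iter σ k x ≡ y) → (∃ λ k → iter σ k y ≡ z) → ∃ λ k → iter σ k x ≡ z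
reach-trans σ {x} (k , refl) (m , refl) = m + k , iter-+ σ m k x

module _ {n : ℕ} where

  insert : (Fin n → Fin n) → Fin n → Fin n → Fin n → Fin n
  insert σ z t x = if does (x ≟ t) then σ z else if does (x ≟ z) then t else σ x

  insert-new : ∀ σ z t → insert σ z t t ≡ σ z
  insert-new σ z t rewrite dec-true (t ≟ t) refl = refl

  insert-before : ∀ σ {z t} → z ≢ t → insert σ z t z ≡ t
  insert-before σ {z} {t} z≢t rewrite dec-false (z ≟ t) z≢t | dec-true (z ≟ z) refl = refl

  insert-other : ∀ σ {z t x} → x ≢ t → x ≢ z → insert σ z t x ≡ σ x
  insert-other σ {z} {t} {x} x≢t x≢z rewrite dec-false (x ≟ t) x≢t | dec-false (x ≟ z) x≢z = refl

  insert-cyclic : ∀ {P : Fin n → Set} {σ z t} → CyclicOn P σ → P z → ¬ P t →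
    CyclicOn (λ x → P x ⊎ x ≡ t) (insert σ z t)
  insert-cyclic {P} {σ} {z} {t} c pz ¬pt = record
    { closed = closed′ ; injective = injective′ ; reach = reach′ }
    where
    σ′ = insert σ z t

    ≢t : ∀ {x} → P x → x ≢ t
    ≢t p refl = ¬pt p

    data View (x : Fin n) : Set where
      new    : x ≡ t → σ′ x ≡ σ z → View x
      before : x ≡ z → σ′ x ≡ t → View x
      other  : P x → x ≢ z → σ′ x ≡ σ x → View x

    view : ∀ {x} → P x ⊎ x ≡ t → View x
    view (inj₂ refl) = new refl (insert-new σ z t)
    view {x} (inj₁ p) with x ≟ z
    ... | yes refl = before refl (insert-before σ (≢t p))
    ... | no x≢z = other p x≢z (insert-other σ (≢t p) x≢z)

    closed′ : ∀ {x} → P x ⊎ x ≡ t → P (σ′ x) ⊎ σ′ x ≡ t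
    closed′ q with view q
    ... | new _ e = inj₁ (subst P (sym e) (closed c pz))
    ... | before _ e = inj₂ e
    ... | other p _ e = inj₁ (subst P (sym e) (closed c p))

    injective′ : ∀ {x y} → P x ⊎ x ≡ t → P y ⊎ y ≡ t → σ′ x ≡ σ′ y → x ≡ y
    injective′ q r eq with view q | view r
    ... | new refl _ | new refl _ = refl
    ... | before refl _ | before refl _ = refl
    ... | other p _ e | other p′ _ e′ = injective c p p′ (trans (sym e) (trans eq e′))
    ... | new _ e | before _ e′ = ⊥-elim (≢t (closed c pz) (trans (sym e) (trans eq e′)))
    ... | before _ e | new _ e′ = ⊥-elim (≢t (closed c pz) (trans (sym e′) (trans (sym eq) e)))
    ... | new _ e | other p ne e′ = ⊥-elim (ne (sym (injective c pz p (trans (sym e) (trans eq e′)))))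
    ... | other p ne e | new _ e′ = ⊥-elim (ne (injective c p pz (trans (sym e) (trans eq e′))))
    ... | before _ e | other p _ e′ = ⊥-elim (≢t (closed c p) (trans (sym e′) (trans (sym eq) e)))
    ... | other p _ e | before _ e′ = ⊥-elim (≢t (closed c p) (trans (sym e) (trans eq e′)))

    step-old : ∀ {x} → P x → ∃ λ k → iter σ′ k x ≡ σ x
    step-old p with view (inj₁ p)
    ... | new refl _ = ⊥-elim (¬pt p)
    ... | before refl e = 2 , trans (cong σ′ e) (insert-new σ z t)
    ... | other _ _ e = 1 , e

    old : ∀ k {x} → P x → ∃ λ m → iter σ′ m x ≡ iter σ k x
    old zero p = 0 , refl
    old (suc k) p = reach-trans σ′ (old k p) (step-old (iter-closed c k p))

    from-old : ∀ {x y} → P x → P y ⊎ y ≡ t → ∃ λ k → iter σ′ k x ≡ y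
    from-old p (inj₁ p′) with reach c p p′
    ... | k , refl = old k p
    from-old p (inj₂ refl) = reach-trans σ′ (from-old p (inj₁ pz)) (1 , insert-before σ (≢t pz))

    reach′ : ∀ {x y} → P x ⊎ x ≡ t → P y ⊎ y ≡ t → ∃ λ k → iter σ′ k x ≡ y
    reach′ (inj₁ p) q = from-old p q
    reach′ (inj₂ refl) q = reach-trans σ′ (1 , insert-new σ z t) (from-old (closed c pz) q)

  skip : (Fin n → Fin n) → Fin n → Fin n → Fin n
  skip σ t x = if does (σ x ≟ t) then σ t else σ x

  skip-yes : ∀ σ {t x} → σ x ≡ t → skip σ t x ≡ σ t
  skip-yes σ {t} {x} e rewrite dec-true (σ x ≟ t) e = refl

  skip-no : ∀ σ {t x} → σ x ≢ t → skip σ t x ≡ σ x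
  skip-no σ {t} {x} e rewrite dec-false (σ x ≟ t) e = refl

  skip-cyclic : ∀ {P : Fin n → Set} {σ t} → CyclicOn P σ → Dec (P t) →
    CyclicOn (λ x → P x × x ≢ t) (skip σ t)
  skip-cyclic {P} {σ} {t} c (no ¬pt) = record
    { closed = λ (p , _) → subst P (sym (same p)) (closed c p) , λ e → ¬pt (subst P (trans (sym (same p)) e) (closed c p))
    ; injective = λ (p , _) (q , _) e → injective c p q (trans (sym (same p)) (trans e (same q)))
    ; reach = λ (p , _) (q , _) → let (k , e) = reach c p q in k , trans (same-iter k p) e
    }
    where
    same : ∀ {x} → P x → skip σ t x ≡ σ x
    same p = skip-no σ λ e → ¬pt (subst P e (closed c p))
    same-iter : ∀ k {x} → P x → iter (skip σ t) k x ≡ iter σ k x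
    same-iter zero p = refl
    same-iter (suc k) p = trans (cong (skip σ t) (same-iter k p)) (same (iter-closed c k p))
  skip-cyclic {P} {σ} {t} c (yes pt) = record
    { closed = closed′ ; injective = injective′ ; reach = reach′ }
    where
    τ = skip σ t

    σt≢t : ∀ {x} → P x → x ≢ t → σ t ≢ t
    σt≢t {x} p x≢t fixed with reach c pt p
    ... | k , e = x≢t (trans (sym e) (constant k))
      where
      constant : ∀ k → iter σ k t ≡ t
      constant zero = refl
      constant (suc k) = trans (cong σ (constant k)) fixed

    closed′ : ∀ {x} → P x × x ≢ t → P (τ x) × τ x ≢ t
    closed′ {x} (p , x≢t) with σ x ≟ t
    ... | yes _ = closed c pt , σt≢t p x≢t
    ... | no ne = closed c p , ne

    injective′ : ∀ {x y} → P x × x ≢ t → P y × y ≢ t → τ x ≡ τ y → x ≡ y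
    injective′ {x} {y} (p , x≢t) (q , y≢t) eq with σ x ≟ t | σ y ≟ t
    ... | yes e | yes e′ = injective c p q (trans e (sym e′))
    ... | no _  | no _   = injective c p q eq
    ... | yes _ | no _   = ⊥-elim (y≢t (sym (injective c pt q eq)))
    ... | no _  | yes _  = ⊥-elim (x≢t (injective c p pt eq))

    -- The shortened cycle follows the old one but has to leap over t; when σ stands on t, the
    -- invariant is stated for the element after it.
    along : ∀ k {x} → P x → x ≢ t →
      (iter σ k x ≢ t → ∃ λ m → iter τ m x ≡ iter σ k x) ×
      (iter σ k x ≡ t → ∃ λ m → iter τ m x ≡ iter σ (suc k) x)
    along zero p x≢t = (λ _ → 0 , refl) , λ e → ⊥-elim (x≢t e)
    along (suc k) {x} p x≢t with along k p x≢t | iter σ k x ≟ t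
    ... | f , g | yes e = (λ _ → g e) , λ e′ → ⊥-elim (σt≢t p x≢t (trans (cong σ (sym e)) e′))
    ... | f , g | no ne =
      (λ ne′ → reach-trans τ (f ne) (1 , skip-no σ ne′)) ,
      (λ e′ → reach-trans τ (f ne) (1 , trans (skip-yes σ e′) (cong σ (sym e′))))

    reach′ : ∀ {x y} → P x × x ≢ t → P y × y ≢ t → ∃ λ k → iter τ k x ≡ y
    reach′ (p , x≢t) (q , y≢t) with reach c p q
    ... | k , refl = proj₁ (along k p x≢t) y≢t

cyclic-pullback : ∀ {A B : Set} {P : B → Set} {τ : B → B} (f : A → B) (σ : A → A) →
  (∀ {x y} → f x ≡ f y → x ≡ y) → (∀ {x} → P (f x) → f (σ x) ≡ τ (f x)) →
  CyclicOn P τ → CyclicOn (P ∘ f) σ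
cyclic-pullback {P = P} {τ} f σ f-injective commutes c = record
  { closed = λ p → subst P (sym (commutes p)) (closed c p)
  ; injective = λ p q e → f-injective (injective c p q (trans (sym (commutes p)) (trans (cong f e) (commutes q))))
  ; reach = λ p q → let (k , e) = reach c p q in k , f-injective (trans (iterate k p) e)
  }
  where
  iterate : ∀ k {x} → P (f x) → f (iter σ k x) ≡ iter τ k (f x)
  iterate zero p = refl
  iterate (suc k) {x} p = trans (commutes (subst P (sym (iterate k p)) (iter-closed c k p))) (cong τ (iterate k p))

-- The edges v u and v w bound a common face at v. The chord is drawn in that face and cuts off the
-- triangle u v w: one more edge, one more face, and all other faces unchanged.
module Chord {n′} (G : Graph (suc n′)) (connected : Connected G)
  (ρ : Rotation G) (planar : PlanarRot ρ)
  {v u w : Fin (suc n′)} (vu : Adj G v u) (rot-u : rot ρ v u ≡ w) (u≢w : u ≢ w) (non-adj : adj G u w ≡ false) where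

  open Faces G ρ

  G⁺ : Graph (suc n′)
  G⁺ = addEdge G u w u≢w

  vw : Adj G v w
  vw = subst (Adj G v) rot-u (rot-adj ρ v u vu)

  vw~uv : (v , w) ~ (u , v)
  vw~uv = ~-sym {u , v} (Adj-sym vu) (1 , cong (v ,_) rot-u)

  ¬uw : ¬ Adj G u w
  ¬uw a with trans (sym a) non-adj
  ... | ()

  ¬wu : ¬ Adj G w u
  ¬wu a = ¬uw (Adj-sym a)

  -- The predecessor of v around u. With w inserted between z and v, the dart (w , u) is followed by
  -- (u , v), which closes the triangle.
  z : Fin (suc n′)
  z = proj₁ (preimage (rot-cyclic ρ u) (Adj-sym vu))

  uz : Adj G u z
  uz = proj₁ (proj₂ (preimage (rot-cyclic ρ u) (Adj-sym vu)))

  rot-z : rot ρ u z ≡ v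
  rot-z = proj₂ (proj₂ (preimage (rot-cyclic ρ u) (Adj-sym vu)))

  data New : Fin (suc n′) → Fin (suc n′) → Set where
    uw : New u w
    wu : New w u

  old⁺ : ∀ {x y} → Adj G x y → Adj G⁺ x y
  old⁺ a rewrite a = refl

  uw⁺ : Adj G⁺ u w
  uw⁺ rewrite non-adj | dec-true (u ≟ u) refl | dec-true (w ≟ w) refl = refl

  wu⁺ : Adj G⁺ w u
  wu⁺ = trans (adj-sym G⁺ w u) uw⁺

  adj⁺⁻ : ∀ {x y} → Adj G⁺ x y → Adj G x y ⊎ New x y
  adj⁺⁻ {x} {y} a with adj G x y
  ... | true = inj₁ refl
  ... | false with x ≟ u | y ≟ w | x ≟ w | y ≟ u
  ...   | yes refl | yes refl | _ | _ = inj₂ uw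
  ...   | _ | _ | yes refl | yes refl = inj₂ wu
  adj⁺⁻ () | false | no _ | _ | no _ | _
  adj⁺⁻ () | false | no _ | _ | yes _ | no _
  adj⁺⁻ () | false | yes _ | no _ | no _ | _
  adj⁺⁻ () | false | yes _ | no _ | yes _ | no _

  σ : (x : Fin (suc n′)) → Dec (x ≡ u) → Dec (x ≡ w) → Fin (suc n′) → Fin (suc n′)
  σ x (yes _) _       = insert (rot ρ u) z w
  σ x (no _)  (yes _) = insert (rot ρ w) v u
  σ x (no _)  (no _)  = rot ρ x

  σ-cyclic : ∀ x (p : Dec (x ≡ u)) (q : Dec (x ≡ w)) → CyclicOn (Adj G⁺ x) (σ x p q)
  σ-cyclic x (yes refl) _ = cyclic-resp to from (insert-cyclic (rot-cyclic ρ u) uz ¬uw)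
    where
    to : ∀ {y} → Adj G u y ⊎ y ≡ w → Adj G⁺ u y
    to (inj₁ a) = old⁺ a
    to (inj₂ refl) = uw⁺
    from : ∀ {y} → Adj G⁺ u y → Adj G u y ⊎ y ≡ w
    from {y} a with adj⁺⁻ {u} {y} a
    ... | inj₁ b = inj₁ b
    ... | inj₂ uw = inj₂ refl
    ... | inj₂ wu = ⊥-elim (u≢w refl)
  σ-cyclic x (no x≢u) (yes refl) = cyclic-resp to from (insert-cyclic (rot-cyclic ρ w) (Adj-sym vw) ¬wu)
    where
    to : ∀ {y} → Adj G w y ⊎ y ≡ u → Adj G⁺ w y
    to (inj₁ a) = old⁺ a
    to (inj₂ refl) = wu⁺
    from : ∀ {y} → Adj G⁺ w y → Adj G w y ⊎ y ≡ u
    from {y} a with adj⁺⁻ {w} {y} a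
    ... | inj₁ b = inj₁ b
    ... | inj₂ wu = inj₂ refl
    ... | inj₂ uw = ⊥-elim (x≢u refl)
  σ-cyclic x (no x≢u) (no x≢w) = cyclic-resp old⁺ from (rot-cyclic ρ x)
    where
    from : ∀ {y} → Adj G⁺ x y → Adj G x y
    from {y} a with adj⁺⁻ {x} {y} a
    ... | inj₁ b = b
    ... | inj₂ uw = ⊥-elim (x≢u refl)
    ... | inj₂ wu = ⊥-elim (x≢w refl)

  ρ⁺ : Rotation G⁺
  ρ⁺ = cyclic⇒rotation G⁺ (λ x → σ x (x ≟ u) (x ≟ w)) (λ x → σ-cyclic x (x ≟ u) (x ≟ w))

  module F⁺ = Faces G⁺ ρ⁺

  rot⁺-u : ∀ y → rot ρ⁺ u y ≡ insert (rot ρ u) z w y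
  rot⁺-u y with u ≟ u
  ... | yes _ = refl
  ... | no ne = ⊥-elim (ne refl)

  rot⁺-w : ∀ y → rot ρ⁺ w y ≡ insert (rot ρ w) v u y
  rot⁺-w y with w ≟ u | w ≟ w
  ... | yes e | _ = ⊥-elim (u≢w (sym e))
  ... | no _ | yes _ = refl
  ... | no _ | no ne = ⊥-elim (ne refl)

  rot⁺-other : ∀ {x} y → x ≢ u → x ≢ w → rot ρ⁺ x y ≡ rot ρ x y
  rot⁺-other {x} y x≢u x≢w with x ≟ u | x ≟ w
  ... | yes e | _ = ⊥-elim (x≢u e)
  ... | no _ | yes e = ⊥-elim (x≢w e)
  ... | no _ | no _ = refl

  -- The rotations change only at z around u and at v around w; the corresponding darts (z , u) and
  -- (v , w) lie on the face being cut.
  φ⁺-old : ∀ {d} → IsDart d → ¬ d ~ (u , v) → F⁺.φ d ≡ φ d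
  φ⁺-old {s , x} a far with x ≟ u
  ... | yes refl = cong (u ,_) (insert-other (rot ρ u)
        (λ { refl → ¬wu a }) (λ { refl → far (1 , cong (u ,_) rot-z) }))
  ... | no _ with x ≟ w
  ...   | yes refl = cong (w ,_) (insert-other (rot ρ w)
        (λ { refl → ¬uw a }) (λ { refl → far vw~uv }))
  ...   | no _ = refl

  iter⁺-old : ∀ k {d} → IsDart d → ¬ d ~ (u , v) → iter F⁺.φ k d ≡ iter φ k d
  iter⁺-old zero a far = refl
  iter⁺-old (suc k) {d} a far = trans (cong F⁺.φ (iter⁺-old k a far))
    (φ⁺-old (iter-dart k a) (far ∘ ~-trans (k , refl)))

  data Corner : Dart (suc n′) → Set where
    uv : Corner (u , v)
    vw′ : Corner (v , w)
    wu : Corner (w , u)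

  corner-iter : ∀ k → Corner (iter F⁺.φ k (u , v))
  corner-iter zero = uv
  corner-iter (suc k) with iter F⁺.φ k (u , v) | corner-iter k
  ... | _ | uv  = subst Corner (cong (v ,_) (sym (trans (rot⁺-other u (Adj⇒≢ vu) (Adj⇒≢ vw)) rot-u))) vw′
  ... | _ | vw′ = subst Corner (cong (w ,_) (sym (trans (rot⁺-w v) (insert-before (rot ρ w) (Adj⇒≢ vu))))) wu
  ... | _ | wu  = subst Corner (cong (u ,_) (sym (trans (rot⁺-u w) (trans (insert-new (rot ρ u) z w) rot-z)))) uv

  rest : List (Dart (suc n′))
  rest = filter (λ d → ¬? (d ≟ᵈ rep (u , v))) reps

  rest⁻ : ∀ {d} → d ∈ rest → d ∈ reps × ¬ d ~ (u , v)
  rest⁻ {d} d∈ with ∈-filter⁻ (λ d → ¬? (d ≟ᵈ rep (u , v))) {xs = reps} d∈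
  ... | d∈reps , ne = d∈reps , λ s → ne (trans (sym (∈-reps⇒rep≡ d∈reps)) (~⇒rep≡ (proj₁ (∈-reps⁻ d∈reps)) s))

  faces≤ : faces ρ ≤ suc (length rest)
  faces≤ = subst (_≤ suc (length rest)) (sym length-reps) (unique-⊆⇒length≤ reps-unique sub)
    where
    sub : ∀ {d} → d ∈ reps → d ∈ rep (u , v) ∷ rest
    sub {d} d∈ with d ≟ᵈ rep (u , v)
    ... | yes e = here e
    ... | no ne = there (∈-filter⁺ _ d∈ ne)

  faces⁺≥ : suc (suc (length rest)) ≤ faces ρ⁺
  faces⁺≥ = F⁺.length≤faces {(u , v) ∷ (u , w) ∷ rest}
    (old⁺ (Adj-sym vu) ∷ uw⁺ ∷ All.tabulate (λ d∈ → old⁺ (proj₁ (∈-reps⁻ (proj₁ (rest⁻ d∈))))))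
    ((uv-uw ∷ All.tabulate uv-rest) ∷ All.tabulate uw-rest ∷
      distinct (filter⁺ _ reps-unique) (All.tabulate rest⁻))
    where
    uv-uw : ¬ (u , v) F⁺.~ (u , w)
    uv-uw (k , e) with iter F⁺.φ k (u , v) | corner-iter k
    uv-uw (k , e) | _ | uv = Adj⇒≢ vw (,-injectiveʳ e)
    uv-uw (k , e) | _ | vw′ = Adj⇒≢ vu (,-injectiveˡ e)
    uv-uw (k , e) | _ | wu = u≢w (,-injectiveʳ e)

    uv-rest : ∀ {d} → d ∈ rest → ¬ (u , v) F⁺.~ d
    uv-rest d∈ (k , refl) with iter F⁺.φ k (u , v) | corner-iter k | rest⁻ d∈
    ... | _ | uv  | _ , far = far ~-refl
    ... | _ | vw′ | _ , far = far vw~uv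
    ... | _ | wu  | d∈reps , _ = ¬wu (proj₁ (∈-reps⁻ d∈reps))

    uw-rest : ∀ {d} → d ∈ rest → ¬ (u , w) F⁺.~ d
    uw-rest {d} d∈ s with rest⁻ d∈
    ... | d∈reps , far with F⁺.~-sym {u , w} uw⁺ s
    ...   | k , e = ¬uw (subst IsDart (trans (sym (iter⁺-old k a far)) e) (iter-dart k a))
      where a = proj₁ (∈-reps⁻ d∈reps)

    distinct : ∀ {ds} → Unique ds → All (λ d → d ∈ reps × ¬ d ~ (u , v)) ds →
      AllPairs (λ d e → ¬ d F⁺.~ e) ds
    distinct [] [] = []
    distinct (ne ∷ us) ((d∈ , far) ∷ ps) =
      All.zipWith (λ (d≢e , e∈ , _) (k , eq) → d≢e (same d∈ far e∈ (k , eq))) (ne , ps) ∷ distinct us ps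
      where
      same : ∀ {d e} → d ∈ reps → ¬ d ~ (u , v) → e ∈ reps → d F⁺.~ e → d ≡ e
      same {d} d∈ far e∈ (k , eq) = trans (sym (∈-reps⇒rep≡ d∈))
        (trans (~⇒rep≡ a (k , trans (sym (iter⁺-old k a far)) eq)) (∈-reps⇒rep≡ e∈))
        where a = proj₁ (∈-reps⁻ d∈)

  degSum⁺ : degSum G⁺ ≤ 2 + degSum G
  degSum⁺ = subst₂ _≤_ (sym F⁺.length-darts) (cong (2 +_) (sym length-darts))
    (unique-⊆⇒length≤ F⁺.darts-unique sub)
    where
    sub : ∀ {d} → d ∈ F⁺.darts → d ∈ (u , w) ∷ (w , u) ∷ darts
    sub {x , y} d∈ with adj⁺⁻ {x} {y} (F⁺.∈-darts⁻ d∈)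
    ... | inj₁ a = there (there (∈-darts⁺ a))
    ... | inj₂ uw = here refl
    ... | inj₂ wu = there (here refl)

  connected⁺ : Connected G⁺
  connected⁺ x y = go (connected x y)
    where
    go : ∀ {x y} → Walk G x y → Walk G⁺ x y
    go here = here
    go (step a W) = step (old⁺ a) (go W)

  planar⁺ : PlanarRot ρ⁺
  planar⁺ = ≤-antisym (Cohomology.euler-≤ G⁺ ρ⁺ connected⁺ {u , w} uw⁺) (begin
    degSum G⁺ + 4                 ≤⟨ +-monoˡ-≤ 4 degSum⁺ ⟩
    (2 + degSum G) + 4            ≡⟨ +-assoc 2 (degSum G) 4 ⟩
    2 + (degSum G + 4)            ≡⟨ cong (2 +_) (sym planar) ⟩
    2 + (2 * suc n′ + 2 * faces ρ) ≤⟨ +-monoʳ-≤ 2 (+-monoʳ-≤ (2 * suc n′) (*-monoʳ-≤ 2 faces≤)) ⟩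
    2 + (2 * suc n′ + 2 * suc (length rest)) ≡⟨ arith n′ (length rest) ⟩
    2 * suc n′ + 2 * suc (suc (length rest)) ≤⟨ +-monoʳ-≤ (2 * suc n′) (*-monoʳ-≤ 2 faces⁺≥) ⟩
    2 * suc n′ + 2 * faces ρ⁺ ∎)
    where
    open ≤-Reasoning
    arith : ∀ n l → 2 + (2 * suc n + 2 * suc l) ≡ 2 * suc n + 2 * suc (suc l)
    arith = solve 2 (λ n l → con 2 :+ (con 2 :* (con 1 :+ n) :+ con 2 :* (con 1 :+ l))
      := con 2 :* (con 1 :+ n) :+ con 2 :* (con 2 :+ l)) refl
      where open +-*-Solver

-- A missing chord could be added without losing planarity, against maximality. A fixed neighbour,
-- at a vertex of degree one, offers no chord.
mpg-chord : ∀ {n′} (G : Graph (suc n′)) → Connected G → MPG G → (ρ : Rotation G) → PlanarRot ρ →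
  ∀ {v u} → Adj G v u → rot ρ v u ≢ u → Adj G u (rot ρ v u)
mpg-chord G connected (_ , maximal) ρ planar {v} {u} vu ne with adj G u (rot ρ v u) in eq
... | true = refl
... | false = ⊥-elim (maximal u (rot ρ v u) (ne ∘ sym) eq (inj₂ (Added.ρ⁺ , Added.planar⁺)))
  where module Added = Chord G connected ρ planar vu refl (ne ∘ sym) eq

-- Deleting a vertex

-- Deleting a loses one vertex, deg a edges and at most deg a faces, while the merged face is
-- gained, so V - E + F does not drop. `moves` makes consecutive neighbours of a distinct, hence
-- adjacent by `chord`.
module Deletion {n″} (G : Graph (suc (suc n″))) (connected : Connected G)
  (ρ : Rotation G) (planar : PlanarRot ρ)
  (chord : ∀ {v u} → Adj G v u → rot ρ v u ≢ u → Adj G u (rot ρ v u))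
  (a : Fin (suc (suc n″))) {b : Fin (suc (suc n″))} (ab : Adj G a b)
  (moves : ∀ {w} → Adj G a w → rot ρ a w ≢ w) where

  open Faces G ρ

  V : Set
  V = Fin (suc (suc n″))

  ι : Fin (suc n″) → V
  ι = punchIn a

  ι≢a : ∀ i → ι i ≢ a
  ι≢a i = punchInᵢ≢i a i

  ι-injective : ∀ {i j} → ι i ≡ ι j → i ≡ j
  ι-injective = punchIn-injective a _ _

  -- A total inverse of `ι`: the default is returned only at a, where no statement about the result
  -- is made.
  pull : Fin (suc n″) → V → Fin (suc n″)
  pull default x with a ≟ x
  ... | yes _ = default
  ... | no a≢x = punchOut a≢x

  ι-pull : ∀ {i x} → x ≢ a → ι (pull i x) ≡ x
  ι-pull {i} {x} x≢a with a ≟ x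
  ... | yes e = ⊥-elim (x≢a (sym e))
  ... | no a≢x = punchIn-punchOut a≢x

  covered : ∀ {x} → x ≢ a → ∃ λ i → ι i ≡ x
  covered {x} x≢a = punchOut (x≢a ∘ sym) , punchIn-punchOut (x≢a ∘ sym)

  H : Graph (suc n″)
  H = record
    { adj = λ i j → adj G (ι i) (ι j)
    ; sym = λ i j → adj-sym G (ι i) (ι j)
    ; irrefl = λ i → adj-irrefl G (ι i) }

  σ : Fin (suc n″) → Fin (suc n″) → Fin (suc n″)
  σ i j = pull j (skip (rot ρ (ι i)) a (ι j))

  skipped : ∀ i → CyclicOn (λ y → Adj G (ι i) y × y ≢ a) (skip (rot ρ (ι i)) a)
  skipped i = skip-cyclic (rot-cyclic ρ (ι i)) (adj G (ι i) a Bool.≟ true)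

  ρᴴ : Rotation H
  ρᴴ = cyclic⇒rotation H σ λ i → cyclic-resp proj₁ (λ {j} e → e , ι≢a j)
    (cyclic-pullback ι (σ i) ι-injective
      (λ p → ι-pull (proj₂ (CyclicOn.closed (skipped i) p))) (skipped i))

  module Fᴴ = Faces H ρᴴ

  ιᵈ : Dart (suc n″) → Dart (suc (suc n″))
  ιᵈ (i , j) = ι i , ι j

  ιᵈ-injective : ∀ {d e} → ιᵈ d ≡ ιᵈ e → d ≡ e
  ιᵈ-injective eq = cong₂ _,_ (ι-injective (,-injectiveˡ eq)) (ι-injective (,-injectiveʳ eq))

  Untouched : Dart (suc (suc n″)) → Set
  Untouched d = ∀ w → Adj G a w → ¬ d ~ (a , w)

  untouched-φ : ∀ {d} → Untouched d → Untouched (φ d)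
  untouched-φ un w aw s = un w aw (~-trans ~-φ s)

  source≢a : ∀ {d} → IsDart d → Untouched d → proj₁ d ≢ a
  source≢a {s , x} sx un refl = un x sx ~-refl

  target≢a : ∀ {d} → IsDart d → Untouched d → proj₂ d ≢ a
  target≢a {s , x} sx un = source≢a (φ-dart {s , x} sx) (untouched-φ un)

  -- A face that misses a contains no dart into a, so nothing is skipped along it.
  φᴴ : ∀ d → IsDart (ιᵈ d) → Untouched (ιᵈ d) → ιᵈ (Fᴴ.φ d) ≡ φ (ιᵈ d)
  φᴴ (i , j) ij un = cong (ι j ,_) (trans (cong (λ z → ι (pull i z)) (skip-no (rot ρ (ι j)) next≢a)) (ι-pull next≢a))
    where
    next≢a : rot ρ (ι j) (ι i) ≢ a
    next≢a = target≢a (φ-dart {ι i , ι j} ij) (untouched-φ un)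

  iterᴴ : ∀ k d → IsDart (ιᵈ d) → Untouched (ιᵈ d) → ιᵈ (iter Fᴴ.φ k d) ≡ iter φ k (ιᵈ d)
  iterᴴ zero d e un = refl
  iterᴴ (suc k) d e un = trans
    (φᴴ (iter Fᴴ.φ k d) (subst IsDart (sym ih) (iter-dart k e))
      (subst Untouched (sym ih) (λ w aw s → un w aw (~-trans (k , refl) s))))
    (cong φ ih)
    where ih = iterᴴ k d e un

  spokes : List V
  spokes = select (adj G a) (allFin _)

  ∈-spokes⁻ : ∀ {w} → w ∈ spokes → Adj G a w
  ∈-spokes⁻ w∈ = ∈-select⁻ (adj G a) (allFin _) w∈

  ∈-spokes⁺ : ∀ {w} → Adj G a w → w ∈ spokes
  ∈-spokes⁺ {w} aw = ∈-select⁺ (adj G a) (∈-allFin w) aw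

  spokes-unique : Unique spokes
  spokes-unique = select-unique (adj G a) (allFin⁺ _)

  deg≡ : deg G a ≡ length spokes
  deg≡ = count≡length-select (adj G a) (allFin _)

  touched : List (Dart (suc (suc n″)))
  touched = map (λ w → rep (a , w)) spokes

  _∈?_ : ∀ d (ds : List (Dart (suc (suc n″)))) → Dec (d ∈ ds)
  d ∈? ds = Any.any? (d ≟ᵈ_) ds

  isRest : Dart (suc n″) → Bool
  isRest d = does (ιᵈ d ∈? reps) ∧ not (does (ιᵈ d ∈? touched))

  rest : List (Dart (suc n″))
  rest = select isRest Fᴴ.pairs

  rest-unique : Unique rest
  rest-unique = select-unique isRest Fᴴ.pairs-unique

  rest⁻ : ∀ {d} → d ∈ rest → ιᵈ d ∈ reps × Untouched (ιᵈ d)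
  rest⁻ {d} d∈ with ιᵈ d ∈? reps | ιᵈ d ∈? touched
    | ∈-select⁻ isRest Fᴴ.pairs d∈
  ... | yes r | no t | _ = r , λ w aw s → t (subst (_∈ touched)
        (trans (~⇒rep≡ {a , w} {ιᵈ d} aw (~-sym {ιᵈ d} (proj₁ (∈-reps⁻ r)) s)) (∈-reps⇒rep≡ r)) (∈-map⁺ (λ w → rep (a , w)) (∈-spokes⁺ aw)))
  ... | yes _ | yes _ | ()
  ... | no _ | _ | ()

  faces≤ : faces ρ ≤ length rest + deg G a
  faces≤ = subst₂ _≤_ (sym length-reps)
    (trans (length-++ (map ιᵈ rest)) (cong₂ _+_ (length-map ιᵈ rest) (trans (length-map (λ w → rep (a , w)) spokes) (sym deg≡))))
    (unique-⊆⇒length≤ reps-unique sub)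
    where
    sub : ∀ {d} → d ∈ reps → d ∈ map ιᵈ rest ++ touched
    sub {d} d∈ with d ∈? touched
    ... | yes t = ∈-++⁺ʳ (map ιᵈ rest) t
    ... | no ¬t = ∈-++⁺ˡ (subst (_∈ map ιᵈ rest) ι≡ (∈-map⁺ ιᵈ (∈-select⁺ isRest (Fᴴ.∈-pairs e) selected)))
      where
      un : Untouched d
      un w aw s = ¬t (subst (_∈ touched)
        (trans (~⇒rep≡ {a , w} {d} aw (~-sym (proj₁ (∈-reps⁻ d∈)) s)) (∈-reps⇒rep≡ d∈)) (∈-map⁺ (λ w → rep (a , w)) (∈-spokes⁺ aw)))
      i = covered (source≢a {d} (proj₁ (∈-reps⁻ d∈)) un)
      j = covered (target≢a {d} (proj₁ (∈-reps⁻ d∈)) un)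
      e : Dart (suc n″)
      e = proj₁ i , proj₁ j
      ι≡ : ιᵈ e ≡ d
      ι≡ = cong₂ _,_ (proj₂ i) (proj₂ j)
      selected : does (ιᵈ e ∈? reps) ∧ not (does (ιᵈ e ∈? touched)) ≡ true
      selected = cong₂ (λ x y → x ∧ not y)
        (dec-true (ιᵈ e ∈? reps) (subst (_∈ reps) (sym ι≡) d∈))
        (dec-false (ιᵈ e ∈? touched) (¬t ∘ subst (_∈ touched) ι≡))

  b′ : V
  b′ = rot ρ a b

  ab′ : Adj G a b′
  ab′ = rot-adj ρ a b ab

  b′b : Adj G b′ b
  b′b = Adj-sym (chord ab (moves ab))

  ≢a : ∀ {w} → Adj G a w → w ≢ a
  ≢a aw e = Adj⇒≢ aw (sym e)

  -- The side opposite a in the triangle a b b′. Its old face passes through a, so in `H` it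
  -- represents the merged face and cannot lie on a surviving one.
  new : Dart (suc n″)
  new = proj₁ (covered (≢a ab′)) , proj₁ (covered (≢a ab))

  ι-new : ιᵈ new ≡ (b′ , b)
  ι-new = cong₂ _,_ (proj₂ (covered (≢a ab′))) (proj₂ (covered (≢a ab)))

  new-dart : IsDart (ιᵈ new)
  new-dart = subst IsDart (sym ι-new) b′b

  faces-H≥ : suc (length rest) ≤ faces ρᴴ
  faces-H≥ = Fᴴ.length≤faces {new ∷ rest}
    (new-dart ∷ All.tabulate λ d∈ → proj₁ (∈-reps⁻ (proj₁ (rest⁻ d∈))))
    (All.tabulate new-rest ∷ distinct rest-unique (All.tabulate rest⁻))
    where
    touches : (b′ , b) ~ (a , b′)
    touches = ~-sym {a , b′} ab′ (1 , cong (b′ ,_)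
      (Jordan.triangle G connected ρ planar chord ab refl (moves ab)))

    new-rest : ∀ {d} → d ∈ rest → ¬ new Fᴴ.~ d
    new-rest {d} d∈ s with rest⁻ d∈ | Fᴴ.~-sym {new} new-dart s
    ... | r , un | k , e = un b′ ab′ (~-trans
      (k , trans (sym (iterᴴ k d (proj₁ (∈-reps⁻ r)) un)) (trans (cong ιᵈ e) ι-new)) touches)

    distinct : ∀ {ds} → Unique ds → All (λ d → ιᵈ d ∈ reps × Untouched (ιᵈ d)) ds →
      AllPairs (λ d e → ¬ d Fᴴ.~ e) ds
    distinct [] [] = []
    distinct (ne ∷ us) ((d∈ , un) ∷ ps) =
      All.zipWith (λ (d≢e , e∈ , _) s → d≢e (same d∈ un e∈ s)) (ne , ps) ∷ distinct us ps
      where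
      same : ∀ {d e} → ιᵈ d ∈ reps → Untouched (ιᵈ d) → ιᵈ e ∈ reps → d Fᴴ.~ e → d ≡ e
      same {d} d∈ un e∈ (k , eq) = ιᵈ-injective (trans (sym (∈-reps⇒rep≡ d∈))
        (trans (~⇒rep≡ r (k , trans (sym (iterᴴ k d r un)) (cong ιᵈ eq))) (∈-reps⇒rep≡ e∈)))
        where r = proj₁ (∈-reps⁻ d∈)

  degSum-H : degSum H + (deg G a + deg G a) ≤ degSum G
  degSum-H = subst₂ _≤_ lengths (sym length-darts) (unique-⊆⇒length≤ unique sub)
    where
    outs ins : List (Dart (suc (suc n″)))
    outs = map (a ,_) spokes
    ins = map (_, a) spokes

    lengths : length (map ιᵈ Fᴴ.darts ++ (outs ++ ins)) ≡ degSum H + (deg G a + deg G a)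
    lengths = trans (length-++ (map ιᵈ Fᴴ.darts)) (cong₂ _+_ (trans (length-map ιᵈ Fᴴ.darts) (sym Fᴴ.length-darts))
      (trans (length-++ outs) (cong₂ _+_ (trans (length-map (a ,_) spokes) (sym deg≡))
                                         (trans (length-map (_, a) spokes) (sym deg≡)))))

    unique : Unique (map ιᵈ Fᴴ.darts ++ (outs ++ ins))
    unique = ++⁺ (map⁺ ιᵈ-injective Fᴴ.darts-unique)
      (++⁺ (map⁺ ,-injectiveʳ spokes-unique) (map⁺ ,-injectiveˡ spokes-unique) outs-ins) old-new
      where
      outs-ins : ∀ {d} → ¬ (d ∈ outs × d ∈ ins)
      outs-ins (o , i) with ∈-map⁻ (a ,_) o | ∈-map⁻ (_, a) i
      ... | w , w∈ , refl | w′ , w′∈ , eq = ≢a (∈-spokes⁻ w′∈) (sym (,-injectiveˡ eq))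
      old-new : ∀ {d} → ¬ (d ∈ map ιᵈ Fᴴ.darts × d ∈ outs ++ ins)
      old-new (o , n) with ∈-map⁻ ιᵈ o | ∈-++⁻ outs n
      ... | e , _ , refl | inj₁ x with ∈-map⁻ (a ,_) x
      ...   | _ , _ , eq = ι≢a (proj₁ e) (,-injectiveˡ eq)
      old-new (o , n) | e , _ , refl | inj₂ x with ∈-map⁻ (_, a) x
      ...   | _ , _ , eq = ι≢a (proj₂ e) (,-injectiveʳ eq)

    sub : ∀ {d} → d ∈ map ιᵈ Fᴴ.darts ++ (outs ++ ins) → d ∈ darts
    sub d∈ with ∈-++⁻ (map ιᵈ Fᴴ.darts) d∈
    ... | inj₁ o with ∈-map⁻ ιᵈ o
    ...   | e , e∈ , refl = ∈-darts⁺ (Fᴴ.∈-darts⁻ e∈)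
    sub d∈ | inj₂ n with ∈-++⁻ outs n
    ...   | inj₁ x with ∈-map⁻ (a ,_) x
    ...     | w , w∈ , refl = ∈-darts⁺ (∈-spokes⁻ w∈)
    sub d∈ | inj₂ n | inj₂ x with ∈-map⁻ (_, a) x
    ...     | w , w∈ , refl = ∈-darts⁺ (Adj-sym (∈-spokes⁻ w∈))

  Avoiding : V → V → Set
  Avoiding x y = Adj G x y × y ≢ a

  -- Consecutive neighbours of a are adjacent, so a walk through a can be detoured along them; this
  -- keeps `H` connected.
  link : ∀ {x y} → Adj G a x → Adj G a y → Star Avoiding x y
  link {x} {y} ax ay with rot-cyc ρ a x y ax ay
  ... | k , refl = go k
    where
    go : ∀ k → Star Avoiding x (iter (rot ρ a) k x)
    go zero = ε
    go (suc k) = go k ◅◅ ((chord aₖ (moves aₖ) , ≢a (rot-adj ρ a _ aₖ)) ◅ ε)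
      where aₖ = Rotations.iter-adj G ρ k ax

  avoid : ∀ {x y} → Walk G x y → x ≢ a → y ≢ a → Star Avoiding x y
  avoid here x≢a y≢a = ε
  avoid (step {w = w} xw W) x≢a y≢a with w ≟ a
  avoid (step xw W) x≢a y≢a | no w≢a = (xw , w≢a) ◅ avoid W w≢a y≢a
  avoid (step xw here) x≢a y≢a | yes refl = ⊥-elim (y≢a refl)
  avoid (step xw (step aw W)) x≢a y≢a | yes refl = link (Adj-sym xw) aw ◅◅ avoid W (≢a aw) y≢a

  connected-H : Connected H
  connected-H i j = go i refl (avoid (connected (ι i) (ι j)) (ι≢a i) (ι≢a j)) refl
    where
    go : ∀ i {x y} → ι i ≡ x → Star Avoiding x y → ι j ≡ y → Walk H i j
    go i e ε e′ = subst (Walk H i) (ι-injective (trans e (sym e′))) here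
    go i refl ((xw , w≢a) ◅ W) e′ with covered w≢a
    ... | k , refl = step xw (go k refl W e′)

  planar-H : PlanarRot ρᴴ
  planar-H = ≤-antisym (Cohomology.euler-≤ H ρᴴ connected-H {new} new-dart)
    (+-cancelʳ-≤ (deg G a + deg G a) _ _ (begin
      degSum H + 4 + (deg G a + deg G a)   ≡⟨ arith₁ (degSum H) (deg G a) ⟩
      degSum H + (deg G a + deg G a) + 4   ≤⟨ +-monoˡ-≤ 4 degSum-H ⟩
      degSum G + 4                         ≡⟨ sym planar ⟩
      2 * suc (suc n″) + 2 * faces ρ       ≤⟨ +-monoʳ-≤ (2 * suc (suc n″)) (*-monoʳ-≤ 2 faces≤) ⟩
      2 * suc (suc n″) + 2 * (length rest + deg G a) ≡⟨ arith₂ n″ (length rest) (deg G a) ⟩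
      2 * suc n″ + 2 * suc (length rest) + (deg G a + deg G a)
        ≤⟨ +-monoˡ-≤ (deg G a + deg G a) (+-monoʳ-≤ (2 * suc n″) (*-monoʳ-≤ 2 faces-H≥)) ⟩
      2 * suc n″ + 2 * faces ρᴴ + (deg G a + deg G a) ∎))
    where
    open ≤-Reasoning
    open +-*-Solver
    arith₁ : ∀ s d → s + 4 + (d + d) ≡ s + (d + d) + 4
    arith₁ = solve 2 (λ s d → s :+ con 4 :+ (d :+ d) := s :+ (d :+ d) :+ con 4) refl
    arith₂ : ∀ n l d → 2 * suc (suc n) + 2 * (l + d) ≡ 2 * suc n + 2 * suc l + (d + d)
    arith₂ = solve 3 (λ n l d → con 2 :* (con 2 :+ n) :+ con 2 :* (l :+ d)
      := con 2 :* (con 1 :+ n) :+ con 2 :* (con 1 :+ l) :+ (d :+ d)) refl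

  -- If `H` were not 4-colourable it would belong to `N4` with one vertex fewer. Only
  -- non-colourability is refuted, whence the double negation.
  minimal⇒deletion-colorable : eMPGN4 G →
    ¬ ¬ ∃ λ (f : V → Fin 4) → ∀ {u v} → Adj G u v → u ≢ a → v ≢ a → f u ≢ f v
  minimal⇒deletion-colorable (_ , _ , minimal) k =
    <-irrefl refl (minimal (suc n″) H (connected-H , inj₂ (ρᴴ , planar-H) , k ∘ extend))
    where
    extend : Colorable H 4 → ∃ λ (f : V → Fin 4) → ∀ {u v} → Adj G u v → u ≢ a → v ≢ a → f u ≢ f v
    extend (g , g-proper) = g ∘ pull zero , λ {u} {v} uv u≢a v≢a →
      g-proper (pull zero u) (pull zero v) (subst₂ (Adj G) (sym (ι-pull u≢a)) (sym (ι-pull v≢a)) uv)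

-- Noncrossing paths around a disc

occurs : ∀ {n} → List (Fin n) → Fin n → Bool
occurs L w = ⨁ (λ l → does (w ≟ l)) L

Chain : ∀ {n} → (Fin n → Fin n) → Fin n → List (Fin n) → Fin n → Set
Chain σ x []      y = σ x ≡ y
Chain σ x (l ∷ L) y = σ x ≡ l × Chain σ l L y

module _ {n} {G : Graph n} (ρ : Rotation G) where

  open Faces G ρ
  open Rotations G ρ

  -- Summing membership along a run telescopes to the derivative that characterises `between`.
  chain-jump : ∀ {v x y} L → Adj G v x → Chain (rot ρ v) x L y → ∀ {u} → Adj G v u →
    occurs L u xor occurs L (rot ρ v u) ≡ does (u ≟ x) xor does (rot ρ v u ≟ y)
  chain-jump {v} {x} [] vx refl {u} vu = sym (trans
    (cong (_xor does (rot ρ v u ≟ rot ρ v x)) (does-⇔ (u ≟ x) (rot ρ v u ≟ rot ρ v x)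
      (cong (rot ρ v)) (rot-inj ρ v u x vu vx))) (xor-same (does (rot ρ v u ≟ rot ρ v x))))
  chain-jump {v} {x} {y} (l ∷ L) vx (refl , c) {u} vu = trans
    (interchange (does (u ≟ l)) (occurs L u) (does (rot ρ v u ≟ l)) _)
    (trans (cong ((does (u ≟ l) xor does (rot ρ v u ≟ l)) xor_) (chain-jump L (rot-adj ρ v x vx) c vu))
    (trans (cong (λ b → (does (u ≟ l) xor b) xor (does (u ≟ l) xor does (rot ρ v u ≟ y)))
        (does-⇔ (rot ρ v u ≟ rot ρ v x) (u ≟ x) (rot-inj ρ v u x vu vx) (cong (rot ρ v))))
      (lemma (does (u ≟ l)) (does (u ≟ x)) _)))
    where
    open import Data.Bool.Solver using (module xor-∧-Solver)
    open xor-∧-Solver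
    lemma : ∀ a b c → (a xor b) xor (a xor c) ≡ b xor c
    lemma = solve 3 (λ a b c → (a :+ b) :+ (a :+ c) := b :+ c) refl

  chain-between : ∀ {v x y} L (vx : Adj G v x) (vy : Adj G v y) → Chain (rot ρ v) x L y →
    occurs L x ≡ false → ∀ {w} → Adj G v w → between vx vy w ≡ occurs L w
  chain-between L vx vy c x∉L = between-unique vx vy (occurs L) x∉L (chain-jump L vx c)

-- A set of inside vertices surrounded by r 0, r 1, …, r (N ∸ 1), where r t sees the inside along
-- the run L t of its rotation; the spoke at t is one of its inside neighbours.
record Surrounded {n} {G : Graph n} (ρ : Rotation G) (Inside : Fin n → Set) (N : ℕ)
  (r : ℕ → Fin n) (L : ℕ → List (Fin n)) (spoke : ℕ → Fin n) : Set where
  field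
    r-outside     : ∀ {t} → t < N → ¬ Inside (r t)
    ring          : ∀ {t} → suc t < N → Adj G (r t) (r (suc t))
    runs          : ∀ {t} → suc (suc t) < N → Chain (rot ρ (r (suc t))) (r (suc (suc t))) (L (suc t)) (r t)
    run-inside    : ∀ {t w} → suc t < N → ¬ Inside w → occurs (L t) w ≡ false
    spoke-adj     : ∀ {t} → t < N → Adj G (r t) (spoke t)
    spoke-inside  : ∀ {t} → t < N → Inside (spoke t)
    spoke-run     : ∀ {t} → suc (suc t) < N → occurs (L (suc t)) (spoke (suc t)) ≡ true
    -- Two positions may carry the same vertex; their spokes must then still tell them apart.
    spoke-unique  : ∀ {s t} → suc (suc s) < N → t < N → suc s ≢ t → r (suc s) ≡ r t →
                    occurs (L (suc s)) (spoke t) ≡ false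
    inside-linked : ∀ {s t} → s < N → t < N → Star (λ x y → Adj G x y × Inside y) (spoke s) (spoke t)

module Noncrossing {n′} {G : Graph (suc n′)} (connected : Connected G)
  {ρ : Rotation G} (planar : PlanarRot ρ)
  {Inside : Fin (suc n′) → Set} {N r L spoke} (S : Surrounded ρ Inside N r L spoke) where

  open Faces G ρ
  open Rotations G ρ
  open Surrounded S

  module _ (OnP : Fin (suc n′) → Set) (OnP⇒outside : ∀ {v} → OnP v → ¬ Inside v) where

    OnP-Star : Fin (suc n′) → Fin (suc n′) → Set
    OnP-Star = Star (λ u v → Adj G u v × OnP v)

    forget : ∀ {u v} → OnP-Star u v → Star (Adj G) u v
    forget = gmap id proj₁

    side-path : ∀ {a b z c v w} (ab : Adj G a b) (P : OnP-Star b z) (zc : Adj G z c) →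
      OnP b → ¬ OnP v → side ab (forget P) zc (v , w) ≡ false
    side-path {b = b} {v = v} ab ε zc pb ¬pv =
      cong (_∧ _) (dec-false (b ≟ v) λ { refl → ¬pv pb })
    side-path {b = b} {v = v} ab ((bb′ , pb′) ◅ P) zc pb ¬pv =
      cong₂ _xor_ (cong (_∧ _) (dec-false (b ≟ v) λ { refl → ¬pv pb })) (side-path bb′ P zc pb′ ¬pv)

    module _ {i} {k z} (P : OnP-Star (r i) k) (pᵢ : OnP (r i)) (kz : Adj G k z) where

      down : ∀ m → m + i < N → Star (Adj G) (r (m + i)) (r i)
      down zero    lt = ε
      down (suc m) lt = Adj-sym (ring lt) ◅ down m (<-trans (n<1+n _) lt)

      -- The side function, away from P, of the closed walk down the ring from k to i and back along
      -- P. The walk is pushed off towards the inside, so a position strictly between i and k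
      -- contributes its inside run.
      runSum : ℕ → Fin (suc n′) → Fin (suc n′) → Bool
      runSum zero    v w = false
      runSum (suc m) v w = (does (r (suc m + i) ≟ v) ∧ occurs (L (suc m + i)) w) xor runSum m v w

      side-down : ∀ m {v w} → (lt : suc (m + i) < N) → Adj G v w → ¬ OnP v →
        side (Adj-sym (ring lt)) (down m (<-trans (n<1+n _) lt) ◅◅ forget P) kz (v , w) ≡ runSum m v w
      side-down zero lt vw ¬pv = side-path (Adj-sym (ring lt)) P kz pᵢ ¬pv
      side-down (suc m) {v} {w} lt vw ¬pv = cong₂ _xor_ (at (r (suc m + i) ≟ v))
        (side-down m (<-trans (n<1+n _) lt) vw ¬pv)
        where
        ab = Adj-sym (ring lt)
        bb′ = Adj-sym (ring (<-trans (n<1+n _) lt))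
        at : (q : Dec (r (suc m + i) ≡ v)) →
          does q ∧ between (Adj-sym ab) bb′ w ≡ does q ∧ occurs (L (suc m + i)) w
        at (no _) = refl
        at (yes refl) = chain-between ρ (L (suc m + i)) (Adj-sym ab) bb′ (runs lt)
          (run-inside lt (r-outside lt)) vw

      runSum-outside : ∀ m {v w} → suc (m + i) < N → ¬ Inside w → runSum m v w ≡ false
      runSum-outside zero lt out = refl
      runSum-outside (suc m) {v} lt out = cong₂ _xor_
        (trans (cong (does (r (suc m + i) ≟ v) ∧_) (run-inside lt out)) (∧-zeroʳ (does (r (suc m + i) ≟ v))))
        (runSum-outside m (<-trans (n<1+n _) lt) out)

      runSum-inside : ∀ m {v w} → suc (m + i) < N → Inside v → runSum m v w ≡ false
      runSum-inside zero lt ins = refl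
      runSum-inside (suc m) {v} lt ins = cong₂ _xor_
        (cong (_∧ _) (dec-false (r (suc m + i) ≟ v) λ { refl → r-outside (<-trans (n<1+n _) lt) ins }))
        (runSum-inside m (<-trans (n<1+n _) lt) ins)

      runSum-≢ : ∀ m {t} → suc (m + i) < N → t < N → m + i < t → runSum m (r t) (spoke t) ≡ false
      runSum-≢ zero lt t<N m<t = refl
      runSum-≢ (suc m) {t} lt t<N m<t = cong₂ _xor_ (at (r (suc m + i) ≟ r t))
        (runSum-≢ m (<-trans (n<1+n _) lt) t<N (<-trans (n<1+n _) m<t))
        where
        at : (q : Dec (r (suc m + i) ≡ r t)) → does q ∧ occurs (L (suc m + i)) (spoke t) ≡ false
        at (no _) = refl
        at (yes e) = spoke-unique lt t<N (<⇒≢ m<t) e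

      runSum-≡ : ∀ m {t} → suc (m + i) < N → i < t → t ≤ m + i → runSum m (r t) (spoke t) ≡ true
      runSum-≡ zero lt i<t t≤i = ⊥-elim (<-irrefl refl (≤-trans i<t t≤i))
      runSum-≡ (suc m) {t} lt i<t t≤ with suc (m + i) ℕ.≟ t
      ... | yes refl = cong₂ _xor_
            (cong₂ _∧_ (dec-true (r (suc m + i) ≟ r (suc m + i)) refl) (spoke-run lt))
            (runSum-≢ m (<-trans (n<1+n _) lt) (<-trans (n<1+n _) lt) ≤-refl)
      ... | no ne = cong₂ _xor_ (at (r (suc m + i) ≟ r t))
            (runSum-≡ m (<-trans (n<1+n _) lt) i<t (≤-pred (≤∧≢⇒< t≤ (ne ∘ sym))))
        where
        at : (q : Dec (r (suc m + i) ≡ r t)) → does q ∧ occurs (L (suc m + i)) (spoke t) ≡ false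
        at (no _) = refl
        at (yes e) = spoke-unique lt (≤-trans (s≤s t≤) (<-trans (n<1+n _) lt)) ne e

  module _ (OnP OnQ : Fin (suc n′) → Set)
    (P-outside : ∀ {v} → OnP v → ¬ Inside v) (Q-outside : ∀ {v} → OnQ v → ¬ Inside v)
    (disjoint : ∀ {v} → OnP v → OnQ v → ⊥)
    {i j m l} (i<j : i < j) (j<k : j < suc (m + i)) (k<l : suc (m + i) < l) (l<N : l < N)
    (pᵢ : OnP (r i)) (P : Star (λ u v → Adj G u v × OnP v) (r i) (r (suc (m + i))))
    (qⱼ : OnQ (r j)) (Q : Star (λ u v → Adj G u v × OnQ v) (r j) (r l)) where

    k<N : suc (m + i) < N
    k<N = <-trans k<l l<N
    j<N = <-trans j<k k<N
    kb = Adj-sym (ring k<N)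
    W = down OnP P-outside P pᵢ kb m (<-trans (n<1+n _) k<N) ◅◅ forget OnP P-outside P
    D₁ = gmap id proj₁ Q
    D₂ = gmap id proj₁ (inside-linked l<N j<N)
    D = D₁ ◅◅ (spoke-adj l<N ◅ D₂ ◅◅ (Adj-sym (spoke-adj j<N) ◅ ε))
    R = runSum OnP P-outside P pᵢ kb m

    side≡R : ∀ {v w} → Adj G v w → ¬ OnP v → side kb W kb (v , w) ≡ R v w
    side≡R = side-down OnP P-outside P pᵢ kb m k<N

    side-in : ∀ {v w} → Adj G v w → Inside v → side kb W kb (v , w) ≡ false
    side-in vw ins = trans (side≡R vw (λ p → P-outside p ins)) (runSum-inside OnP P-outside P pᵢ kb m k<N ins)

    -- Q may pass through ring vertices of W: because W is pushed off to the inside, a step between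
    -- outside vertices does not cross it.
    side-out : ∀ {v w} → Adj G v w → OnQ v → ¬ Inside w → side kb W kb (v , w) ≡ false
    side-out vw q out = trans (side≡R vw (λ p → disjoint p q)) (runSum-outside OnP P-outside P pᵢ kb m k<N out)

    sum-◅◅ : ∀ {R : Fin (suc n′) → Fin (suc n′) → Set} p {x y z} (W : Star R x y) (W′ : Star R y z) →
      path-sum p (W ◅◅ W′) ≡ path-sum p W xor path-sum p W′
    sum-◅◅ p ε W′ = refl
    sum-◅◅ p (_◅_ {x} {y} a W) W′ = trans (cong (p (x , y) xor_) (sum-◅◅ p W W′))
      (sym (xor-assoc (p (x , y)) (path-sum p W) (path-sum p W′)))

    sum-Q : ∀ {x y} (Q : Star (λ u v → Adj G u v × OnQ v) x y) → OnQ x →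
      path-sum (crossing kb W) (gmap {U = Adj G} id proj₁ Q) ≡ false
    sum-Q ε qx = refl
    sum-Q ((xy , qy) ◅ Q) qx = cong₂ _xor_
      (cong₂ _xor_ (side-out xy qx (Q-outside qy)) (side-out (Adj-sym xy) qy (Q-outside qx))) (sum-Q Q qy)

    Q-end : ∀ {x y} → OnQ x → Star (λ u v → Adj G u v × OnQ v) x y → OnQ y
    Q-end q ε = q
    Q-end q ((_ , q′) ◅ Q) = Q-end q′ Q

    sum-inside : ∀ {x y} (E : Star (λ u v → Adj G u v × Inside v) x y) → Inside x →
      path-sum (crossing kb W) (gmap {U = Adj G} id proj₁ E) ≡ false
    sum-inside ε ins = refl
    sum-inside ((xy , ins′) ◅ E) ins = cong₂ _xor_
      (cong₂ _xor_ (side-in xy ins) (side-in (Adj-sym xy) ins′)) (sum-inside E ins′)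

    -- Only the spoke at j crosses: j lies strictly between i and k, l lies beyond k, and the
    -- remaining steps of D stay outside along Q or inside the disc.
    odd : path-sum (crossing kb W) D ≡ true
    odd = trans (sum-◅◅ _ D₁ _) (cong₂ _xor_ (sum-Q Q qⱼ) (cong₂ _xor_
      (cong₂ _xor_
        (trans (side≡R (spoke-adj l<N) (λ p → disjoint p (Q-end qⱼ Q)))
          (runSum-≢ OnP P-outside P pᵢ kb m k<N l<N (<-trans (n<1+n _) k<l)))
        (side-in (Adj-sym (spoke-adj l<N)) (spoke-inside l<N)))
      (trans (sum-◅◅ _ D₂ _) (cong₂ _xor_ (sum-inside (inside-linked l<N j<N) (spoke-inside l<N))
        (cong₂ _xor_ (cong₂ _xor_
          (side-in (Adj-sym (spoke-adj j<N)) (spoke-inside j<N))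
          (trans (side≡R (spoke-adj j<N) (λ p → disjoint p qⱼ))
            (runSum-≡ OnP P-outside P pᵢ kb m k<N i<j (≤-pred j<k))))
          (refl {x = false}))))))

    noncrossing′ : ⊥
    noncrossing′ with trans (sym (Jordan.closed-walks-cross-evenly G connected ρ planar kb W D)) odd
    ... | ()

  -- Disjoint outside paths from r i to r k and from r j to r l, closed up along the ring and
  -- through the inside, would cross exactly once.
  noncrossing : ∀ (OnP OnQ : Fin (suc n′) → Set) →
    (∀ {v} → OnP v → ¬ Inside v) → (∀ {v} → OnQ v → ¬ Inside v) → (∀ {v} → OnP v → OnQ v → ⊥) →
    ∀ {i j k l} → i < j → j < k → k < l → l < N →
    OnP (r i) → Star (λ u v → Adj G u v × OnP v) (r i) (r k) →
    OnQ (r j) → Star (λ u v → Adj G u v × OnQ v) (r j) (r l) → ⊥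
  noncrossing OnP OnQ po qo dis {i} {j} {suc k} {l} i<j j<k k<l l<N pᵢ P qⱼ Q
    with k ∸ i | m∸n+n≡m {k} {i} (≤-trans (<⇒≤ i<j) (≤-pred j<k))
  ... | m | refl = noncrossing′ OnP OnQ po qo dis {m = m} i<j j<k k<l l<N pᵢ P qⱼ Q

-- Checking reducibility

-- The colours are 𝔽₂ × 𝔽₂, so that the three pairings of four colours are the three nonzero
-- translations.
Color : Set
Color = Bool × Bool

pattern c₀ = false , false

-- An axis pairs the four colours: flip exchanges partners, class tells the pairs apart.
data Axis : Set where
  α β γ : Axis

flip : Axis → Color → Color
flip α (x , y) = not x , y
flip β (x , y) = x , not y
flip γ (x , y) = not x , not y

class : Axis → Color → Bool
class α (x , y) = y
class β (x , y) = x
class γ (x , y) = x xor y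

infix 4 _==_ _==ᶜ_
_==_ : Bool → Bool → Bool
a == b = not (a xor b)

_==ᶜ_ : Color → Color → Bool
(x , y) ==ᶜ (x′ , y′) = (x == x′) ∧ (y == y′)

at : ∀ {A : Set} → A → List A → ℕ → A
at d []       _       = d
at d (x ∷ xs) zero    = x
at d (x ∷ xs) (suc i) = at d xs i

tab : ∀ {A : Set} → ℕ → (ℕ → A) → List A
tab zero    h = []
tab (suc n) h = h 0 ∷ tab n (h ∘ suc)

allBelow anyBelow : ℕ → (ℕ → Bool) → Bool
allBelow zero    p = true
allBelow (suc n) p = allBelow n p ∧ p n
anyBelow zero    p = false
anyBelow (suc n) p = anyBelow n p ∨ p n

-- A neighbour of an interior vertex: the i-th interior vertex or the t-th ring vertex.
data Site : Set where
  inner outer : ℕ → Site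

record Configuration : Set where
  field
    ringSize interiorSize : ℕ
    neighbours : List (List Site)
    levels     : List ℕ

module Check (Γ : Configuration) where

  open Configuration Γ

  siteColor : List Color → List Color → Site → Color
  siteColor χ φ (inner j) = at c₀ χ j
  siteColor χ φ (outer t) = at c₀ φ t

  inBounds : Site → Bool
  inBounds (inner j) = j <ᵇ interiorSize
  inBounds (outer t) = t <ᵇ ringSize

  valid : List Color → List Color → Bool
  valid φ χ = allBelow interiorSize λ i →
    all (λ s → inBounds s ∧ not (siteColor χ φ s ==ᶜ at c₀ χ i)) (at [] neighbours i)

  -- Backtracking in the order of the interior vertices. Nothing is proved about it, since `extends`
  -- checks its result again with `valid`.
  search : List Color → List (List Site) → List Color → Maybe (List Color)
  search φ []       χ = just χ
  search φ (S ∷ Ss) χ = try c₀ <∣> try (false , true) <∣> try (true , false) <∣> try (true , true)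
    where
    clash : Color → Site → Bool
    clash c (inner j) = (j <ᵇ length χ) ∧ (at c₀ χ j ==ᶜ c)
    clash c (outer t) = at c₀ φ t ==ᶜ c

    try : Color → Maybe (List Color)
    try c = if any (clash c) S then nothing else search φ Ss (χ ++ c ∷ [])

  extends : List Color → Bool
  extends φ = maybe′ (valid φ) false (search φ neighbours [])

  -- The differences of consecutive ring colours, divided by the first of them in 𝔽₄, are
  -- powers of a generator; their exponents form the base 3 index of a colouring in the table.
  difference : Color → Color → ℕ
  difference (x , y) (x′ , y′) = if y == y′ then 0 else if x == x′ then 1 else 2

  index : List Color → ℕ
  index []           = 0
  index (_ ∷ [])     = 0
  index (c ∷ c′ ∷ φ) = go c′ φ
    where
    e = difference c c′
    go : Color → List Color → ℕ
    go c []       = 0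
    go c (c′ ∷ φ) = (difference c c′ + (3 ∸ e)) % 3 + 3 * go c′ φ

  -- Each numeral of the table packs 81 one-digit levels, lowest index in the last digit: 3 numerals
  -- serve the 3 ^ 5 indices of a ring of seven, 9 the 3 ^ 6 of a ring of eight. The index forgets
  -- translations and scalings of 𝔽₄ and the closing difference, which the others determine.
  level : List Color → ℕ
  level φ = _/_ (at 0 levels (index φ / 81)) (10 ^ (index φ % 81)) {{m^n≢0 10 (index φ % 81)}} % 10

  -- The table is not trusted: check verifies that level 0 colourings extend and that every other
  -- one can be improved, whatever the chains are.  A chain structure is recorded by labelling each
  -- ring position with the least position of its chain; explore runs through all noncrossing ones.
  module Explore (a : Axis) (φ : List Color) where

    type : ℕ → Bool
    type t = class a (at c₀ φ t)

    joined : ℕ → Bool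
    joined zero    = false
    joined (suc t) = type t == type (suc t)

    -- A position with the class of its predecessor continues that chain. Otherwise it opens a chain
    -- or joins an earlier one rooted at s, and then no q after s may belong to a chain reaching
    -- back before s, as it would cross the link from s to t.
    allowed : (ℕ → ℕ) → ℕ → ℕ → Bool
    allowed lab t s =
      if joined t then s ≡ᵇ lab (t ∸ 1)
      else ((s ≡ᵇ t) ∨ ((lab s ≡ᵇ s) ∧ ((type s == type t) ∧ allBelow t (λ q → (q ≤ᵇ s) ∨ (s ≤ᵇ lab q)))))

    update : (ℕ → ℕ) → ℕ → ℕ → ℕ → ℕ
    update lab t s q = if q ≡ᵇ t then s else lab q

    -- The chain of position i, or its complement if that chain contains position 0: the colour of
    -- position 0 stays the same.
    block : (ℕ → ℕ) → ℕ → ℕ → Bool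
    block lab i j = (lab j ≡ᵇ lab i) xor (lab 0 ≡ᵇ lab i)

    swapBlock : (ℕ → ℕ) → ℕ → List Color
    swapBlock lab i = tab ringSize λ j → if block lab i j then flip a (at c₀ φ j) else at c₀ φ j

    improvable : (ℕ → ℕ) → Bool
    improvable lab = anyBelow ringSize λ i → level (swapBlock lab i) <ᵇ level φ

    explore : ℕ → ℕ → (ℕ → ℕ) → Bool
    explore zero    t lab = improvable lab
    explore (suc k) t lab =
      allBelow (suc t) λ s → not (allowed lab t s) ∨ explore k (suc t) (update lab t s)

  open Explore public

  check : List Color → Bool
  check φ = if level φ ≡ᵇ 0 then extends φ
    else explore α φ ringSize 0 id ∨ (explore β φ ringSize 0 id ∨ explore γ φ ringSize 0 id)

  -- The argument p is the previous colour; passing the test as a continuation avoids building the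
  -- list of all colourings.
  allFrom : Color → ℕ → (List Color → Bool) → Bool
  allFrom p zero    P = P []
  allFrom p (suc m) P = go c₀ ∧ (go (false , true) ∧ (go (true , false) ∧ go (true , true)))
    where
    go : Color → Bool
    go c = (c ==ᶜ p) ∨ allFrom c m (P ∘ (c ∷_))

  -- Position 0 has colour `c₀`, a normalisation that `no-trace` obtains by translation. The left
  -- disjunct discards the colourings that clash where the ring closes.
  reducible : Bool
  reducible = allFrom c₀ (ringSize ∸ 1) λ ψ →
    (at c₀ (c₀ ∷ ψ) (ringSize ∸ 1) ==ᶜ c₀) ∨ check (c₀ ∷ ψ)

-- The interior is a, b, v₁, v₂, v₄, v₅, c.  The ring is d, u₁, u₂, u₃, u₄, u₅, u₆ if c has degree 6;
-- in degree 7 the seventh neighbour of c comes between u₃ and u₄.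
dumbbell₆ : Configuration
dumbbell₆ = record
  { ringSize = 7
  ; interiorSize = 7
  ; neighbours =
        (inner 1 ∷ outer 0 ∷ inner 2 ∷ inner 3 ∷ inner 6 ∷ [])
    ∷ (inner 0 ∷ inner 6 ∷ inner 4 ∷ inner 5 ∷ outer 0 ∷ [])
    ∷ (inner 0 ∷ outer 0 ∷ outer 1 ∷ outer 2 ∷ inner 3 ∷ [])
    ∷ (inner 0 ∷ inner 2 ∷ outer 2 ∷ outer 3 ∷ inner 6 ∷ [])
    ∷ (inner 1 ∷ inner 6 ∷ outer 4 ∷ outer 5 ∷ inner 5 ∷ [])
    ∷ (inner 1 ∷ inner 4 ∷ outer 5 ∷ outer 6 ∷ outer 0 ∷ [])
    ∷ (outer 4 ∷ inner 4 ∷ inner 1 ∷ inner 0 ∷ inner 3 ∷ outer 3 ∷ [])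
    ∷ []
  ; levels =
    ( 12200000000002010110120002002000100020102000210110002020200000020200000001001000
    ∷ 21120001120012020000000000000100010020200000000001120000010100020001020220000002
    ∷ 20200000010000100001000210102210200210201001000000000001200200100000010000220002
    ∷ [])
  }

dumbbell₇ : Configuration
dumbbell₇ = record
  { ringSize = 8
  ; interiorSize = 7
  ; neighbours =
        (inner 1 ∷ outer 0 ∷ inner 2 ∷ inner 3 ∷ inner 6 ∷ [])
    ∷ (inner 0 ∷ inner 6 ∷ inner 4 ∷ inner 5 ∷ outer 0 ∷ [])
    ∷ (inner 0 ∷ outer 0 ∷ outer 1 ∷ outer 2 ∷ inner 3 ∷ [])
    ∷ (inner 0 ∷ inner 2 ∷ outer 2 ∷ outer 3 ∷ inner 6 ∷ [])
    ∷ (inner 1 ∷ inner 6 ∷ outer 5 ∷ outer 6 ∷ inner 5 ∷ [])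
    ∷ (inner 1 ∷ inner 4 ∷ outer 6 ∷ outer 7 ∷ outer 0 ∷ [])
    ∷ (outer 5 ∷ inner 4 ∷ inner 1 ∷ inner 0 ∷ inner 3 ∷ outer 3 ∷ outer 4 ∷ [])
    ∷ []
  ; levels =
    ( 1021001031001100030200000001301010201001001020300000130310101130310011001001002
    ∷ 20400000320110003020103000322230103040301000003000210041404010103011200030400000
    ∷ 31400000320232013000003120110230003040200000013200000101013020044401100040300000
    ∷ 310010230000002020004030331430003150410010004010201032103120100020110000210011
    ∷ 20002030002230031200100002101230000001000000101020130330002230310010001000000
    ∷ 22300000000002010230014032101030003040300010034430102120112020141330002020300000
    ∷ 140510100340331003100004021000320002130000100004200300200010110013302210120000101
    ∷ 30400100300011003340304012002000100030202000104320302330411002112210200030200000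
    ∷ 1000000011002320011000200002300320200000002020301010130320100330310002000001000
    ∷ [])
  }

-- Boxing hides the equation, whose normalisation is the entire computation, behind a name. The
-- computation is run by `refl` in the two abstract proofs.
record Reducible (Γ : Configuration) : Set where
  field
    reducible : Check.reducible Γ ≡ true

abstract

  dumbbell₆-reducible : Reducible dumbbell₆
  dumbbell₆-reducible = record { reducible = refl }

  dumbbell₇-reducible : Reducible dumbbell₇
  dumbbell₇-reducible = record { reducible = refl }

-- Kempe chains on the ring

T⇒≡ : ∀ {b} → T b → b ≡ true
T⇒≡ {true} _ = refl

≡⇒T : ∀ {b} → b ≡ true → T b
≡⇒T refl = _

∨-true⁻ : ∀ {a b} → a ∨ b ≡ true → a ≡ true ⊎ b ≡ true
∨-true⁻ {true} _ = inj₁ refl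
∨-true⁻ {false} e = inj₂ e

∨-trueˡ : ∀ {a b} → a ≡ true → a ∨ b ≡ true
∨-trueˡ refl = refl

∨-trueʳ : ∀ {a b} → b ≡ true → a ∨ b ≡ true
∨-trueʳ {true} _ = refl
∨-trueʳ {false} e = e

==⇒≡ : ∀ {a b} → (a == b) ≡ true → a ≡ b
==⇒≡ {true} {true} _ = refl
==⇒≡ {false} {false} _ = refl

≡⇒== : ∀ {a b} → a ≡ b → (a == b) ≡ true
≡⇒== {true} refl = refl
≡⇒== {false} refl = refl

==ᶜ⇒≡ : ∀ {c d} → (c ==ᶜ d) ≡ true → c ≡ d
==ᶜ⇒≡ {x , y} e with ∧-true⁻ {a = x == _} e
... | e₁ , e₂ = cong₂ _,_ (==⇒≡ e₁) (==⇒≡ e₂)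

≡⇒==ᶜ : ∀ {c d} → c ≡ d → (c ==ᶜ d) ≡ true
≡⇒==ᶜ {x , y} refl = cong₂ _∧_ (≡⇒== {x} refl) (≡⇒== {y} refl)

≡ᵇ-true⇒≡ : ∀ {m n} → (m ≡ᵇ n) ≡ true → m ≡ n
≡ᵇ-true⇒≡ {m} {n} e = ≡ᵇ⇒≡ m n (≡⇒T e)

≡⇒≡ᵇ-true : ∀ {m n} → m ≡ n → (m ≡ᵇ n) ≡ true
≡⇒≡ᵇ-true {m} {n} e = T⇒≡ (≡⇒≡ᵇ m n e)

≢⇒≡ᵇ-false : ∀ {m n} → m ≢ n → (m ≡ᵇ n) ≡ false
≢⇒≡ᵇ-false {m} {n} ne with m ≡ᵇ n in eq
... | true = ⊥-elim (ne (≡ᵇ-true⇒≡ eq))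
... | false = refl

allBelow⁻ : ∀ n {p} → allBelow n p ≡ true → ∀ {i} → i < n → p i ≡ true
allBelow⁻ (suc n) {p} e {i} i<1+n with ∧-true⁻ {a = allBelow n p} e
... | below , last with i ℕ.≟ n
...   | yes refl = last
...   | no i≢n = allBelow⁻ n below (≤∧≢⇒< (≤-pred i<1+n) i≢n)

allBelow⁺ : ∀ n {p} → (∀ {i} → i < n → p i ≡ true) → allBelow n p ≡ true
allBelow⁺ zero h = refl
allBelow⁺ (suc n) h = cong₂ _∧_ (allBelow⁺ n (h ∘ m≤n⇒m≤1+n)) (h ≤-refl)

anyBelow⁻ : ∀ n {p} → anyBelow n p ≡ true → ∃ λ i → i < n × p i ≡ true
anyBelow⁻ (suc n) {p} e with ∨-true⁻ {a = anyBelow n p} e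
... | inj₂ last = n , ≤-refl , last
... | inj₁ below with anyBelow⁻ n below
...   | i , i<n , pᵢ = i , m≤n⇒m≤1+n i<n , pᵢ

anyBelow⁺ : ∀ n {p i} → i < n → p i ≡ true → anyBelow n p ≡ true
anyBelow⁺ (suc n) {p} {i} i<1+n pᵢ with i ℕ.≟ n
... | yes refl = ∨-trueʳ {a = anyBelow n p} pᵢ
... | no i≢n = ∨-trueˡ (anyBelow⁺ n (≤∧≢⇒< (≤-pred i<1+n) i≢n) pᵢ)

at-tab : ∀ {A : Set} {d : A} n {h t} → t < n → at d (tab n h) t ≡ h t
at-tab (suc n) {t = zero}  _         = refl
at-tab (suc n) {t = suc t} (s≤s t<n) = at-tab n t<n

tab-cong : ∀ {A : Set} n {g h : ℕ → A} → (∀ {t} → t < n → g t ≡ h t) → tab n g ≡ tab n h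
tab-cong zero e = refl
tab-cong (suc n) e = cong₂ _∷_ (e (s≤s z≤n)) (tab-cong n (e ∘ s≤s))

least : (ℕ → Bool) → ℕ → ℕ
least p zero    = zero
least p (suc n) = if p 0 then 0 else suc (least (p ∘ suc) n)

least-true : ∀ (p : ℕ → Bool) n → p n ≡ true → p (least p n) ≡ true
least-true p zero e = e
least-true p (suc n) e with p 0 in eq
... | true = eq
... | false = least-true (p ∘ suc) n e

least-minimal : ∀ (p : ℕ → Bool) n {i} → p i ≡ true → least p n ≤ i
least-minimal p zero e = z≤n
least-minimal p (suc n) {i} e with p 0 in eq
... | true = z≤n
least-minimal p (suc n) {zero} e | false with trans (sym eq) e
... | ()
least-minimal p (suc n) {suc i} e | false = s≤s (least-minimal (p ∘ suc) n e)

flipIf : Axis → Bool → Color → Color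
flipIf a b c = if b then flip a c else c

-- The connections between ring positions by two-coloured chains, and the recolourings they allow.
record Chains (N : ℕ) (Trace : (ℕ → Color) → Set) (h : ℕ → Color) (a : Axis) : Set where
  field
    conn       : ℕ → ℕ → Bool
    conn-refl  : ∀ {i} → conn i i ≡ true
    conn-sym   : ∀ {i j} → conn i j ≡ true → conn j i ≡ true
    conn-trans : ∀ {i j k} → conn i j ≡ true → conn j k ≡ true → conn i k ≡ true
    conn-class : ∀ {i j} → i < N → j < N → conn i j ≡ true → class a (h i) ≡ class a (h j)
    conn-next  : ∀ {t} → suc t < N → class a (h t) ≡ class a (h (suc t)) → conn t (suc t) ≡ true
    conn-cross : ∀ {i j k l} → i < j → j < k → k < l → l < N →
                 conn i k ≡ true → conn j l ≡ true → conn i j ≡ true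
    recolor    : ∀ (B : ℕ → Bool) → (∀ {i j} → i < N → j < N → conn i j ≡ true → B i ≡ B j) →
                 Trace (λ t → flipIf a (B t) (h t))

-- `Trace h` stands for "h is the ring part of a proper colouring outside", and the argument knows
-- the graph only through these hypotheses. Chains under double negation suffice because every
-- conclusion drawn from them is ⊥.
module Sound (Γ : Configuration) (Trace : (ℕ → Color) → Set)
  (proper : ∀ {h} → Trace h → ∀ {t} → suc t < Configuration.ringSize Γ → h t ≢ h (suc t))
  (closing : ∀ {h} → Trace h → h (Configuration.ringSize Γ ∸ 1) ≢ h 0)
  (kempe : ∀ {h} → Trace h → ∀ a → ¬ ¬ Chains (Configuration.ringSize Γ) Trace h a) where

  open Configuration Γ
  open Check Γ

  module _ {h : ℕ → Color} {a : Axis} (chains : Chains ringSize Trace h a) where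

    open Chains chains

    φ : List Color
    φ = tab ringSize h

    root : ℕ → ℕ
    root t = least (λ s → conn s t) t

    conn-root : ∀ t → conn (root t) t ≡ true
    conn-root t = least-true (λ s → conn s t) t conn-refl

    root-minimal : ∀ {s t} → conn s t ≡ true → root t ≤ s
    root-minimal {s} {t} = least-minimal (λ s → conn s t) t

    conn⇒root≡ : ∀ {s t} → conn s t ≡ true → root s ≡ root t
    conn⇒root≡ {s} {t} c = ≤-antisym
      (root-minimal (conn-trans (conn-root t) (conn-sym c))) (root-minimal (conn-trans (conn-root s) c))

    type≡ : ∀ {t} → t < ringSize → type a φ t ≡ class a (h t)
    type≡ t<N = cong (class a) (at-tab ringSize t<N)

    -- The true labelling passes the test. A violation would give root q < s < q < t with chains
    -- from root q to q and from s to t; by `conn-cross` these are one chain, contradicting that s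
    -- is its least position.
    allowed-root : ∀ {lab t} → t < ringSize → (∀ {q} → q < t → lab q ≡ root q) →
      allowed a φ lab t (root t) ≡ true
    allowed-root {lab} {t} t<N known = cases (joined a φ t) refl
      where
      s = root t
      s≤t : s ≤ t
      s≤t = root-minimal conn-refl

      same : ∀ t → t < ringSize → (∀ {q} → q < t → lab q ≡ root q) → joined a φ t ≡ true → root t ≡ lab (t ∸ 1)
      same (suc t) t<N known j = trans (sym (conn⇒root≡ (conn-next t<N
        (trans (sym (type≡ (<-trans (n<1+n t) t<N))) (trans (==⇒≡ j) (type≡ t<N)))))) (sym (known ≤-refl))

      noCross : ∀ {q} → s < t → q < t → (q ≤ᵇ s) ∨ (s ≤ᵇ lab q) ≡ true
      noCross {q} s<t q<t with q ℕ.≤? s | s ℕ.≤? lab q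
      ... | yes q≤s | _ = ∨-trueˡ (T⇒≡ (≤⇒≤ᵇ q≤s))
      ... | no _ | yes s≤ = ∨-trueʳ {a = q ≤ᵇ s} (T⇒≡ (≤⇒≤ᵇ s≤))
      ... | no q≰s | no s≰ = ⊥-elim (s≰ (subst (s ≤_) (sym (known q<t))
            (≤-trans (≤-reflexive (sym (conn⇒root≡ (conn-root t)))) (root-minimal (conn-cross p<s (≰⇒> q≰s) q<t t<N (conn-root q) (conn-root t))))))
        where
        p<s : root q < s
        p<s = subst (_< s) (known q<t) (≰⇒> s≰)

      cases : ∀ b → joined a φ t ≡ b → (if b then s ≡ᵇ lab (t ∸ 1)
        else ((s ≡ᵇ t) ∨ ((lab s ≡ᵇ s) ∧ ((type a φ s == type a φ t) ∧ allBelow t (λ q → (q ≤ᵇ s) ∨ (s ≤ᵇ lab q)))))) ≡ true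
      cases true j = ≡⇒≡ᵇ-true (same t t<N known j)
      cases false _ with s ℕ.≟ t
      ... | yes e = ∨-trueˡ (≡⇒≡ᵇ-true e)
      ... | no s≢t = ∨-trueʳ {a = s ≡ᵇ t} (cong₂ _∧_ (≡⇒≡ᵇ-true (trans (known s<t) (conn⇒root≡ (conn-root t))))
            (cong₂ _∧_ (≡⇒== (trans (type≡ (<-trans s<t t<N)) (trans (conn-class (<-trans s<t t<N) t<N (conn-root t)) (sym (type≡ t<N)))))
              (allBelow⁺ t (noCross s<t))))
        where
        s<t : s < t
        s<t = ≤∧≢⇒< s≤t s≢t

    -- `explore` requires success for every allowed label; following the branch `root t` at each
    -- position ends at the actual chain structure.
    explore-sound : ∀ k t lab → k + t ≡ ringSize → (∀ {q} → q < t → lab q ≡ root q) →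
      explore a φ k t lab ≡ true →
      ∃ λ lab′ → (∀ {q} → q < ringSize → lab′ q ≡ root q) × improvable a φ lab′ ≡ true
    explore-sound zero t lab refl known e = lab , known , e
    explore-sound (suc k) t lab eq known e
      with ∨-true⁻ (allBelow⁻ (suc t) {λ s → not (allowed a φ lab t s) ∨ explore a φ k (suc t) (update a φ lab t s)}
             e (s≤s (root-minimal (conn-refl {t}))))
    ... | inj₁ ¬allowed with trans (sym (cong not (allowed-root {lab} t<N known))) ¬allowed
      where
      t<N : t < ringSize
      t<N = ≤-trans (m≤n+m (suc t) k) (≤-reflexive (trans (+-suc k t) eq))
    ...   | ()
    explore-sound (suc k) t lab eq known e | inj₂ deeper =
      explore-sound k (suc t) (update a φ lab t (root t)) (trans (+-suc k t) eq) known′ deeper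
      where
      known′ : ∀ {q} → q < suc t → update a φ lab t (root t) q ≡ root q
      known′ {q} q<1+t with q ℕ.≟ t
      ... | yes refl rewrite ≡⇒≡ᵇ-true {q} refl = refl
      ... | no q≢t rewrite ≢⇒≡ᵇ-false q≢t = known (≤∧≢⇒< (≤-pred q<1+t) q≢t)

    explored : 0 < ringSize → explore a φ ringSize 0 id ≡ true →
      ∃ λ h′ → Trace h′ × h′ 0 ≡ h 0 × level (tab ringSize h′) < level φ
    explored 0<N e with explore-sound ringSize 0 id (+-identityʳ ringSize) (λ ()) e
    ... | lab , known , imp with anyBelow⁻ ringSize imp
    ...   | i , i<N , lower = (λ t → flipIf a (block a φ lab i t) (h t)) ,
            recolor (block a φ lab i) respects ,
            cong (λ b → flipIf a b (h 0)) (xor-same (lab 0 ≡ᵇ lab i)) ,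
            subst (λ ψ → level ψ < level φ) (tab-cong ringSize λ {t} t<N →
                cong (flipIf a (block a φ lab i t)) (at-tab ringSize t<N))
              (<ᵇ⇒< (level (swapBlock a φ lab i)) (level φ) (≡⇒T lower))
      where
      respects : ∀ {j k} → j < ringSize → k < ringSize → conn j k ≡ true → block a φ lab i j ≡ block a φ lab i k
      respects j<N k<N c = cong (λ z → (z ≡ᵇ lab i) xor (lab 0 ≡ᵇ lab i))
        (trans (known j<N) (trans (conn⇒root≡ c) (sym (known k<N))))

  allFrom-sound : ∀ {P} m p → allFrom p m P ≡ true → ∀ h → h 0 ≢ p →
    (∀ {t} → suc t < m → h t ≢ h (suc t)) → P (tab m h) ≡ true
  allFrom-sound zero p e h _ _ = e
  allFrom-sound {P} (suc m) p e h h₀≢p steps = go steps (tail (∨-true⁻ (pick (h 0) e)))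
    where
    branch : Color → Bool
    branch c = (c ==ᶜ p) ∨ allFrom c m (P ∘ (c ∷_))
    pick : ∀ c → branch c₀ ∧ (branch (false , true) ∧ (branch (true , false) ∧ branch (true , true))) ≡ true → branch c ≡ true
    pick c e with ∧-true⁻ {a = branch c₀} e
    ... | e₀ , e′ with ∧-true⁻ {a = branch (false , true)} e′
    ...   | e₁ , e″ with ∧-true⁻ {a = branch (true , false)} e″
    pick (false , false) e | e₀ , e′ | e₁ , e″ | e₂ , e₃ = e₀
    pick (false , true)  e | e₀ , e′ | e₁ , e″ | e₂ , e₃ = e₁
    pick (true  , false) e | e₀ , e′ | e₁ , e″ | e₂ , e₃ = e₂
    pick (true  , true)  e | e₀ , e′ | e₁ , e″ | e₂ , e₃ = e₃
    tail : (h 0 ==ᶜ p) ≡ true ⊎ allFrom (h 0) m (P ∘ (h 0 ∷_)) ≡ true → allFrom (h 0) m (P ∘ (h 0 ∷_)) ≡ true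
    tail (inj₁ eq) = ⊥-elim (h₀≢p (==ᶜ⇒≡ eq))
    tail (inj₂ x) = x
    go : ∀ {m} → (∀ {t} → suc t < suc m → h t ≢ h (suc t)) →
      allFrom (h 0) m (P ∘ (h 0 ∷_)) ≡ true → P (h 0 ∷ tab m (h ∘ suc)) ≡ true
    go {zero}   steps x = x
    go {suc m′} steps x = allFrom-sound {P ∘ (h 0 ∷_)} (suc m′) (h 0) x (h ∘ suc)
      (steps (s≤s (s≤s z≤n)) ∘ sym) (steps ∘ s≤s)

  module _ (good : reducible ≡ true) (1<N : 1 < ringSize)
    (stuck : ∀ {h} → Trace h → extends (tab ringSize h) ≡ true → ⊥) where

    checked : ∀ {h} → Trace h → h 0 ≡ c₀ → check (tab ringSize h) ≡ true
    checked {h} tr h₀ = subst (λ φ → check φ ≡ true) split (strip (∨-true⁻ found))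
      where
      N′ = ringSize ∸ 1
      N≡ : suc N′ ≡ ringSize
      N≡ = m+[n∸m]≡n (<⇒≤ 1<N)
      split : c₀ ∷ tab N′ (h ∘ suc) ≡ tab ringSize h
      split = trans (cong (_∷ tab N′ (h ∘ suc)) (sym h₀)) (cong (λ n → tab n h) N≡)
      found : (at c₀ (c₀ ∷ tab N′ (h ∘ suc)) N′ ==ᶜ c₀) ∨ check (c₀ ∷ tab N′ (h ∘ suc)) ≡ true
      found = allFrom-sound N′ c₀ good (h ∘ suc)
        (λ e → proper tr 1<N (trans h₀ (sym e)))
        (λ {t} lt → proper tr (subst (suc (suc t) <_) N≡ (s≤s lt)))
      strip : _ ⊎ _ → _
      strip (inj₂ x) = x
      strip (inj₁ e) = ⊥-elim (closing tr (trans (sym (at-tab {d = c₀} ringSize (≤-reflexive N≡)))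
        (trans (cong (λ l → at c₀ l N′) (sym split)) (trans (==ᶜ⇒≡ e) (sym h₀)))))

    -- Infinite descent on levels: at level 0 the colouring would extend, and at any other the axis
    -- found by `check` yields a trace of lower level, still with `c₀` at position 0.
    descend : ∀ {h} → Trace h → h 0 ≡ c₀ → Acc _<_ (level (tab ringSize h)) → ⊥
    descend {h} tr h₀ (acc rs) = cases (level φ₀ ≡ᵇ 0) (checked tr h₀)
      where
      φ₀ = tab ringSize h
      run : ∀ a → explore a φ₀ ringSize 0 id ≡ true → ⊥
      run a e = kempe tr a λ chains →
        let (h′ , tr′ , h′₀ , lower) = explored chains (<⇒≤ 1<N) e in
        descend tr′ (trans h′₀ h₀) (rs lower)
      cases : ∀ b → (if b then extends φ₀ else explore α φ₀ ringSize 0 id ∨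
        (explore β φ₀ ringSize 0 id ∨ explore γ φ₀ ringSize 0 id)) ≡ true → ⊥
      cases true e = stuck tr e
      cases false e with ∨-true⁻ {a = explore α φ₀ ringSize 0 id} e
      ... | inj₁ x = run α x
      ... | inj₂ e′ with ∨-true⁻ {a = explore β φ₀ ringSize 0 id} e′
      ...   | inj₁ x = run β x
      ...   | inj₂ x = run γ x

    -- Translating all colours is recolouring every chain.
    no-trace : ∀ {h} → ¬ Trace h
    no-trace {h} tr = kempe tr α λ chains →
      let tr′ = Chains.recolor chains (const (proj₁ (h 0))) (λ _ _ _ → refl) in
      kempe {h₁} tr′ β λ chains′ →
        descend {h₂} (Chains.recolor chains′ (const (proj₂ (h 0))) (λ _ _ _ → refl)) (zeroed (h 0)) (<-wellFounded _)
      where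
      h₁ h₂ : ℕ → Color
      h₁ t = flipIf α (proj₁ (h 0)) (h t)
      h₂ t = flipIf β (proj₂ (h 0)) (h₁ t)
      zeroed : ∀ c → flipIf β (proj₂ c) (flipIf α (proj₁ c) c) ≡ c₀
      zeroed (false , false) = refl
      zeroed (false , true)  = refl
      zeroed (true  , false) = refl
      zeroed (true  , true)  = refl

-- Colourings outside a configuration

-- Double negation commutes with finite quantifiers, so all chain relations may be assumed decided
-- at once.
¬¬-∀Fin : ∀ {n} {P : Fin n → Set} → (∀ i → ¬ ¬ P i) → ¬ ¬ (∀ i → P i)
¬¬-∀Fin {zero}  h k = k λ ()
¬¬-∀Fin {suc n} {P} h k = h zero λ p → ¬¬-∀Fin {n} {P ∘ suc} (h ∘ suc) λ ps → k λ { zero → p ; (suc i) → ps i }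

all⁻ : ∀ {A : Set} (p : A → Bool) {x xs} → all p xs ≡ true → x ∈ xs → p x ≡ true
all⁻ p e (here refl) = proj₁ (∧-true⁻ e)
all⁻ p {xs = y ∷ ys} e (there x∈) = all⁻ p (proj₂ (∧-true⁻ {p y} e)) x∈

flip-class : ∀ a c → class a (flip a c) ≡ class a c
flip-class α c = refl
flip-class β c = refl
flip-class γ (true  , true)  = refl
flip-class γ (true  , false) = refl
flip-class γ (false , true)  = refl
flip-class γ (false , false) = refl

flip-involutive : ∀ a c → flip a (flip a c) ≡ c
flip-involutive α (x , y) = cong (_, y) (not-involutive x)
flip-involutive β (x , y) = cong (x ,_) (not-involutive y)
flip-involutive γ (x , y) = cong₂ _,_ (not-involutive x) (not-involutive y)

flipIf-class : ∀ a b c → class a (flipIf a b c) ≡ class a c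
flipIf-class a true  c = flip-class a c
flipIf-class a false c = refl

flipIf-injective : ∀ a b {c d} → flipIf a b c ≡ flipIf a b d → c ≡ d
flipIf-injective a true  {c} {d} e = trans (sym (flip-involutive a c)) (trans (cong (flip a) e) (flip-involutive a d))
flipIf-injective a false e = e

toFin : Color → Fin 4
toFin (false , false) = zero
toFin (false , true)  = suc zero
toFin (true  , false) = suc (suc zero)
toFin (true  , true)  = suc (suc (suc zero))

fromFin : Fin 4 → Color
fromFin zero                   = false , false
fromFin (suc zero)             = false , true
fromFin (suc (suc zero))       = true , false
fromFin (suc (suc (suc zero))) = true , true

fromFin-toFin : ∀ c → fromFin (toFin c) ≡ c
fromFin-toFin (false , false) = refl
fromFin-toFin (false , true)  = refl
fromFin-toFin (true  , false) = refl
fromFin-toFin (true  , true)  = refl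

toFin-fromFin : ∀ i → toFin (fromFin i) ≡ i
toFin-fromFin zero                   = refl
toFin-fromFin (suc zero)             = refl
toFin-fromFin (suc (suc zero))       = refl
toFin-fromFin (suc (suc (suc zero))) = refl

paint : ∀ {n} → ℕ → (ℕ → Fin n) → (ℕ → Color) → (Fin n → Color) → Fin n → Color
paint zero    x g f v = f v
paint (suc k) x g f v = if does (v ≟ x 0) then g 0 else paint k (x ∘ suc) (g ∘ suc) f v

paint-inner : ∀ {n} k {x : ℕ → Fin n} {g f j} → (∀ {i j} → i < k → j < k → x i ≡ x j → i ≡ j) → j < k →
  paint k x g f (x j) ≡ g j
paint-inner (suc k) {x} {j = zero} inj j<k rewrite dec-true (x 0 ≟ x 0) refl = refl
paint-inner (suc k) {x} {j = suc j} inj (s≤s j<k)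
  rewrite dec-false (x (suc j) ≟ x 0) (λ e → 1+n≢0 (inj (s≤s j<k) (s≤s z≤n) e)) =
  paint-inner k (λ i<k j<k e → suc-injective (inj (s≤s i<k) (s≤s j<k) e)) j<k

paint-outer : ∀ {n} k {x : ℕ → Fin n} {g f v} → (∀ {j} → j < k → v ≢ x j) → paint k x g f v ≡ f v
paint-outer zero out = refl
paint-outer (suc k) {x} {v = v} out rewrite dec-false (v ≟ x 0) (out (s≤s z≤n)) =
  paint-outer k (out ∘ s≤s)

Among : ∀ {n} → ℕ → (ℕ → Fin n) → Fin n → Set
Among k x v = ∃ λ j → j < k × v ≡ x j

vertex : ∀ {n} → (ℕ → Fin n) → (ℕ → Fin n) → Site → Fin n
vertex x r (inner j) = x j
vertex x r (outer t) = r t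

module Reduction {n′} {G : Graph (suc n′)} (connected : Connected G)
  {ρ : Rotation G} (planar : PlanarRot ρ) (Γ : Configuration)
  (x r : ℕ → Fin (suc n′)) {L spoke}
  (S : Surrounded ρ (Among (Configuration.interiorSize Γ) x) (Configuration.ringSize Γ) r L spoke)
  (x-injective : ∀ {i j} → i < Configuration.interiorSize Γ → j < Configuration.interiorSize Γ → x i ≡ x j → i ≡ j)
  (complete : ∀ {j w} → j < Configuration.interiorSize Γ → Adj G (x j) w → ∃ λ s → s ∈ at [] (Configuration.neighbours Γ) j × w ≡ vertex x r s)
  (1<N : 1 < Configuration.ringSize Γ) (closing : Adj G (r (Configuration.ringSize Γ ∸ 1)) (r 0))
  (reducible : Reducible Γ) (¬colorable : ¬ Colorable G 4) where

  open Configuration Γ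
  open Faces G ρ using (Adj-sym)
  open Surrounded S
  open Check Γ hiding (reducible)

  V : Set
  V = Fin (suc n′)

  Inside : V → Set
  Inside = Among interiorSize x

  Outer-proper : (V → Color) → Set
  Outer-proper f = ∀ {u v} → Adj G u v → ¬ Inside u → ¬ Inside v → f u ≢ f v

  Trace : (ℕ → Color) → Set
  Trace h = ∃ λ f → Outer-proper f × (∀ {t} → t < ringSize → f (r t) ≡ h t)

  inside? : ∀ v → Dec (Inside v)
  inside? v = anyUpTo? (λ j → v ≟ x j) interiorSize

  module Kempe {h} (a : Axis) (tr : Trace h) where

    f : V → Color
    f = proj₁ tr

    f≡h : ∀ {t} → t < ringSize → f (r t) ≡ h t
    f≡h = proj₂ (proj₂ tr)

    -- A class is a pair of colours, so the components of this relation are the Kempe chains of the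
    -- axis a outside the disc.
    Link : V → V → Set
    Link u v = Adj G u v × (¬ Inside u × ¬ Inside v) × class a (f u) ≡ class a (f v)

    link-sym : ∀ {u v} → Link u v → Link v u
    link-sym (uv , (¬u , ¬v) , e) = Adj-sym uv , (¬v , ¬u) , sym e

    chain-class : ∀ {u v} → Star Link u v → class a (f u) ≡ class a (f v)
    chain-class ε = refl
    chain-class ((_ , _ , e) ◅ W) = trans e (chain-class W)

    -- Every vertex of a chain is reachable from its start u. Reachability is the predicate handed
    -- to `noncrossing`, and it is disjoint for different chains.
    restrict : ∀ {u v w} → Star Link u v → Star Link v w →
      Star (λ y z → Adj G y z × (¬ Inside z × Star Link u z)) v w
    restrict U ε = ε
    restrict U (l@(yz , (_ , ¬z) , _) ◅ W) = (yz , ¬z , U◅) ◅ restrict U◅ W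
      where U◅ = U ◅◅ (l ◅ ε)

    module Decided (chain? : ∀ u v → Dec (Star Link u v)) where

      conn : ℕ → ℕ → Bool
      conn i j = does (chain? (r i) (r j))

      conn⁻ : ∀ {i j} → conn i j ≡ true → Star Link (r i) (r j)
      conn⁻ {i} {j} e with chain? (r i) (r j)
      ... | yes W = W

      conn⁺ : ∀ {i j} → Star Link (r i) (r j) → conn i j ≡ true
      conn⁺ {i} {j} = dec-true (chain? (r i) (r j))

      cross : ∀ {i j k l} → i < j → j < k → k < l → l < ringSize →
        conn i k ≡ true → conn j l ≡ true → conn i j ≡ true
      cross {i} {j} {k} {l} i<j j<k k<l l<N ik jl with chain? (r i) (r j)
      ... | yes _ = refl
      ... | no apart = ⊥-elim (Noncrossing.noncrossing connected planar S
              (λ v → ¬ Inside v × Star Link (r i) v) (λ v → ¬ Inside v × Star Link (r j) v)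
              proj₁ proj₁ (λ (_ , W) (_ , W′) → apart (W ◅◅ reverse link-sym W′))
              i<j j<k k<l l<N
              (r-outside (<-trans i<j (<-trans j<k (<-trans k<l l<N))) , ε) (restrict ε (conn⁻ ik))
              (r-outside (<-trans j<k (<-trans k<l l<N)) , ε) (restrict ε (conn⁻ jl)))

      module _ (B : ℕ → Bool) (respects : ∀ {i j} → i < ringSize → j < ringSize → conn i j ≡ true → B i ≡ B j) where

        -- The union of the chains through ring positions selected by B; chains that miss the ring
        -- keep their colours.
        K : V → Bool
        K v = anyBelow ringSize λ t → B t ∧ does (chain? (r t) v)

        K⁺ : ∀ {t v} → t < ringSize → B t ≡ true → Star Link (r t) v → K v ≡ true
        K⁺ {t} {v} t<N Bt W = anyBelow⁺ ringSize t<N (cong₂ _∧_ Bt (dec-true (chain? (r t) v) W))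

        K⁻ : ∀ {v} → K v ≡ true → ∃ λ t → t < ringSize × B t ≡ true × Star Link (r t) v
        K⁻ {v} e with anyBelow⁻ ringSize e
        ... | t , t<N , q with ∧-true⁻ {B t} q
        ...   | Bt , w with chain? (r t) v
        ...     | yes W = t , t<N , Bt , W

        K-link : ∀ {u v} → Link u v → K u ≡ true → K v ≡ true
        K-link l Ku with K⁻ Ku
        ... | t , t<N , Bt , W = K⁺ t<N Bt (W ◅◅ (l ◅ ε))

        bool-iff : ∀ {p q} → (p ≡ true → q ≡ true) → (q ≡ true → p ≡ true) → p ≡ q
        bool-iff {true}  {q}     f g = sym (f refl)
        bool-iff {false} {true}  f g = g refl
        bool-iff {false} {false} f g = refl

        K-ring : ∀ {t} → t < ringSize → K (r t) ≡ B t
        K-ring {t} t<N = bool-iff to (λ Bt → K⁺ t<N Bt ε)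
          where
          to : K (r t) ≡ true → B t ≡ true
          to Kr with K⁻ Kr
          ... | s , s<N , Bs , W = trans (sym (respects s<N t<N (conn⁺ W))) Bs

        -- Flipping preserves classes, so an edge with equal new colours is a link. Its ends then
        -- lie both in `K` or both outside it, and undoing the flip makes the old colours equal.
        recolored : Trace (λ t → flipIf a (B t) (h t))
        recolored = f′ , proper′ , λ t<N → cong₂ (flipIf a) (K-ring t<N) (f≡h t<N)
          where
          f′ : V → Color
          f′ v = flipIf a (K v) (f v)
          proper′ : Outer-proper f′
          proper′ {u} {v} uv ¬u ¬v e = proj₁ (proj₂ tr) uv ¬u ¬v
            (flipIf-injective a (K u) (trans e (cong (λ b → flipIf a b (f v)) (sym same))))
            where
            link : Link u v
            link = uv , (¬u , ¬v) , trans (sym (flipIf-class a (K u) (f u))) (trans (cong (class a) e) (flipIf-class a (K v) (f v)))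
            same : K u ≡ K v
            same = bool-iff (K-link link) (K-link (link-sym link))

      chains : Chains ringSize Trace h a
      chains = record
        { conn = conn
        ; conn-refl = conn⁺ ε
        ; conn-sym = λ {i} {j} → conn⁺ ∘ reverse link-sym ∘ conn⁻ {i} {j}
        ; conn-trans = λ {i} {j} {k} c c′ → conn⁺ (conn⁻ {i} {j} c ◅◅ conn⁻ {j} {k} c′)
        ; conn-class = λ {i} {j} i<N j<N c → subst₂ _≡_ (cong (class a) (f≡h i<N)) (cong (class a) (f≡h j<N)) (chain-class (conn⁻ {i} {j} c))
        ; conn-next = λ {t} lt e → conn⁺ ((ring lt , (r-outside (<-trans (n<1+n _) lt) , r-outside lt) ,
            subst₂ _≡_ (cong (class a) (sym (f≡h (<-trans (n<1+n _) lt)))) (cong (class a) (sym (f≡h lt))) e) ◅ ε)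
        ; conn-cross = cross
        ; recolor = recolored
        }

  kempe : ∀ {h} → Trace h → ∀ a → ¬ ¬ Chains ringSize Trace h a
  kempe tr a k = ¬¬-∀Fin (λ u → ¬¬-∀Fin λ v → ¬¬-excluded-middle) λ chain? → k (Kempe.Decided.chains a tr chain?)

  trace-proper : ∀ {h} → Trace h → ∀ {t} → suc t < ringSize → h t ≢ h (suc t)
  trace-proper (f , proper , f≡h) lt e = proper (ring lt) (r-outside (<-trans (n<1+n _) lt)) (r-outside lt)
    (trans (f≡h (<-trans (n<1+n _) lt)) (trans e (sym (f≡h lt))))

  last<N : ringSize ∸ 1 < ringSize
  last<N = ≤-reflexive (m+[n∸m]≡n (<⇒≤ 1<N))

  trace-closing : ∀ {h} → Trace h → h (ringSize ∸ 1) ≢ h 0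
  trace-closing (f , proper , f≡h) e = proper closing (r-outside last<N) (r-outside (<⇒≤ 1<N))
    (trans (f≡h last<N) (trans e (sym (f≡h (<⇒≤ 1<N)))))

  module Extend {h} (tr : Trace h) (χ : List Color) (ok : valid (tab ringSize h) χ ≡ true) where

    f : V → Color
    f = proj₁ tr

    F : V → Color
    F = paint interiorSize x (at c₀ χ) f

    F-outside : ∀ {v} → ¬ Inside v → F v ≡ f v
    F-outside ¬v = paint-outer interiorSize λ {j} j<k e → ¬v (j , j<k , e)

    F-site : ∀ s → inBounds s ≡ true → F (vertex x r s) ≡ siteColor χ (tab ringSize h) s
    F-site (inner j) b = paint-inner interiorSize x-injective (<ᵇ⇒< j interiorSize (≡⇒T b))
    F-site (outer t) b = trans (F-outside (r-outside t<N))
      (trans (proj₂ (proj₂ tr) t<N) (sym (at-tab ringSize t<N)))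
      where
      t<N : t < ringSize
      t<N = <ᵇ⇒< t ringSize (≡⇒T b)

    inner-proper : ∀ {j w} → j < interiorSize → Adj G (x j) w → F (x j) ≢ F w
    inner-proper {j} j<k a e with complete j<k a
    ... | s , s∈ , refl with ∧-true⁻ {inBounds s} (all⁻ _ (allBelow⁻ interiorSize ok j<k) s∈)
    ...   | bounds , differ with trans (sym differ) (cong not (≡⇒==ᶜ (sym
              (trans (sym (paint-inner interiorSize {f = f} x-injective j<k)) (trans e (F-site s bounds))))))
    ...     | ()

    F-proper : ∀ u v → Adj G u v → F u ≢ F v
    F-proper u v uv e with inside? u | inside? v
    ... | yes (j , j<k , refl) | _ = inner-proper j<k uv e
    ... | no _ | yes (j , j<k , refl) = inner-proper j<k (Adj-sym uv) (sym e)
    ... | no ¬u | no ¬v = proj₁ (proj₂ tr) uv ¬u ¬v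
          (trans (sym (F-outside ¬u)) (trans e (F-outside ¬v)))

    coloring : Colorable G 4
    coloring = toFin ∘ F , λ u v uv e → F-proper u v uv
      (trans (sym (fromFin-toFin (F u))) (trans (cong fromFin e) (fromFin-toFin (F v))))

  stuck : ∀ {h} → Trace h → extends (tab ringSize h) ≡ true → ⊥
  stuck {h} tr e with search (tab ringSize h) neighbours []
  ... | just χ = ¬colorable (Extend.coloring tr χ e)
  stuck tr () | nothing

  not-outer-colorable : ∀ f → ¬ Outer-proper f
  not-outer-colorable f proper = Sound.no-trace Γ Trace trace-proper trace-closing kempe (Reducible.reducible reducible) 1<N stuck
    {f ∘ r} (f , proper , λ _ → refl)

-- The dumbbell

apart : ∀ {A : Set} {xs : List A} → Unique xs → (i j : Fin (length xs)) → {False (i ≟ j)} →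
  lookup xs i ≢ lookup xs j
apart u i j {i≢j} e = toWitnessFalse i≢j (lookup-injective u i j e)

chain-closed : ∀ {n} (σ : Fin n → Fin n) {x} L {y} → Chain σ x L y →
  ∀ {u} → u ∈ x ∷ L → σ u ∈ L ⊎ σ u ≡ y
chain-closed σ []      e       (here refl) = inj₂ e
chain-closed σ (l ∷ L) (e , _) (here refl) = inj₁ (here e)
chain-closed σ (l ∷ L) (_ , c) (there u∈) with chain-closed σ L c u∈
... | inj₁ q = inj₁ (there q)
... | inj₂ q = inj₂ q

module _ {n} {G : Graph n} where

  -- A run that returns to its start is the whole rotation, which is a single cycle on the
  -- neighbours of v.
  chain-covers : (ρ : Rotation G) → ∀ {v x L} → Adj G v x → Chain (rot ρ v) x L x →
    ∀ {w} → Adj G v w → w ∈ x ∷ L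
  chain-covers ρ {v} {x} {L} vx c {w} vw with rot-cyc ρ v x w vx vw
  ... | k , refl = go k
    where
    go : ∀ k → iter (rot ρ v) k x ∈ x ∷ L
    go zero = here refl
    go (suc k) with chain-closed (rot ρ v) L c (go k)
    ... | inj₁ q = there q
    ... | inj₂ q = here q

  private
    spokes : Fin n → List (Fin n)
    spokes v = select (adj G v) (allFin n)

  unique⇒length≤deg : ∀ {v xs} → Unique xs → (∀ {w} → w ∈ xs → Adj G v w) → length xs ≤ deg G v
  unique⇒length≤deg {v} {xs} u adjacent = subst (length xs ≤_) (sym (count≡length-select (adj G v) (allFin n)))
    (unique-⊆⇒length≤ u λ {w} w∈ → ∈-select⁺ (adj G v) (∈-allFin w) (adjacent w∈))

  -- A repetition would let deg v neighbours fit into a shorter list. Thus the prescribed degrees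
  -- turn listed neighbours into distinct ones.
  covering⇒unique : ∀ {v} xs → (∀ {w} → Adj G v w → w ∈ xs) → deg G v ≡ length xs → Unique xs
  covering⇒unique {v} xs covers d = tight xs (select-unique (adj G v) (allFin⁺ n))
    (λ {w} w∈ → covers (∈-select⁻ (adj G v) (allFin n) w∈))
    (≤-reflexive (trans (sym d) (count≡length-select (adj G v) (allFin n))))
    where
    tight : ∀ (xs : List (Fin n)) {ys} → Unique ys → (∀ {w} → w ∈ ys → w ∈ xs) → length xs ≤ length ys → Unique xs
    tight [] u s l = []
    tight (x ∷ xs) {ys} u s l with Any.any? (x ≟_) xs
    ... | yes x∈ = ⊥-elim (1+n≰n (≤-trans l (unique-⊆⇒length≤ u λ w∈ → drop (s w∈))))
      where
      drop : ∀ {w} → w ∈ x ∷ xs → w ∈ xs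
      drop (here refl) = x∈
      drop (there w∈) = w∈
    ... | no x∉ = ¬Any⇒All¬ xs x∉ ∷ tight xs (filter⁺ ≢x? u) sub
            (≤-pred (≤-trans l (unique-⊆⇒length≤ {ys = x ∷ filter ≢x? ys} u split)))
      where
      ≢x? = λ y → ¬? (y ≟ x)
      sub : ∀ {w} → w ∈ filter ≢x? ys → w ∈ xs
      sub w∈ with ∈-filter⁻ ≢x? {xs = ys} w∈
      ... | w∈ys , w≢x with s w∈ys
      ...   | here e = ⊥-elim (w≢x e)
      ...   | there q = q
      split : ∀ {w} → w ∈ ys → w ∈ x ∷ filter ≢x? ys
      split {w} w∈ with w ≟ x
      ... | yes e = here e
      ... | no ne = there (∈-filter⁺ ≢x? w∈ ne)

occurs-∉ : ∀ {n} {L : List (Fin n)} {w} → w ∉ L → occurs L w ≡ false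
occurs-∉ {L = L} {w} w∉ = ⨁-false L λ {l} l∈ → dec-false (w ≟ l) λ { refl → w∉ l∈ }

occurs-∈ : ∀ {n} {L : List (Fin n)} {w} → Unique L → w ∈ L → occurs L w ≡ true
occurs-∈ {w = w} u w∈ = trans (⨁-single u w∈ λ {l} _ l≢w → dec-false (w ≟ l) (l≢w ∘ sym))
  (dec-true (w ≟ w) refl)

at-∈ : ∀ {A : Set} {d : A} xs {i} → i < length xs → at d xs i ∈ xs
at-∈ (x ∷ xs) {zero}  _       = here refl
at-∈ (x ∷ xs) {suc i} (s≤s l) = there (at-∈ xs l)

at-injective : ∀ {A : Set} {d : A} {xs} → Unique xs → ∀ {i j} → i < length xs → j < length xs →
  at d xs i ≡ at d xs j → i ≡ j
at-injective (x∉ ∷ u) {zero}  {zero}  _ _ _ = refl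
at-injective {xs = x ∷ xs} (x∉ ∷ u) {zero}  {suc j} _ (s≤s l) e = ⊥-elim (All.lookup x∉ (at-∈ xs l) e)
at-injective {xs = x ∷ xs} (x∉ ∷ u) {suc i} {zero}  (s≤s l) _ e = ⊥-elim (All.lookup x∉ (at-∈ xs l) (sym e))
at-injective (x∉ ∷ u) {suc i} {suc j} (s≤s l) (s≤s l′) e = cong suc (at-injective u l l′ e)

∈⇒Among : ∀ {n} {d : Fin n} xs {v} → v ∈ xs → Among (length xs) (at d xs) v
∈⇒Among (x ∷ xs) (here e) = 0 , s≤s z≤n , e
∈⇒Among (x ∷ xs) (there v∈) with ∈⇒Among xs v∈
... | j , l , e = suc j , s≤s l , e

Among⇒∈ : ∀ {n} {d : Fin n} xs {v} → Among (length xs) (at d xs) v → v ∈ xs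
Among⇒∈ xs (j , l , refl) = at-∈ xs l

All-at : ∀ {A : Set} {P : A → Set} {d xs} → All P xs → ∀ {i} → i < length xs → P (at d xs i)
All-at (p ∷ ps) {zero} _ = p
All-at (p ∷ ps) {suc i} (s≤s l) = All-at ps l

module Dumbbell {n″} (G : Graph (suc (suc n″))) (connected : Connected G)
  (ρ : Rotation G) (planar : PlanarRot ρ)
  (chord : ∀ {v u} → Adj G v u → rot ρ v u ≢ u → Adj G u (rot ρ v u)) where

  open Faces G ρ using (Adj-sym; Adj⇒≢)

  V : Set
  V = Fin (suc (suc n″))

  record Triangle (v u w : V) : Set where
    field
      vw    : Adj G v w
      uw    : Adj G u w
      rot-w : rot ρ w v ≡ u
      rot-u : rot ρ u w ≡ v

  triangle : ∀ {v u w} → Adj G v u → rot ρ v u ≡ w → u ≢ w → Triangle v u w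
  triangle {v} {u} vu refl u≢w = record
    { vw = vw ; uw = chord vu (u≢w ∘ sym) ; rot-w = at-w
    ; rot-u = Jordan.triangle G connected ρ planar chord (Adj-sym vw) at-w (Adj⇒≢ (Adj-sym vu)) }
    where
    vw = rot-adj ρ v u vu
    at-w = Jordan.triangle G connected ρ planar chord vu refl (u≢w ∘ sym)

  -- One half of the dumbbell. The half turn exchanges a with b, c with d, v₁ v₂ with v₄ v₅ and u₁
  -- u₂ u₃ with u₄ u₅ u₆, so the other half is a `Side` with permuted arguments and each fact needs
  -- one proof.
  record Side (a b c d v₁ v₂ u₁ u₂ u₃ : V) : Set where
    field
      ab : Adj G a b
      deg-a : deg G a ≡ 5
      chain-a : Chain (rot ρ a) b (d ∷ v₁ ∷ v₂ ∷ c ∷ []) b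
      deg-v₁ : deg G v₁ ≡ 5
      deg-v₂ : deg G v₂ ≡ 5
      outer-v₁ : Chain (rot ρ v₁) d (u₁ ∷ u₂ ∷ []) v₂
      outer-v₂ : Chain (rot ρ v₂) v₁ (u₂ ∷ u₃ ∷ []) c

    near-a : ∀ {w} → Adj G a w → w ∈ b ∷ d ∷ v₁ ∷ v₂ ∷ c ∷ []
    near-a = chain-covers ρ ab chain-a

    unique-a : Unique (b ∷ d ∷ v₁ ∷ v₂ ∷ c ∷ [])
    unique-a = covering⇒unique {G = G} {a} _ near-a deg-a

    module Δabd   = Triangle (triangle ab (proj₁ chain-a) (apart unique-a (# 0) (# 1)))
    module Δadv₁  = Triangle (triangle Δabd.vw (proj₁ (proj₂ chain-a)) (apart unique-a (# 1) (# 2)))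
    module Δav₁v₂ = Triangle (triangle Δadv₁.vw (proj₁ (proj₂ (proj₂ chain-a))) (apart unique-a (# 2) (# 3)))
    module Δav₂c  = Triangle (triangle Δav₁v₂.vw (proj₁ (proj₂ (proj₂ (proj₂ chain-a)))) (apart unique-a (# 3) (# 4)))
    module Δacb   = Triangle (triangle Δav₂c.vw (proj₂ (proj₂ (proj₂ (proj₂ chain-a)))) (apart unique-a (# 4) (# 0)))

    near-v₁ : ∀ {w} → Adj G v₁ w → w ∈ a ∷ d ∷ u₁ ∷ u₂ ∷ v₂ ∷ []
    near-v₁ = chain-covers ρ (Adj-sym Δadv₁.vw)
      (Δadv₁.rot-w , proj₁ outer-v₁ , proj₁ (proj₂ outer-v₁) , proj₂ (proj₂ outer-v₁) , Δav₁v₂.rot-u)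

    unique-v₁ : Unique (a ∷ d ∷ u₁ ∷ u₂ ∷ v₂ ∷ [])
    unique-v₁ = covering⇒unique {G = G} {v₁} _ near-v₁ deg-v₁

    near-v₂ : ∀ {w} → Adj G v₂ w → w ∈ a ∷ v₁ ∷ u₂ ∷ u₃ ∷ c ∷ []
    near-v₂ = chain-covers ρ (Adj-sym Δav₁v₂.vw)
      (Δav₁v₂.rot-w , proj₁ outer-v₂ , proj₁ (proj₂ outer-v₂) , proj₂ (proj₂ outer-v₂) , Δav₂c.rot-u)

    unique-v₂ : Unique (a ∷ v₁ ∷ u₂ ∷ u₃ ∷ c ∷ [])
    unique-v₂ = covering⇒unique {G = G} {v₂} _ near-v₂ deg-v₂

    module Δv₁du₁  = Triangle (triangle (Adj-sym Δadv₁.uw) (proj₁ outer-v₁) (apart unique-v₁ (# 1) (# 2)))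
    module Δv₁u₁u₂ = Triangle (triangle Δv₁du₁.vw (proj₁ (proj₂ outer-v₁)) (apart unique-v₁ (# 2) (# 3)))
    module Δv₁u₂v₂ = Triangle (triangle Δv₁u₁u₂.vw (proj₂ (proj₂ outer-v₁)) (apart unique-v₁ (# 3) (# 4)))
    module Δv₂u₂u₃ = Triangle (triangle (Adj-sym Δv₁u₂v₂.uw) (proj₁ (proj₂ outer-v₂)) (apart unique-v₂ (# 2) (# 3)))
    module Δv₂u₃c  = Triangle (triangle Δv₂u₂u₃.vw (proj₂ (proj₂ outer-v₂)) (apart unique-v₂ (# 3) (# 4)))

    ¬v₁c : c ≢ d → c ≢ u₁ → c ≢ u₂ → ¬ Adj G v₁ c
    ¬v₁c c≢d c≢u₁ c≢u₂ v₁c = All¬⇒¬Any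
      (Adj⇒≢ (Adj-sym Δav₂c.vw) ∷ c≢d ∷ c≢u₁ ∷ c≢u₂ ∷ apart unique-a (# 4) (# 3) ∷ []) (near-v₁ v₁c)

  Ring : (c d u₁ u₂ u₃ u₄ u₅ u₆ : V) → Set
  Ring c d u₁ u₂ u₃ u₄ u₅ u₆ = Unique (d ∷ u₁ ∷ u₂ ∷ u₃ ∷ c ∷ u₄ ∷ u₅ ∷ u₆ ∷ [])

  -- The inner vertices of different halves are kept apart by their neighbourhoods: a coincidence
  -- would give a vertex of degree 5 a neighbour that differs from all five of its listed ones.
  module Separation₁ {a b c d v₁ v₂ v₄ v₅ u₁ u₂ u₃ u₄ u₅ u₆}
    (A : Side a b c d v₁ v₂ u₁ u₂ u₃) (B : Side b a d c v₄ v₅ u₄ u₅ u₆)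
    (R : Ring c d u₁ u₂ u₃ u₄ u₅ u₆) where

    module SA = Side A
    module SB = Side B

    ¬v₁c : ¬ Adj G v₁ c
    ¬v₁c = SA.¬v₁c (apart R (# 4) (# 0)) (apart R (# 4) (# 1)) (apart R (# 4) (# 2))

    v₁≢v₄ : v₁ ≢ v₄
    v₁≢v₄ refl = ¬v₁c (Adj-sym SB.Δadv₁.uw)

    v₂≢v₅ : v₂ ≢ v₅
    v₂≢v₅ refl = All¬⇒¬Any
      (apart SA.unique-a (# 4) (# 0) ∷ apart SB.unique-a (# 1) (# 2) ∷ apart R (# 4) (# 6) ∷ apart R (# 4) (# 7) ∷
       apart R (# 4) (# 0) ∷ []) (SB.near-v₂ SA.Δav₂c.uw)

    -- Aligning the rotations at v₁ = v₅ from d on gives u₅ = v₂ and u₆ = a.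
    v₁≢v₅ : v₁ ≢ v₅
    v₁≢v₅ v₁≡v₅ = All¬⇒¬Any
      ((λ u₄≡a → apart R (# 5) (# 7) (trans u₄≡a a≡u₆)) ∷
       (λ u₄≡v₁ → apart SB.unique-v₁ (# 2) (# 4) (trans u₄≡v₁ v₁≡v₅)) ∷
       apart R (# 5) (# 2) ∷ apart R (# 5) (# 3) ∷ apart R (# 5) (# 4) ∷ [])
      (SA.near-v₂ (subst (λ z → Adj G z u₄) u₅≡v₂ (Adj-sym SB.Δv₁u₁u₂.uw)))
      where
      align : ∀ {x x′ y y′} → x ≡ x′ → rot ρ v₁ x ≡ y → rot ρ v₅ x′ ≡ y′ → y ≡ y′
      align refl refl e = trans (cong (λ v → rot ρ v _) v₁≡v₅) e
      u₁≡b : u₁ ≡ b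
      u₁≡b = align refl (proj₁ SA.outer-v₁) SB.Δav₂c.rot-u
      u₂≡v₄ : u₂ ≡ v₄
      u₂≡v₄ = align u₁≡b (proj₁ (proj₂ SA.outer-v₁)) SB.Δav₁v₂.rot-w
      u₅≡v₂ : u₅ ≡ v₂
      u₅≡v₂ = sym (align u₂≡v₄ (proj₂ (proj₂ SA.outer-v₁)) (proj₁ SB.outer-v₂))
      a≡u₆ : a ≡ u₆
      a≡u₆ = align (sym u₅≡v₂) SA.Δav₁v₂.rot-u (proj₁ (proj₂ SB.outer-v₂))

  -- The parameter v₂ ≢ v₄ is `v₁≢v₅` after the half turn. It is obtained from `Separation₁` with
  -- the halves exchanged and then separates inner vertices of one half from outer vertices of the
  -- other.
  module Separation₂ {a b c d v₁ v₂ v₄ v₅ u₁ u₂ u₃ u₄ u₅ u₆}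
    (A : Side a b c d v₁ v₂ u₁ u₂ u₃) (B : Side b a d c v₄ v₅ u₄ u₅ u₆)
    (R : Ring c d u₁ u₂ u₃ u₄ u₅ u₆) (v₂≢v₄ : v₂ ≢ v₄) where

    open Separation₁ A B R public

    ¬av₄ : ¬ Adj G a v₄
    ¬av₄ av₄ = All¬⇒¬Any
      (Adj⇒≢ (Adj-sym SB.Δadv₁.vw) ∷ apart SB.unique-a (# 2) (# 4) ∷ ≢-sym v₁≢v₄ ∷ ≢-sym v₂≢v₄ ∷
       apart SB.unique-a (# 2) (# 1) ∷ []) (SA.near-a av₄)

    a≢u₄ : a ≢ u₄
    a≢u₄ refl = ¬av₄ (Adj-sym SB.Δv₁du₁.vw)

    a≢u₅ : a ≢ u₅
    a≢u₅ refl = ¬av₄ (Adj-sym SB.Δv₁u₁u₂.vw)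

    a≢u₆ : a ≢ u₆
    a≢u₆ refl = All¬⇒¬Any
      (Adj⇒≢ (Adj-sym SB.Δav₁v₂.vw) ∷ apart SB.unique-a (# 3) (# 4) ∷ ≢-sym v₁≢v₅ ∷ ≢-sym v₂≢v₅ ∷
       apart SB.unique-a (# 3) (# 1) ∷ []) (SA.near-a (Adj-sym SB.Δv₂u₂u₃.vw))

    v₁≢u₄ : v₁ ≢ u₄
    v₁≢u₄ refl = ¬v₁c (Adj-sym SB.Δv₁du₁.uw)

    only-v₂ : ∀ {w} → Adj G v₁ w → w ≢ a → w ≢ d → w ≢ u₁ → w ≢ u₂ → w ≡ v₂
    only-v₂ v₁w n₀ n₁ n₂ n₃ with SA.near-v₁ v₁w
    ... | here e = ⊥-elim (n₀ e)
    ... | there (here e) = ⊥-elim (n₁ e)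
    ... | there (there (here e)) = ⊥-elim (n₂ e)
    ... | there (there (there (here e))) = ⊥-elim (n₃ e)
    ... | there (there (there (there (here e)))) = e

    v₁≢u₅ : v₁ ≢ u₅
    -- Both u₄ and u₆ are neighbours of u₅. Among the neighbours of v₁ only v₂ is left for either,
    -- although u₄ and u₆ differ.
    v₁≢u₅ refl = apart R (# 5) (# 7) (trans
      (only-v₂ (Adj-sym SB.Δv₁u₁u₂.uw) (≢-sym a≢u₄) (apart R (# 5) (# 0)) (apart R (# 5) (# 1)) (apart R (# 5) (# 2)))
      (sym (only-v₂ SB.Δv₂u₂u₃.uw (≢-sym a≢u₆) (apart R (# 7) (# 0)) (apart R (# 7) (# 1)) (apart R (# 7) (# 2)))))

    ¬v₂u₄ : v₁ ≢ u₄ → ¬ Adj G v₂ u₄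
    ¬v₂u₄ ne v₂u₄ = All¬⇒¬Any
      (≢-sym a≢u₄ ∷ ≢-sym ne ∷ apart R (# 5) (# 2) ∷ apart R (# 5) (# 3) ∷ apart R (# 5) (# 4) ∷ []) (SA.near-v₂ v₂u₄)

    v₂≢u₅ : v₂ ≢ u₅
    v₂≢u₅ refl = ¬v₂u₄ v₁≢u₄ (Adj-sym SB.Δv₁u₁u₂.uw)

    v₁≢u₆ : v₁ ≢ u₆
    v₁≢u₆ refl = v₂≢u₅ (sym (only-v₂ (Adj-sym SB.Δv₂u₂u₃.uw) (≢-sym a≢u₅)
      (apart R (# 6) (# 0)) (apart R (# 6) (# 1)) (apart R (# 6) (# 2))))

    ¬v₂u₅ : ¬ Adj G v₂ u₅
    ¬v₂u₅ v₂u₅ = All¬⇒¬Any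
      (≢-sym a≢u₅ ∷ ≢-sym v₁≢u₅ ∷ apart R (# 6) (# 2) ∷ apart R (# 6) (# 3) ∷ apart R (# 6) (# 4) ∷ []) (SA.near-v₂ v₂u₅)

    v₂≢u₄ : v₂ ≢ u₄
    v₂≢u₄ refl = ¬v₂u₅ SB.Δv₁u₁u₂.uw

    v₂≢u₆ : v₂ ≢ u₆
    v₂≢u₆ refl = ¬v₂u₅ (Adj-sym SB.Δv₂u₂u₃.uw)

  ring-swap : ∀ {c d u₁ u₂ u₃ u₄ u₅ u₆} → Ring c d u₁ u₂ u₃ u₄ u₅ u₆ → Ring d c u₄ u₅ u₆ u₁ u₂ u₃
  ring-swap {c} {d} {u₁} {u₂} {u₃} {u₄} {u₅} {u₆} =
    Permutationₛ.Unique-resp-↭ (setoid V) (↭⇒↭ₛ (++-comm (d ∷ u₁ ∷ u₂ ∷ u₃ ∷ []) (c ∷ u₄ ∷ u₅ ∷ u₆ ∷ [])))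

  -- The dumbbell as a disc surrounded by its ring

  module Around {a b c d v₁ v₂ v₄ v₅ u₁ u₂ u₃ u₄ u₅ u₆}
    (A : Side a b c d v₁ v₂ u₁ u₂ u₃) (B : Side b a d c v₄ v₅ u₄ u₅ u₆)
    (R : Ring c d u₁ u₂ u₃ u₄ u₅ u₆) where

    module SA = Side A
    module SB = Side B
    module P = Separation₂ A B R (≢-sym (Separation₁.v₁≢v₅ B A (ring-swap R)))
    module Q = Separation₂ B A (ring-swap R) (≢-sym P.v₁≢v₅)

    interior : List V
    interior = a ∷ b ∷ v₁ ∷ v₂ ∷ v₄ ∷ v₅ ∷ c ∷ []

    interior-unique : Unique interior
    interior-unique =
      (Adj⇒≢ SA.ab ∷ Adj⇒≢ SA.Δadv₁.vw ∷ Adj⇒≢ SA.Δav₁v₂.vw ∷ apart SB.unique-a (# 0) (# 2) ∷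
        apart SB.unique-a (# 0) (# 3) ∷ apart SB.unique-a (# 0) (# 1) ∷ []) ∷
      (apart SA.unique-a (# 0) (# 2) ∷ apart SA.unique-a (# 0) (# 3) ∷ Adj⇒≢ SB.Δadv₁.vw ∷
        Adj⇒≢ SB.Δav₁v₂.vw ∷ apart SA.unique-a (# 0) (# 4) ∷ []) ∷
      (apart SA.unique-a (# 2) (# 3) ∷ P.v₁≢v₄ ∷ P.v₁≢v₅ ∷ apart SA.unique-a (# 2) (# 4) ∷ []) ∷
      (≢-sym Q.v₁≢v₅ ∷ P.v₂≢v₅ ∷ apart SA.unique-a (# 3) (# 4) ∷ []) ∷
      (apart SB.unique-a (# 2) (# 3) ∷ apart SB.unique-a (# 2) (# 1) ∷ []) ∷
      (apart SB.unique-a (# 3) (# 1) ∷ []) ∷ [] ∷ []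

    d-outside : All (d ≢_) interior
    d-outside = ≢-sym (Adj⇒≢ SA.Δabd.vw) ∷ apart SA.unique-a (# 1) (# 0) ∷ apart SA.unique-a (# 1) (# 2) ∷
      apart SA.unique-a (# 1) (# 3) ∷ apart SB.unique-a (# 4) (# 2) ∷ apart SB.unique-a (# 4) (# 3) ∷
      apart R (# 0) (# 4) ∷ []

    u₁-outside : All (u₁ ≢_) interior
    u₁-outside = apart SA.unique-v₁ (# 2) (# 0) ∷ ≢-sym Q.a≢u₄ ∷ ≢-sym (Adj⇒≢ SA.Δv₁du₁.vw) ∷
      apart SA.unique-v₁ (# 2) (# 4) ∷ ≢-sym Q.v₁≢u₄ ∷ ≢-sym Q.v₂≢u₄ ∷ apart R (# 1) (# 4) ∷ []

    u₂-outside : All (u₂ ≢_) interior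
    u₂-outside = apart SA.unique-v₁ (# 3) (# 0) ∷ ≢-sym Q.a≢u₅ ∷ ≢-sym (Adj⇒≢ SA.Δv₁u₁u₂.vw) ∷
      apart SA.unique-v₁ (# 3) (# 4) ∷ ≢-sym Q.v₁≢u₅ ∷ ≢-sym Q.v₂≢u₅ ∷ apart R (# 2) (# 4) ∷ []

    u₃-outside : All (u₃ ≢_) interior
    u₃-outside = apart SA.unique-v₂ (# 3) (# 0) ∷ ≢-sym Q.a≢u₆ ∷ apart SA.unique-v₂ (# 3) (# 1) ∷
      ≢-sym (Adj⇒≢ SA.Δv₂u₂u₃.vw) ∷ ≢-sym Q.v₁≢u₆ ∷ ≢-sym Q.v₂≢u₆ ∷ apart R (# 3) (# 4) ∷ []

    u₄-outside : All (u₄ ≢_) interior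
    u₄-outside = ≢-sym P.a≢u₄ ∷ apart SB.unique-v₁ (# 2) (# 0) ∷ ≢-sym P.v₁≢u₄ ∷ ≢-sym P.v₂≢u₄ ∷
      ≢-sym (Adj⇒≢ SB.Δv₁du₁.vw) ∷ apart SB.unique-v₁ (# 2) (# 4) ∷ apart R (# 5) (# 4) ∷ []

    u₅-outside : All (u₅ ≢_) interior
    u₅-outside = ≢-sym P.a≢u₅ ∷ apart SB.unique-v₁ (# 3) (# 0) ∷ ≢-sym P.v₁≢u₅ ∷ ≢-sym P.v₂≢u₅ ∷
      ≢-sym (Adj⇒≢ SB.Δv₁u₁u₂.vw) ∷ apart SB.unique-v₁ (# 3) (# 4) ∷ apart R (# 6) (# 4) ∷ []

    u₆-outside : All (u₆ ≢_) interior
    u₆-outside = ≢-sym P.a≢u₆ ∷ apart SB.unique-v₂ (# 3) (# 0) ∷ ≢-sym P.v₁≢u₆ ∷ ≢-sym P.v₂≢u₆ ∷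
      apart SB.unique-v₂ (# 3) (# 1) ∷ ≢-sym (Adj⇒≢ SB.Δv₂u₂u₃.vw) ∷ apart R (# 7) (# 4) ∷ []

    cu₄ : Adj G c u₄
    cu₄ = SB.Δv₁du₁.uw
    cv₄ : Adj G c v₄
    cv₄ = SB.Δadv₁.uw
    cb : Adj G c b
    cb = SA.Δacb.uw
    ca : Adj G c a
    ca = Adj-sym SA.Δav₂c.vw
    cv₂ : Adj G c v₂
    cv₂ = Adj-sym SA.Δav₂c.uw
    cu₃ : Adj G c u₃
    cu₃ = Adj-sym SA.Δv₂u₃c.uw

    six-unique : Unique (u₄ ∷ v₄ ∷ b ∷ a ∷ v₂ ∷ u₃ ∷ [])
    six-unique =
      (o₄ (# 4) ∷ o₄ (# 1) ∷ o₄ (# 0) ∷ o₄ (# 3) ∷ apart R (# 5) (# 3) ∷ []) ∷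
      (i (# 4) (# 1) ∷ i (# 4) (# 0) ∷ i (# 4) (# 3) ∷ ≢-sym (o₃ (# 4)) ∷ []) ∷
      (i (# 1) (# 0) ∷ i (# 1) (# 3) ∷ ≢-sym (o₃ (# 1)) ∷ []) ∷
      (i (# 0) (# 3) ∷ ≢-sym (o₃ (# 0)) ∷ []) ∷
      (≢-sym (o₃ (# 3)) ∷ []) ∷ [] ∷ []
      where
      i = apart interior-unique
      o₄ : ∀ j → u₄ ≢ lookup interior j
      o₄ j = All.lookup u₄-outside (∈-lookup j)
      o₃ : ∀ j → u₃ ≢ lookup interior j
      o₃ j = All.lookup u₃-outside (∈-lookup j)

    -- The known run u₄, v₄, b, a, v₂, u₃ around c leaves a gap after u₃. If y is u₄ the degree is
    -- 6, if its successor is u₄ the degree is 7, and otherwise y and its successor are two further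
    -- neighbours.
    y : V
    y = rot ρ c u₃

    cy : Adj G c y
    cy = rot-adj ρ c u₃ cu₃

    rot-≢ : ∀ {p q s} → Adj G c p → Adj G c q → p ≢ q → rot ρ c q ≡ s → rot ρ c p ≢ s
    rot-≢ {p} {q} cp cq p≢q refl e = p≢q (rot-inj ρ c p q cp cq e)

    -- A neighbour p of c outside the known run u₄, v₄, b, a, v₂, u₃ is followed by a neighbour
    -- which can only meet that run at u₄.
    fresh : ∀ {p} → Adj G c p → All (p ≢_) (u₄ ∷ v₄ ∷ b ∷ a ∷ v₂ ∷ []) → rot ρ c p ≢ u₄ →
      All (rot ρ c p ≢_) (u₄ ∷ v₄ ∷ b ∷ a ∷ v₂ ∷ u₃ ∷ [])
    fresh cp (n₀ ∷ n₁ ∷ n₂ ∷ n₃ ∷ n₄ ∷ []) ne =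
      ne ∷ rot-≢ cp cu₄ n₀ SB.Δv₁du₁.rot-u ∷ rot-≢ cp cv₄ n₁ SB.Δadv₁.rot-u ∷ rot-≢ cp cb n₂ SA.Δacb.rot-u ∷
      rot-≢ cp ca n₃ SA.Δav₂c.rot-w ∷ rot-≢ cp cv₂ n₄ SA.Δv₂u₃c.rot-w ∷ []

    u₃-fresh : All (u₃ ≢_) (u₄ ∷ v₄ ∷ b ∷ a ∷ v₂ ∷ [])
    u₃-fresh = apart six-unique (# 5) (# 0) ∷ apart six-unique (# 5) (# 1) ∷ apart six-unique (# 5) (# 2) ∷
      apart six-unique (# 5) (# 3) ∷ apart six-unique (# 5) (# 4) ∷ []

    Linked : V → V → Set
    Linked p q = Adj G p q × Among 7 (at a interior) q

    inside : ∀ {w} → w ∈ interior → Among 7 (at a interior) w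
    inside = ∈⇒Among interior

    a∈ : a ∈ interior
    a∈ = here refl
    b∈ : b ∈ interior
    b∈ = there (here refl)
    v₁∈ : v₁ ∈ interior
    v₁∈ = there (there (here refl))
    v₂∈ : v₂ ∈ interior
    v₂∈ = there (there (there (here refl)))
    v₄∈ : v₄ ∈ interior
    v₄∈ = there (there (there (there (here refl))))
    v₅∈ : v₅ ∈ interior
    v₅∈ = there (there (there (there (there (here refl)))))
    c∈ : c ∈ interior
    c∈ = there (there (there (there (there (there (here refl))))))

    via-a : All (λ w → Star Linked w a × Star Linked a w) interior
    via-a = (ε , ε) ∷ hop SA.ab b∈ ∷ hop SA.Δadv₁.vw v₁∈ ∷ hop SA.Δav₁v₂.vw v₂∈ ∷ hop₂ SB.Δadv₁.vw v₄∈ ∷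
      hop₂ SB.Δav₁v₂.vw v₅∈ ∷ hop SA.Δav₂c.vw c∈ ∷ []
      where
      hop : ∀ {w} → Adj G a w → w ∈ interior → Star Linked w a × Star Linked a w
      hop aw w∈ = (Adj-sym aw , inside a∈) ◅ ε , (aw , inside w∈) ◅ ε
      hop₂ : ∀ {w} → Adj G b w → w ∈ interior → Star Linked w a × Star Linked a w
      hop₂ bw w∈ = (Adj-sym bw , inside b∈) ◅ (Adj-sym SA.ab , inside a∈) ◅ ε ,
                   (SA.ab , inside b∈) ◅ (bw , inside w∈) ◅ ε

    linked : ∀ {p q} → p ∈ interior → q ∈ interior → Star Linked p q
    linked p∈ q∈ = proj₁ (All.lookup via-a p∈) ◅◅ proj₂ (All.lookup via-a q∈)

    outside : ∀ {p} → All (p ≢_) interior → ¬ Among 7 (at a interior) p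
    outside ne ins = All.lookup ne (Among⇒∈ interior ins) refl

    run-inside : ∀ Ls → All (All (_∈ interior)) Ls → ∀ {t w} → t < length Ls → ¬ Among 7 (at a interior) w →
      occurs (at [] Ls t) w ≡ false
    run-inside Ls all {t} t<N out = occurs-∉ λ w∈ → out (inside (All.lookup (All-at {d = []} all t<N) w∈))

    interior-injective : ∀ {i j} → i < 7 → j < 7 → at a interior i ≡ at a interior j → i ≡ j
    interior-injective = at-injective interior-unique

    v₂v₁ : Unique (v₂ ∷ v₁ ∷ [])
    v₂v₁ = (apart interior-unique (# 3) (# 2) ∷ []) ∷ [] ∷ []
    cv₂-unique : Unique (c ∷ v₂ ∷ [])
    cv₂-unique = (apart interior-unique (# 6) (# 3) ∷ []) ∷ [] ∷ []
    v₄c : Unique (v₄ ∷ c ∷ [])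
    v₄c = (apart interior-unique (# 4) (# 6) ∷ []) ∷ [] ∷ []
    v₅v₄ : Unique (v₅ ∷ v₄ ∷ [])
    v₅v₄ = (apart interior-unique (# 5) (# 4) ∷ []) ∷ [] ∷ []

    module Degree₆ (y≡u₄ : y ≡ u₄) where

      module Δ = Triangle (triangle cu₃ y≡u₄ (apart R (# 3) (# 5)))

      ring : List V
      ring = d ∷ u₁ ∷ u₂ ∷ u₃ ∷ u₄ ∷ u₅ ∷ u₆ ∷ []

      ring-unique : Unique ring
      ring-unique =
        (p (# 0) (# 1) ∷ p (# 0) (# 2) ∷ p (# 0) (# 3) ∷ p (# 0) (# 5) ∷ p (# 0) (# 6) ∷ p (# 0) (# 7) ∷ []) ∷
        (p (# 1) (# 2) ∷ p (# 1) (# 3) ∷ p (# 1) (# 5) ∷ p (# 1) (# 6) ∷ p (# 1) (# 7) ∷ []) ∷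
        (p (# 2) (# 3) ∷ p (# 2) (# 5) ∷ p (# 2) (# 6) ∷ p (# 2) (# 7) ∷ []) ∷
        (p (# 3) (# 5) ∷ p (# 3) (# 6) ∷ p (# 3) (# 7) ∷ []) ∷
        (p (# 5) (# 6) ∷ p (# 5) (# 7) ∷ []) ∷ (p (# 6) (# 7) ∷ []) ∷ [] ∷ []
        where p = apart R

      -- Each run goes from the next ring vertex to the previous one. The two end positions get
      -- empty runs: the ring is cut open at d, and `Surrounded` prescribes runs only in between.
      runs : List (List V)
      runs = [] ∷ (v₁ ∷ []) ∷ (v₂ ∷ v₁ ∷ []) ∷ (c ∷ v₂ ∷ []) ∷ (v₄ ∷ c ∷ []) ∷ (v₅ ∷ v₄ ∷ []) ∷ [] ∷ []

      spokes′ : List V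
      spokes′ = v₁ ∷ v₁ ∷ v₂ ∷ v₂ ∷ v₄ ∷ v₅ ∷ v₅ ∷ []

      spokes∈ : All (_∈ interior) spokes′
      spokes∈ = v₁∈ ∷ v₁∈ ∷ v₂∈ ∷ v₂∈ ∷ v₄∈ ∷ v₅∈ ∷ v₅∈ ∷ []

      surrounded : Surrounded ρ (Among 7 (at a interior)) 7 (at d ring) (at [] runs) (at a spokes′)
      surrounded = record
        { r-outside = λ t<N → outside (All-at {P = λ v → All (v ≢_) interior} {d = d} {xs = ring} (d-outside ∷ u₁-outside ∷ u₂-outside ∷ u₃-outside ∷ u₄-outside ∷ u₅-outside ∷ u₆-outside ∷ []) t<N)
        ; ring = λ lt → applyUpTo⁻ {P = λ t → Adj G (at d ring t) (at d ring (suc t))} id 6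
            (SA.Δv₁du₁.uw ∷ SA.Δv₁u₁u₂.uw ∷ SA.Δv₂u₂u₃.uw ∷ Δ.uw ∷ SB.Δv₁u₁u₂.uw ∷ SB.Δv₂u₂u₃.uw ∷ []) (≤-pred lt)
        ; runs = λ lt → applyUpTo⁻ {P = λ t → Chain (rot ρ (at d ring (suc t))) (at d ring (suc (suc t))) (at [] runs (suc t)) (at d ring t)} id 5
            ((SA.Δv₁u₁u₂.rot-u , SA.Δv₁du₁.rot-w) ∷
             (SA.Δv₂u₂u₃.rot-u , SA.Δv₁u₂v₂.rot-u , SA.Δv₁u₁u₂.rot-w) ∷
             (Δ.rot-u , SA.Δv₂u₃c.rot-u , SA.Δv₂u₂u₃.rot-w) ∷
             (SB.Δv₁u₁u₂.rot-u , SB.Δv₁du₁.rot-w , Δ.rot-w) ∷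
             (SB.Δv₂u₂u₃.rot-u , SB.Δv₁u₂v₂.rot-u , SB.Δv₁u₁u₂.rot-w) ∷ []) (≤-pred (≤-pred lt))
        ; run-inside = λ lt → run-inside runs ([] ∷ (v₁∈ ∷ []) ∷ (v₂∈ ∷ v₁∈ ∷ []) ∷ (c∈ ∷ v₂∈ ∷ []) ∷ (v₄∈ ∷ c∈ ∷ []) ∷ (v₅∈ ∷ v₄∈ ∷ []) ∷ [] ∷ []) (<-trans (n<1+n _) lt)
        ; spoke-adj = applyUpTo⁻ {P = λ t → Adj G (at d ring t) (at a spokes′ t)} id 7
            (SA.Δadv₁.uw ∷ Adj-sym SA.Δv₁du₁.vw ∷ SA.Δv₁u₂v₂.uw ∷ Adj-sym SA.Δv₂u₂u₃.vw ∷ Adj-sym SB.Δv₁du₁.vw ∷ SB.Δv₁u₂v₂.uw ∷ Adj-sym SB.Δv₂u₂u₃.vw ∷ [])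
        ; spoke-inside = λ t<N → inside (All-at {d = a} spokes∈ t<N)
        ; spoke-run = λ lt → applyUpTo⁻ {P = λ t → occurs (at [] runs (suc t)) (at a spokes′ (suc t)) ≡ true} id 5
            (occurs-∈ {w = v₁} ([] ∷ []) (here refl) ∷ occurs-∈ v₂v₁ (here refl) ∷ occurs-∈ cv₂-unique (there (here refl)) ∷
             occurs-∈ v₄c (here refl) ∷ occurs-∈ v₅v₄ (here refl) ∷ []) (≤-pred (≤-pred lt))
        ; spoke-unique = λ lt t<N s≢t e → ⊥-elim (s≢t (at-injective ring-unique (<-trans (n<1+n _) lt) t<N e))
        ; inside-linked = λ s<N t<N → linked (All-at {d = a} spokes∈ s<N) (All-at {d = a} spokes∈ t<N)
        }

      near-c : ∀ {w} → Adj G c w → w ∈ u₄ ∷ v₄ ∷ b ∷ a ∷ v₂ ∷ u₃ ∷ []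
      near-c = chain-covers ρ cu₄ (SB.Δv₁du₁.rot-u , SB.Δadv₁.rot-u , SA.Δacb.rot-u , SA.Δav₂c.rot-w , SA.Δv₂u₃c.rot-w , y≡u₄)

      complete : ∀ {j w} → j < 7 → Adj G (at a interior j) w →
        ∃ λ s → s ∈ at [] (Configuration.neighbours dumbbell₆) j × w ≡ vertex (at a interior) (at d ring) s
      complete {0} _ = ∈-map⁻ (vertex (at a interior) (at d ring)) ∘ SA.near-a
      complete {1} _ = ∈-map⁻ (vertex (at a interior) (at d ring)) ∘ SB.near-a
      complete {2} _ = ∈-map⁻ (vertex (at a interior) (at d ring)) ∘ SA.near-v₁
      complete {3} _ = ∈-map⁻ (vertex (at a interior) (at d ring)) ∘ SA.near-v₂
      complete {4} _ = ∈-map⁻ (vertex (at a interior) (at d ring)) ∘ SB.near-v₁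
      complete {5} _ = ∈-map⁻ (vertex (at a interior) (at d ring)) ∘ SB.near-v₂
      complete {6} _ = ∈-map⁻ (vertex (at a interior) (at d ring)) ∘ near-c
      complete {suc (suc (suc (suc (suc (suc (suc j))))))} lt = ⊥-elim (≤⇒≯ (m≤m+n 7 j) lt)

      not-outer-colorable : ¬ Colorable G 4 → ∀ f → ¬ (∀ {u v} → Adj G u v →
        ¬ Among 7 (at a interior) u → ¬ Among 7 (at a interior) v → f u ≢ f v)
      not-outer-colorable = Reduction.not-outer-colorable connected planar dumbbell₆ (at a interior) (at d ring)
        surrounded interior-injective complete (s≤s (s≤s z≤n)) SB.Δv₂u₃c.uw dumbbell₆-reducible

    module Degree₇ (y≢u₄ : y ≢ u₄) (rot-y : rot ρ c y ≡ u₄) where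

      y-fresh : All (y ≢_) (u₄ ∷ v₄ ∷ b ∷ a ∷ v₂ ∷ u₃ ∷ [])
      y-fresh = fresh cu₃ u₃-fresh y≢u₄

      y≢ : ∀ i → y ≢ lookup (u₄ ∷ v₄ ∷ b ∷ a ∷ v₂ ∷ u₃ ∷ []) i
      y≢ i = All.lookup y-fresh (∈-lookup i)

      y-outside : All (y ≢_) interior
      y-outside = y≢ (# 3) ∷ y≢ (# 2) ∷ (λ e → P.¬v₁c (subst (λ z → Adj G z c) e (Adj-sym cy))) ∷ y≢ (# 4) ∷
        y≢ (# 1) ∷ (λ e → v₅c (subst (Adj G c) e cy)) ∷ ≢-sym (Adj⇒≢ cy) ∷ []
        where
        v₅c : ¬ Adj G c v₅
        v₅c cv₅ = All¬⇒¬Any (≢-sym (apart interior-unique (# 1) (# 6)) ∷ ≢-sym (apart interior-unique (# 4) (# 6)) ∷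
          apart R (# 4) (# 6) ∷ apart R (# 4) (# 7) ∷ apart R (# 4) (# 0) ∷ []) (SB.near-v₂ (Adj-sym cv₅))

      module Δ₁ = Triangle (triangle cu₃ refl (≢-sym (y≢ (# 5))))
      module Δ₂ = Triangle (triangle cy rot-y y≢u₄)

      ring : List V
      ring = d ∷ u₁ ∷ u₂ ∷ u₃ ∷ y ∷ u₄ ∷ u₅ ∷ u₆ ∷ []

      runs : List (List V)
      runs = [] ∷ (v₁ ∷ []) ∷ (v₂ ∷ v₁ ∷ []) ∷ (c ∷ v₂ ∷ []) ∷ (c ∷ []) ∷ (v₄ ∷ c ∷ []) ∷ (v₅ ∷ v₄ ∷ []) ∷ [] ∷ []

      spokes′ : List V
      spokes′ = v₁ ∷ v₁ ∷ v₂ ∷ v₂ ∷ c ∷ v₄ ∷ v₅ ∷ v₅ ∷ []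

      spokes∈ : All (_∈ interior) spokes′
      spokes∈ = v₁∈ ∷ v₁∈ ∷ v₂∈ ∷ v₂∈ ∷ c∈ ∷ v₄∈ ∷ v₅∈ ∷ v₅∈ ∷ []

      -- The vertex y may coincide with another ring vertex; its only spoke is c.
      y-spoke : ∀ {t} → t < 8 → t ≢ 4 → occurs (c ∷ []) (at a spokes′ t) ≡ false
      y-spoke = applyUpTo⁻ {P = λ t → t ≢ 4 → occurs (c ∷ []) (at a spokes′ t) ≡ false} id 8
        (away (# 2) ∷ away (# 2) ∷ away (# 3) ∷ away (# 3) ∷ (λ ne → ⊥-elim (ne refl)) ∷ away (# 4) ∷ away (# 5) ∷ away (# 5) ∷ [])
        where
        away : ∀ j {j≢6 : False (j ≟ (# 6))} {t} → t ≢ 4 → occurs (c ∷ []) (lookup interior j) ≡ false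
        away j {j≢6} _ = occurs-∉ (All¬⇒¬Any (apart interior-unique j (# 6) {j≢6} ∷ []))

      spoke-y : ∀ {s} → s < 6 → suc s ≢ 4 → at d ring (suc s) ≡ y → occurs (at [] runs (suc s)) c ≡ false
      spoke-y = applyUpTo⁻ {P = λ s → suc s ≢ 4 → at d ring (suc s) ≡ y → occurs (at [] runs (suc s)) c ≡ false} id 6
        ((λ _ _ → occurs-∉ (All¬⇒¬Any (c≢ (# 2) ∷ []))) ∷
         (λ _ _ → occurs-∉ (All¬⇒¬Any (c≢ (# 3) ∷ c≢ (# 2) ∷ []))) ∷
         (λ _ e → ⊥-elim (y≢ (# 5) (sym e))) ∷
         (λ ne → ⊥-elim (ne refl)) ∷
         (λ _ e → ⊥-elim (y≢ (# 0) (sym e))) ∷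
         (λ _ _ → occurs-∉ (All¬⇒¬Any (c≢ (# 5) ∷ c≢ (# 4) ∷ []))) ∷ [])
        where
        c≢ : ∀ j {j≢6 : False ((# 6) ≟ j)} → c ≢ lookup interior j
        c≢ j {j≢6} = apart interior-unique (# 6) j {j≢6}

      -- The list whose distinctness is R. It differs from `ring` only at position 4, so away from
      -- that position ring vertices still determine their positions.
      hubbed : List V
      hubbed = d ∷ u₁ ∷ u₂ ∷ u₃ ∷ c ∷ u₄ ∷ u₅ ∷ u₆ ∷ []

      same-in-hubbed : ∀ {t} → t < 8 → t ≢ 4 → at d ring t ≡ at d hubbed t
      same-in-hubbed = applyUpTo⁻ {P = λ t → t ≢ 4 → at d ring t ≡ at d hubbed t} id 8
        ((λ _ → refl) ∷ (λ _ → refl) ∷ (λ _ → refl) ∷ (λ _ → refl) ∷ (λ ne → ⊥-elim (ne refl)) ∷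
         (λ _ → refl) ∷ (λ _ → refl) ∷ (λ _ → refl) ∷ [])

      spoke-unique : ∀ {s t} → suc (suc s) < 8 → t < 8 → suc s ≢ t → at d ring (suc s) ≡ at d ring t →
        occurs (at [] runs (suc s)) (at a spokes′ t) ≡ false
      spoke-unique {s} {t} lt t<N s≢t e with suc s ℕ.≟ 4 | t ℕ.≟ 4
      ... | yes refl | yes refl = ⊥-elim (s≢t refl)
      ... | yes refl | no t≢4 = y-spoke t<N t≢4
      ... | no s≢4 | yes refl = spoke-y (≤-pred (≤-pred lt)) s≢4 e
      ... | no s≢4 | no t≢4 = ⊥-elim (s≢t (at-injective R (<-trans (n<1+n _) lt) t<N
              (trans (sym (same-in-hubbed (<-trans (n<1+n _) lt) s≢4)) (trans e (same-in-hubbed t<N t≢4)))))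

      surrounded : Surrounded ρ (Among 7 (at a interior)) 8 (at d ring) (at [] runs) (at a spokes′)
      surrounded = record
        { r-outside = λ t<N → outside (All-at {P = λ v → All (v ≢_) interior} {d = d} {xs = ring} (d-outside ∷ u₁-outside ∷ u₂-outside ∷ u₃-outside ∷ y-outside ∷ u₄-outside ∷ u₅-outside ∷ u₆-outside ∷ []) t<N)
        ; ring = λ lt → applyUpTo⁻ {P = λ t → Adj G (at d ring t) (at d ring (suc t))} id 7
            (SA.Δv₁du₁.uw ∷ SA.Δv₁u₁u₂.uw ∷ SA.Δv₂u₂u₃.uw ∷ Δ₁.uw ∷ Δ₂.uw ∷ SB.Δv₁u₁u₂.uw ∷ SB.Δv₂u₂u₃.uw ∷ []) (≤-pred lt)
        ; runs = λ lt → applyUpTo⁻ {P = λ t → Chain (rot ρ (at d ring (suc t))) (at d ring (suc (suc t))) (at [] runs (suc t)) (at d ring t)} id 6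
            ((SA.Δv₁u₁u₂.rot-u , SA.Δv₁du₁.rot-w) ∷
             (SA.Δv₂u₂u₃.rot-u , SA.Δv₁u₂v₂.rot-u , SA.Δv₁u₁u₂.rot-w) ∷
             (Δ₁.rot-u , SA.Δv₂u₃c.rot-u , SA.Δv₂u₂u₃.rot-w) ∷
             (Δ₂.rot-u , Δ₁.rot-w) ∷
             (SB.Δv₁u₁u₂.rot-u , SB.Δv₁du₁.rot-w , Δ₂.rot-w) ∷
             (SB.Δv₂u₂u₃.rot-u , SB.Δv₁u₂v₂.rot-u , SB.Δv₁u₁u₂.rot-w) ∷ []) (≤-pred (≤-pred lt))
        ; run-inside = λ lt → run-inside runs ([] ∷ (v₁∈ ∷ []) ∷ (v₂∈ ∷ v₁∈ ∷ []) ∷ (c∈ ∷ v₂∈ ∷ []) ∷ (c∈ ∷ []) ∷ (v₄∈ ∷ c∈ ∷ []) ∷ (v₅∈ ∷ v₄∈ ∷ []) ∷ [] ∷ []) (<-trans (n<1+n _) lt)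
        ; spoke-adj = applyUpTo⁻ {P = λ t → Adj G (at d ring t) (at a spokes′ t)} id 8
            (SA.Δadv₁.uw ∷ Adj-sym SA.Δv₁du₁.vw ∷ SA.Δv₁u₂v₂.uw ∷ Adj-sym SA.Δv₂u₂u₃.vw ∷ Adj-sym cy ∷
             Adj-sym SB.Δv₁du₁.vw ∷ SB.Δv₁u₂v₂.uw ∷ Adj-sym SB.Δv₂u₂u₃.vw ∷ [])
        ; spoke-inside = λ t<N → inside (All-at {d = a} spokes∈ t<N)
        ; spoke-run = λ lt → applyUpTo⁻ {P = λ t → occurs (at [] runs (suc t)) (at a spokes′ (suc t)) ≡ true} id 6
            (occurs-∈ {w = v₁} ([] ∷ []) (here refl) ∷ occurs-∈ v₂v₁ (here refl) ∷ occurs-∈ cv₂-unique (there (here refl)) ∷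
             occurs-∈ {w = c} ([] ∷ []) (here refl) ∷ occurs-∈ v₄c (here refl) ∷ occurs-∈ v₅v₄ (here refl) ∷ []) (≤-pred (≤-pred lt))
        ; spoke-unique = spoke-unique
        ; inside-linked = λ s<N t<N → linked (All-at {d = a} spokes∈ s<N) (All-at {d = a} spokes∈ t<N)
        }

      near-c : ∀ {w} → Adj G c w → w ∈ u₄ ∷ v₄ ∷ b ∷ a ∷ v₂ ∷ u₃ ∷ y ∷ []
      near-c = chain-covers ρ cu₄ (SB.Δv₁du₁.rot-u , SB.Δadv₁.rot-u , SA.Δacb.rot-u , SA.Δav₂c.rot-w , SA.Δv₂u₃c.rot-w , refl , rot-y)

      complete : ∀ {j w} → j < 7 → Adj G (at a interior j) w →
        ∃ λ s → s ∈ at [] (Configuration.neighbours dumbbell₇) j × w ≡ vertex (at a interior) (at d ring) s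
      complete {0} _ = ∈-map⁻ (vertex (at a interior) (at d ring)) ∘ SA.near-a
      complete {1} _ = ∈-map⁻ (vertex (at a interior) (at d ring)) ∘ SB.near-a
      complete {2} _ = ∈-map⁻ (vertex (at a interior) (at d ring)) ∘ SA.near-v₁
      complete {3} _ = ∈-map⁻ (vertex (at a interior) (at d ring)) ∘ SA.near-v₂
      complete {4} _ = ∈-map⁻ (vertex (at a interior) (at d ring)) ∘ SB.near-v₁
      complete {5} _ = ∈-map⁻ (vertex (at a interior) (at d ring)) ∘ SB.near-v₂
      complete {6} _ = ∈-map⁻ (vertex (at a interior) (at d ring)) ∘ near-c
      complete {suc (suc (suc (suc (suc (suc (suc j))))))} lt = ⊥-elim (≤⇒≯ (m≤m+n 7 j) lt)

      not-outer-colorable : ¬ Colorable G 4 → ∀ f → ¬ (∀ {u v} → Adj G u v →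
        ¬ Among 7 (at a interior) u → ¬ Among 7 (at a interior) v → f u ≢ f v)
      not-outer-colorable = Reduction.not-outer-colorable connected planar dumbbell₇ (at a interior) (at d ring)
        surrounded interior-injective complete (s≤s (s≤s z≤n)) SB.Δv₂u₃c.uw dumbbell₇-reducible

    8-neighbours : y ≢ u₄ → rot ρ c y ≢ u₄ → 8 ≤ deg G c
    8-neighbours y≢u₄ z≢u₄ = unique⇒length≤deg {G = G} {v = c} {xs = z ∷ y ∷ u₄ ∷ v₄ ∷ b ∷ a ∷ v₂ ∷ u₃ ∷ []}
      ((rot-≢ cy cu₃ (y≢ (# 5)) refl ∷ z-fresh) ∷ y-fresh ∷ six-unique)
      (All.lookup (rot-adj ρ c y cy ∷ cy ∷ cu₄ ∷ cv₄ ∷ cb ∷ ca ∷ cv₂ ∷ cu₃ ∷ []))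
      where
      z = rot ρ c y
      y-fresh : All (y ≢_) (u₄ ∷ v₄ ∷ b ∷ a ∷ v₂ ∷ u₃ ∷ [])
      y-fresh = fresh cu₃ u₃-fresh y≢u₄
      y≢ : ∀ i → y ≢ lookup (u₄ ∷ v₄ ∷ b ∷ a ∷ v₂ ∷ u₃ ∷ []) i
      y≢ i = All.lookup y-fresh (∈-lookup i)
      z-fresh : All (z ≢_) (u₄ ∷ v₄ ∷ b ∷ a ∷ v₂ ∷ u₃ ∷ [])
      z-fresh = fresh cy (y≢ (# 0) ∷ y≢ (# 1) ∷ y≢ (# 2) ∷ y≢ (# 3) ∷ y≢ (# 4) ∷ []) z≢u₄

    a-moves : ∀ {w} → Adj G a w → rot ρ a w ≢ w
    a-moves aw e with SA.near-a aw
    ... | here refl = apart SA.unique-a (# 1) (# 0) (trans (sym (proj₁ SA.chain-a)) e)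
    ... | there (here refl) = apart SA.unique-a (# 2) (# 1) (trans (sym (proj₁ (proj₂ SA.chain-a))) e)
    ... | there (there (here refl)) = apart SA.unique-a (# 3) (# 2) (trans (sym (proj₁ (proj₂ (proj₂ SA.chain-a)))) e)
    ... | there (there (there (here refl))) = apart SA.unique-a (# 4) (# 3) (trans (sym (proj₁ (proj₂ (proj₂ (proj₂ SA.chain-a))))) e)
    ... | there (there (there (there (here refl)))) = apart SA.unique-a (# 0) (# 4) (trans (sym (proj₂ (proj₂ (proj₂ (proj₂ SA.chain-a))))) e)

    OuterColoring : Set
    OuterColoring = ∃ λ (f : V → Color) → ∀ {u v} → Adj G u v →
      ¬ Among 7 (at a interior) u → ¬ Among 7 (at a interior) v → f u ≢ f v

    -- Since a is itself an inner vertex, a colouring of G - a is proper on everything outside the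
    -- disc.
    outer-colorable : eMPGN4 G → ¬ ¬ OuterColoring
    outer-colorable E k = Deletion.minimal⇒deletion-colorable G connected ρ planar chord a SA.ab a-moves E
      λ (g , g-proper) → k (fromFin ∘ g , λ uv ¬u ¬v e → g-proper uv (λ { refl → ¬u (inside a∈) }) (λ { refl → ¬v (inside a∈) })
        (trans (sym (toFin-fromFin _)) (trans (cong toFin e) (toFin-fromFin _))))

    8≤deg : eMPGN4 G → 8 ≤ deg G c
    8≤deg E = cases (y ≟ u₄) (rot ρ c y ≟ u₄)
      where
      ¬colorable : ¬ Colorable G 4
      ¬colorable = proj₂ (proj₂ (proj₁ E))
      cases : Dec (y ≡ u₄) → Dec (rot ρ c y ≡ u₄) → 8 ≤ deg G c
      cases (yes y≡u₄) _ = ⊥-elim (outer-colorable E λ (f , proper) →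
        Degree₆.not-outer-colorable y≡u₄ ¬colorable f proper)
      cases (no y≢u₄) (yes rot-y) = ⊥-elim (outer-colorable E λ (f , proper) →
        Degree₇.not-outer-colorable y≢u₄ rot-y ¬colorable f proper)
      cases (no y≢u₄) (no z≢u₄) = 8-neighbours y≢u₄ z≢u₄

  both-hubs : eMPGN4 G →
    (a b c d v₁ v₂ v₄ v₅ u₁ u₂ u₃ u₄ u₅ u₆ : V) →
    Adj G a b → deg G a ≡ 5 → deg G b ≡ 5 →
    rot ρ a b ≡ d → rot ρ a d ≡ v₁ → rot ρ a v₁ ≡ v₂ → rot ρ a v₂ ≡ c → rot ρ a c ≡ b →
    rot ρ b a ≡ c → rot ρ b c ≡ v₄ → rot ρ b v₄ ≡ v₅ → rot ρ b v₅ ≡ d → rot ρ b d ≡ a →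
    deg G v₁ ≡ 5 → deg G v₂ ≡ 5 → deg G v₄ ≡ 5 → deg G v₅ ≡ 5 →
    rot ρ v₁ d ≡ u₁ → rot ρ v₁ u₁ ≡ u₂ → rot ρ v₁ u₂ ≡ v₂ →
    rot ρ v₂ v₁ ≡ u₂ → rot ρ v₂ u₂ ≡ u₃ → rot ρ v₂ u₃ ≡ c →
    rot ρ v₄ c ≡ u₄ → rot ρ v₄ u₄ ≡ u₅ → rot ρ v₄ u₅ ≡ v₅ →
    rot ρ v₅ v₄ ≡ u₅ → rot ρ v₅ u₅ ≡ u₆ → rot ρ v₅ u₆ ≡ d →
    Unique (d ∷ u₁ ∷ u₂ ∷ u₃ ∷ c ∷ u₄ ∷ u₅ ∷ u₆ ∷ []) →
    8 ≤ deg G c × 8 ≤ deg G d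
  both-hubs E a b c d v₁ v₂ v₄ v₅ u₁ u₂ u₃ u₄ u₅ u₆ ab deg-a deg-b
    a₀ a₁ a₂ a₃ a₄ b₀ b₁ b₂ b₃ b₄ deg-v₁ deg-v₂ deg-v₄ deg-v₅
    v₁₀ v₁₁ v₁₂ v₂₀ v₂₁ v₂₂ v₄₀ v₄₁ v₄₂ v₅₀ v₅₁ v₅₂ R =
    Around.8≤deg A B R E , Around.8≤deg B A (ring-swap R) E
    where
    A : Side a b c d v₁ v₂ u₁ u₂ u₃
    A = record { ab = ab ; deg-a = deg-a ; chain-a = a₀ , a₁ , a₂ , a₃ , a₄ ; deg-v₁ = deg-v₁ ; deg-v₂ = deg-v₂
      ; outer-v₁ = v₁₀ , v₁₁ , v₁₂ ; outer-v₂ = v₂₀ , v₂₁ , v₂₂ }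
    B : Side b a d c v₄ v₅ u₄ u₅ u₆
    B = record { ab = Adj-sym ab ; deg-a = deg-b ; chain-a = b₀ , b₁ , b₂ , b₃ , b₄ ; deg-v₁ = deg-v₄ ; deg-v₂ = deg-v₅
      ; outer-v₁ = v₄₀ , v₄₁ , v₄₂ ; outer-v₂ = v₅₀ , v₅₁ , v₅₂ }

theorem4p3 : ∀ {n} (G : Graph n) → eMPGN4 G →
    (ρ : Rotation G) → PlanarRot ρ →
    (a b c d v₁ v₂ v₄ v₅ u₁ u₂ u₃ u₄ u₅ u₆ : Fin n) →
    Adj G a b → deg G a ≡ 5 → deg G b ≡ 5 →
    rot ρ a b ≡ d → rot ρ a d ≡ v₁ → rot ρ a v₁ ≡ v₂ → rot ρ a v₂ ≡ c → rot ρ a c ≡ b →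
    rot ρ b a ≡ c → rot ρ b c ≡ v₄ → rot ρ b v₄ ≡ v₅ → rot ρ b v₅ ≡ d → rot ρ b d ≡ a →
    deg G v₁ ≡ 5 → deg G v₂ ≡ 5 → deg G v₄ ≡ 5 → deg G v₅ ≡ 5 →
    rot ρ v₁ d ≡ u₁ → rot ρ v₁ u₁ ≡ u₂ → rot ρ v₁ u₂ ≡ v₂ →
    rot ρ v₂ v₁ ≡ u₂ → rot ρ v₂ u₂ ≡ u₃ → rot ρ v₂ u₃ ≡ c →
    rot ρ v₄ c ≡ u₄ → rot ρ v₄ u₄ ≡ u₅ → rot ρ v₄ u₅ ≡ v₅ →
    rot ρ v₅ v₄ ≡ u₅ → rot ρ v₅ u₅ ≡ u₆ → rot ρ v₅ u₆ ≡ d →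
    Unique (d ∷ u₁ ∷ u₂ ∷ u₃ ∷ c ∷ u₄ ∷ u₅ ∷ u₆ ∷ []) →
    8 ≤ deg G c × 8 ≤ deg G d
-- A single vertex carries no edge; `Deletion` works with at least two vertices.
theorem4p3 {suc zero} G _ ρ _ zero zero _ _ _ _ _ _ _ _ _ _ _ _ ab = ⊥-elim (Faces.Adj⇒≢ G ρ ab refl)
theorem4p3 {suc (suc n″)} G E@((connected , _) , mpg , _) ρ planar =
  Dumbbell.both-hubs G connected ρ planar (mpg-chord G connected mpg ρ planar) E
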